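{- There exists an algorithm that, given (with probe access) a graph $G=(V,E)$ with maximum degree $\Delta\ge1$ and an integer $q\ge65\Delta$, a partial proper $q$-coloring $\sigma\in[q]^\Lambda$ of a subset of vertices $\Lambda\subset V$, a vertex $v\in V\setminus\Lambda$, and parameters $\varepsilon,\delta\in(0,1)$, outputs an estimate $\hat\mu_v^\sigma$ such that $$\Pr\left[\forall c\in[q]:\ (1-\varepsilon)\mu_v^\sigma(c)\le\hat\mu_v^\sigma(c)\le(1+\varepsilon)\mu_v^\sigma(c)\right]\ge1-\delta,$$ where $\mu$ denotes the uniform distribution over all proper $q$-colorings of $G$, in expected time $O\left(\varepsilon^{ -2}\delta^{ -1}\Delta^2q^3|\Lambda|\right)$.
   Context: A proper $q$-coloring of a finite graph $G=(V,E)$ is a map $\tau:V\to[q]$ with $\tau(u)\ne\tau(w)$ for all $(u,w)\in E$; a partial proper $q$-coloring of $\Lambda$ is $\sigma\in[q]^\Lambda$ with $\sigma(u)\neq\sigma(w)$ for every edge $(u,w)\in E$ with $u,w\in\Lambda$. For $v\in V\setminus\Lambda$, the conditional marginal distribution is $\mu_v^\sigma(c)=\Pr_{\tau\sim\mu}[\tau_v=c\mid\tau_\Lambda=\sigma]$ for $c\in[q]$. Probe access means: for each $v\in V$, each neighbor of $v$ can be accessed in $O(1)$ time.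
   Formalization: In the time bound |Λ| is read as max(|Λ|,1), since for empty Λ the literal bound is 0, which no algorithm meets; the input parameters ε and δ are rational numbers in (0,1), given by numerator and denominator. -}

module Defs where

open import Level using (0ℓ)
open import Data.Bool using (if_then_else_; _∧_)
open import Data.Nat as ℕ using (ℕ; zero; suc; _∸_; _≡ᵇ_; _⊔_)
open import Data.Integer as ℤ using (+_; ∣_∣)
open import Data.Rational as ℚ using (ℚ; 0ℚ; 1ℚ; _/_; _÷_; 1/_; ↥_; ↧ₙ_; Positive; ≢-nonZero)
import Data.Rational.Properties as ℚ
open import Data.Fin as Fin using (Fin; toℕ; fromℕ<)
import Data.Fin.Properties as Fin
open import Data.List using (List; []; _∷_; map; filter; length; allFin)
open import Data.List.Extrema.Nat using (max)
open import Data.List.Membership.Propositional using (_∈_)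
open import Data.List.Relation.Unary.All as All using (All)
open import Data.List.Relation.Unary.Unique.Propositional using (Unique)
open import Data.Product using (∃; _×_; _,_; proj₁; proj₂)
open import Function using (_∘_; _⇔_; const)
open import Relation.Binary using (Rel; Symmetric; Irreflexive) renaming (Decidable to Decidable₂)
open import Relation.Binary.PropositionalEquality using (_≡_; _≢_)
open import Relation.Nullary using (Dec; yes; no; ¬?; _→-dec_; _×-dec_)
open import Relation.Unary using (Pred; Decidable; _∩_)
open import Relation.Unary.Properties using (_∩?_)
open import Algebra.Properties.CommutativeMonoid.Sum ℚ.+-0-commutativeMonoid using (sum)

fromℕ : ℕ → ℚ
fromℕ k = + k / 1

-- Division with the convention p / 0 = 0.
infixl 7 _÷₀_
_÷₀_ : ℚ → ℚ → ℚ
p ÷₀ r with r ℚ.≟ 0ℚ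
... | yes _   = 0ℚ
... | no  r≢0 = _÷_ p r {{≢-nonZero r≢0}}

------------------------------------------------------------------------
-- Graphs and colorings

record Graph (n : ℕ) : Set₁ where
  field
    E      : Rel (Fin n) 0ℓ
    E?     : Decidable₂ E
    sym    : Symmetric E
    irrefl : Irreflexive _≡_ E

  degree : Fin n → ℕ
  degree v = length (filter (E? v) (allFin n))

  maxDegree : ℕ
  maxDegree = max 0 (map degree (allFin n))

Coloring : ℕ → ℕ → Set
Coloring n q = Fin n → Fin q

module _ {n : ℕ} (G : Graph n) where
  open Graph G

  -- The order in which neighbors are listed is arbitrary.
  record AdjacencyLists : Set where
    field
      neighbors : Fin n → List (Fin n)
      unique    : ∀ u → Unique (neighbors u)
      correct   : ∀ u w → w ∈ neighbors u ⇔ E u w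

  module _ (q : ℕ) where

    Proper : Pred (Coloring n q) 0ℓ
    Proper τ = ∀ u w → E u w → τ u ≢ τ w

    proper? : Decidable Proper
    proper? τ = Fin.all? λ u → Fin.all? λ w → E? u w →-dec ¬? (τ u Fin.≟ τ w)

    properColorings : List (Coloring n q)
    properColorings = filter proper? (map Fin.finToFun (allFin (q ℕ.^ n)))

    -- A partial coloring, as the graph of a function on Λ, listed in an
    -- arbitrary order.
    record PartialProperColoring : Set where
      field
        entries : List (Fin n × Fin q)

      Λ : List (Fin n)
      Λ = map proj₁ entries

      field
        unique : Unique Λ
        proper : ∀ {u w a b} → (u , a) ∈ entries → (w , b) ∈ entries →
                 E u w → a ≢ b

      Extends : Pred (Coloring n q) 0ℓ
      Extends τ = All (λ (u , a) → τ u ≡ a) entries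

      extends? : Decidable Extends
      extends? τ = All.all? (λ (u , a) → τ u Fin.≟ a) entries

    -- μ-probability of an event, for μ uniform on the proper colorings.
    μ : {A : Pred (Coloring n q) 0ℓ} → Decidable A → ℚ
    μ A? = fromℕ (length (filter A? properColorings)) ÷₀ fromℕ (length properColorings)

    -- When q exceeds the maximum degree, every partial proper coloring
    -- extends to a proper coloring, so the conditioning event has positive
    -- probability and the convention for division by zero is not used.
    marginal : PartialProperColoring → Fin n → Fin q → ℚ
    marginal σ v c = μ ((λ τ → τ v Fin.≟ c) ∩? extends?) ÷₀ μ extends?
      where open PartialProperColoring σ

------------------------------------------------------------------------
-- A randomized random-access machine with probe access to a graph
--
-- Memory consists of ℕ-indexed arrays of natural numbers.  Array names occur
-- as constants in programs, so a program uses finitely many arrays.  Indirect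
-- addressing is available within an array.  Addition and truncated
-- subtraction are the only arithmetic operations: each statement costs one
-- unit irrespective of operand size, and unit-cost multiplication of
-- unbounded numbers would make the machine unreasonably powerful.

Memory : Set
Memory = ℕ → ℕ → ℕ

data Expr : Set where
  lit  : ℕ → Expr
  read : (array : ℕ) → Expr → Expr
  _⊕_  : Expr → Expr → Expr
  _⊖_  : Expr → Expr → Expr

data Stmt : Set where
  assign : (array : ℕ) → Expr → Expr → Stmt
  -- random a i e stores a uniform element of {0, …, e} in a[i].
  random : (array : ℕ) → Expr → Expr → Stmt
  -- probe a i u j stores the answer to a probe for the j-th neighbor of u.
  probe  : (array : ℕ) → Expr → Expr → Expr → Stmt
  _⨾_    : Stmt → Stmt → Stmt
  ifnz   : Expr → Stmt → Stmt → Stmt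
  while  : Expr → Stmt → Stmt

eval : Memory → Expr → ℕ
eval m (lit k)    = k
eval m (read a e) = m a (eval m e)
eval m (d ⊕ e)    = eval m d ℕ.+ eval m e
eval m (d ⊖ e)    = eval m d ∸ eval m e

write : Memory → ℕ → ℕ → ℕ → Memory
write m a i x b j = if (b ≡ᵇ a) ∧ (j ≡ᵇ i) then x else m b j

-- The list of statements still to be executed, and the memory.
Config : Set
Config = List Stmt × Memory

-- branch k f moves to f i for i uniform in Fin (suc k).
data Transition : Set where
  halt   : Memory → Transition
  branch : (k : ℕ) → (Fin (suc k) → Config) → Transition

goto : Config → Transition
goto c = branch 0 (const c)

-- An oracle maps u and j to the answer to a probe for the j-th neighbor of u.
Oracle : Set
Oracle = ℕ → ℕ → ℕ

transition : Oracle → Config → Transition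
transition O ([] , m)                 = halt m
transition O (assign a i e ∷ ss , m)  = goto (ss , write m a (eval m i) (eval m e))
transition O (random a i e ∷ ss , m)  =
  branch (eval m e) λ x → ss , write m a (eval m i) (toℕ x)
transition O (probe a i u j ∷ ss , m) =
  goto (ss , write m a (eval m i) (O (eval m u) (eval m j)))
transition O (s ⨾ t ∷ ss , m)         = goto (s ∷ t ∷ ss , m)
transition O (ifnz e s t ∷ ss , m)    =
  goto ((if eval m e ≡ᵇ 0 then t else s) ∷ ss , m)
transition O (while e s ∷ ss , m)     =
  goto ((if eval m e ≡ᵇ 0 then ss else s ∷ while e s ∷ ss) , m)

mean : (k : ℕ) → (Fin (suc k) → ℚ) → ℚ
mean k f = (+ 1 / suc k) ℚ.* sum f

indicator : {A : Set} → Dec A → ℚ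
indicator (yes _) = 1ℚ
indicator (no  _) = 0ℚ

-- With T the (random, possibly infinite) number of steps before halting:

-- the probability that T < t and the final memory satisfies P;
haltProbability : Oracle → {P : Pred Memory 0ℓ} → Decidable P → Config → ℕ → ℚ
haltProbability O P? c zero    = 0ℚ
haltProbability O P? c (suc t) with transition O c
... | halt m     = indicator (P? m)
... | branch k f = mean k λ i → haltProbability O P? (f i) t

-- the expectation of min(T, t).
expectedSteps : Oracle → Config → ℕ → ℚ
expectedSteps O c zero    = 0ℚ
expectedSteps O c (suc t) with transition O c
... | halt _     = 0ℚ
... | branch k f = 1ℚ ℚ.+ mean k λ i → expectedSteps O (f i) t

-- Both sequences above are nondecreasing in t.  The probability that the
-- machine halts with P, and the expectation of T, are their suprema.
_≤sup_ : ℚ → (ℕ → ℚ) → Set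
p ≤sup f = ∀ (η : ℚ) → 0ℚ ℚ.< η → ∃ λ t → p ℚ.- η ℚ.≤ f t

sup_≤_ : (ℕ → ℚ) → ℚ → Set
sup f ≤ b = ∀ t → f t ℚ.≤ b

------------------------------------------------------------------------
-- Input and output

entry : List ℕ → ℕ → ℕ
entry []       i       = 0
entry (x ∷ xs) zero    = x
entry (x ∷ xs) (suc i) = entry xs i

module _ {n : ℕ} {G : Graph n} where

  -- The answer is 1 + w if the j-th neighbor of u is w, and 0 if u is not a
  -- vertex or has at most j neighbors.
  oracle : AdjacencyLists G → Oracle
  oracle adj u j with u ℕ.<? n
  ... | yes u<n = entry (map (suc ∘ toℕ) (AdjacencyLists.neighbors adj (fromℕ< u<n))) j
  ... | no  _   = 0

  input : (q : ℕ) → PartialProperColoring G q → Fin n → ℚ → ℚ → Memory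
  input q σ v ε δ = λ where
      0 → entry (n ∷ Graph.maxDegree G ∷ q ∷ toℕ v ∷ length entries ∷
                 ∣ ↥ ε ∣ ∷ ↧ₙ ε ∷ ∣ ↥ δ ∣ ∷ ↧ₙ δ ∷ [])
      1 → entry (map (toℕ ∘ proj₁) entries)
      2 → entry (map (toℕ ∘ proj₂) entries)
      _ → const 0
    where open PartialProperColoring σ

-- The output is in array 3: a common denominator followed by one numerator
-- for each color.
estimate : {q : ℕ} → Memory → Fin q → ℚ
estimate m c = fromℕ (m 3 (suc (toℕ c))) ÷₀ fromℕ (m 3 0)

Accurate : {q : ℕ} → ℚ → (Fin q → ℚ) → Pred Memory 0ℓ
Accurate ε p m = ∀ c → (1ℚ ℚ.- ε) ℚ.* p c ℚ.≤ estimate m c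
                     × estimate m c ℚ.≤ (1ℚ ℚ.+ ε) ℚ.* p c

accurate? : {q : ℕ} (ε : ℚ) (p : Fin q → ℚ) → Decidable (Accurate ε p)
accurate? ε p m = Fin.all? λ c →
  ((1ℚ ℚ.- ε) ℚ.* p c ℚ.≤? estimate m c) ×-dec
  (estimate m c ℚ.≤? (1ℚ ℚ.+ ε) ℚ.* p c)

-- ε⁻² δ⁻¹ Δ² q³ |Λ|, with |Λ| read as 1 when Λ is empty: no algorithm runs in
-- time 0.
timeBound : (ε δ : ℚ) .{{_ : Positive ε}} .{{_ : Positive δ}} (Δ q ∣Λ∣ : ℕ) → ℚ
timeBound ε δ Δ q ∣Λ∣ =
  inv ε ℚ.* inv ε ℚ.* inv δ ℚ.* fromℕ (Δ ℕ.^ 2 ℕ.* q ℕ.^ 3 ℕ.* (∣Λ∣ ⊔ 1))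
  where
  inv : (p : ℚ) .{{_ : Positive p}} → ℚ
  inv p = (1/ p) {{ℚ.pos⇒nonZero p}}

{-# OPTIONS --safe #-}
-- For a partial coloring p extending σ let Z p be the number of proper colorings
-- that extend p.  If p x = c, then recoloring x shows that
--
--   q Z p = #{τ ⊇ p without x : no neighbor of x has color c}
--           + Σ (over colors c′) #{τ ⊇ p : some neighbor of x has color c′},
--
-- and inclusion-exclusion over the last neighbor of a given color turns both
-- counts into sums over partial colorings with one vertex fewer or more.  After
-- scaling by 4 H per vertex added to σ, where H = ⌊q / 16⌋, the coefficients of
-- this linear system have absolute sum at most 5/8 per row, because q ≥ 65 Δ.  So
-- the signed, killed random walk on partial colorings with these coefficients
-- has an expected number of O(1) steps of O(Δ) time each, and its final sign (0
-- if killed) is an unbiased estimate of 4 H μ_v(c) when it starts from σ with v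
-- colored c.  For a color c that is not blocked by σ this mean is at least 1/8,
-- so 64 q ⌈1/ε⌉² ⌈1/δ⌉ walks per color and Chebyshev's inequality suffice; a
-- blocked color is recognized in the first step.
--
-- Probabilities and running times are bounded by potentials: a function of the
-- configurations that decreases in expectation along each step bounds the
-- expected final reward.  The potential (S - N g)² of the sum S of the signs
-- yields Chebyshev's inequality.
module Submission where

open import Defs
open import Level using (0ℓ)
open import Data.Bool using (Bool; true; false; if_then_else_; _∧_)
open import Data.Nat as ℕ using (ℕ; zero; suc; z≤n; s≤s; z<s; s<s; s≤s⁻¹; _∸_; _≡ᵇ_; _⊔_)
import Data.Nat.Properties as ℕ
import Data.Nat.Tactic.RingSolver as ℕ-Ring
open import Data.Integer as ℤ using (+[1+_]; -[1+_])
import Data.Integer.Properties as ℤ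
open import Data.Rational as ℚ using (ℚ; mkℚ; 0ℚ; 1ℚ; ½; Positive; 1/_; ↥_; ↧ₙ_; *≤*)
import Data.Rational.Properties as ℚ
import Data.Rational.Unnormalised as ℚᵘ
import Data.Rational.Unnormalised.Properties as ℚᵘ
open import Data.Fin as Fin using (Fin; toℕ; fromℕ<)
import Data.Fin.Properties as Fin
open import Data.List using (List; []; _∷_; map; filter; length; allFin; drop; _++_; lookup)
import Data.List.Properties as List
open import Data.List.Membership.Propositional using (_∈_; _∉_; find; lose)
open import Data.List.Membership.Propositional.Properties using (∈-map⁺; ∈-map⁻; ∈-filter⁺; ∈-allFin)
open import Data.List.Relation.Unary.Any as Any using (Any; here; there; any?)
import Data.List.Relation.Unary.Any.Properties as Any
open import Data.List.Relation.Unary.All as All using (All; []; _∷_)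
open import Data.List.Relation.Unary.AllPairs using (_∷_)
open import Data.List.Relation.Unary.Unique.Propositional using (Unique)
open import Data.List.Extrema.Nat using (xs≤max)
open import Data.Product using (∃; ∃₂; _×_; _,_; proj₁; proj₂)
open import Data.Sum using (_⊎_; inj₁; inj₂)
open import Data.Empty using (⊥; ⊥-elim)
open import Data.Unit using (⊤; tt)
open import Data.Maybe using (Maybe; just; nothing)
open import Function using (_∘_; const; id; case_of_; Equivalence)
open import Relation.Binary.PropositionalEquality using (_≡_; _≢_; _≗_; refl; sym; trans; cong; cong₂; subst; subst₂; module ≡-Reasoning)
open import Relation.Nullary using (Dec; yes; no; ¬_; ¬?; _×-dec_; contradiction)
open import Relation.Nullary.Decidable using (dec⇒maybe)
open import Relation.Unary using (Pred; Decidable)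
import Tactic.RingSolver as RingSolver
import Tactic.RingSolver.Core.AlmostCommutativeRing as ACR

module Rationals where

  open import Algebra.Properties.CommutativeMonoid.Sum ℚ.+-0-commutativeMonoid using (sum; sum-cong-≗)
  open import Data.Rational using (_+_; _*_; _-_; -_; _≤_; _<_)

  ℚ-ring : ACR.AlmostCommutativeRing 0ℓ 0ℓ
  ℚ-ring = ACR.fromCommutativeRing ℚ.+-*-commutativeRing (λ x → dec⇒maybe (0ℚ ℚ.≟ x))

  p≤q⇒0≤q-p : ∀ {p q} → p ≤ q → 0ℚ ≤ q - p
  p≤q⇒0≤q-p {p} {q} p≤q = subst (_≤ q - p) (ℚ.+-inverseʳ p) (ℚ.+-monoˡ-≤ (- p) p≤q)

  0≤q-p⇒p≤q : ∀ {p q} → 0ℚ ≤ q - p → p ≤ q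
  0≤q-p⇒p≤q {p} {q} h = subst₂ _≤_ (ℚ.+-identityˡ p) (lemma q p) (ℚ.+-monoˡ-≤ p h)
    where
    lemma : ∀ q p → q - p + p ≡ q
    lemma = RingSolver.solve-∀ ℚ-ring

  *-monoˡ : ∀ {r p q} → 0ℚ ≤ r → p ≤ q → r * p ≤ r * q
  *-monoˡ {r} 0≤r = ℚ.*-monoˡ-≤-nonNeg r {{ℚ.nonNegative 0≤r}}

  *-monoʳ : ∀ {r p q} → 0ℚ ≤ r → p ≤ q → p * r ≤ q * r
  *-monoʳ {r} 0≤r = ℚ.*-monoʳ-≤-nonNeg r {{ℚ.nonNegative 0≤r}}

  0≤+ : ∀ {p q} → 0ℚ ≤ p → 0ℚ ≤ q → 0ℚ ≤ p + q
  0≤+ 0≤p 0≤q = ℚ.+-mono-≤ 0≤p 0≤q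

  0≤* : ∀ {p q} → 0ℚ ≤ p → 0ℚ ≤ q → 0ℚ ≤ p * q
  0≤* {p} {q} 0≤p 0≤q = subst (_≤ p * q) (ℚ.*-zeroʳ p) (*-monoˡ 0≤p 0≤q)

  *-mono : ∀ {p q r s} → 0ℚ ≤ r → 0ℚ ≤ q → p ≤ q → r ≤ s → p * r ≤ q * s
  *-mono 0≤r 0≤q p≤q r≤s = ℚ.≤-trans (*-monoʳ 0≤r p≤q) (*-monoˡ 0≤q r≤s)

  *-cancelˡ-≤ : ∀ {r p q} → 0ℚ < r → r * p ≤ r * q → p ≤ q
  *-cancelˡ-≤ {r} 0<r = ℚ.*-cancelˡ-≤-pos r {{ℚ.positive 0<r}}

  *-cancelˡ : ∀ {r p q} → 0ℚ < r → r * p ≡ r * q → p ≡ q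
  *-cancelˡ 0<r eq = ℚ.≤-antisym (*-cancelˡ-≤ 0<r (ℚ.≤-reflexive eq))
                                 (*-cancelˡ-≤ 0<r (ℚ.≤-reflexive (sym eq)))

  0≤p² : ∀ p → 0ℚ ≤ p * p
  0≤p² p with ℚ.≤-total 0ℚ p
  ... | inj₁ 0≤p = 0≤* 0≤p 0≤p
  ... | inj₂ p≤0 = subst (0ℚ ≤_) (lemma p) (0≤* 0≤-p 0≤-p)
    where
    0≤-p : 0ℚ ≤ - p
    0≤-p = ℚ.neg-antimono-≤ p≤0
    lemma : ∀ p → (- p) * (- p) ≡ p * p
    lemma = RingSolver.solve-∀ ℚ-ring

  fromℕ-mono : ∀ {m n} → m ℕ.≤ n → fromℕ m ≤ fromℕ n
  fromℕ-mono {m} {n} m≤n = ℚ.toℚᵘ-cancel-≤ (begin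
    ℚ.toℚᵘ (fromℕ m) ≃⟨ ℚ.toℚᵘ-fromℚᵘ (ℚᵘ.mkℚᵘ (ℤ.+ m) 0) ⟩
    ℚᵘ.mkℚᵘ (ℤ.+ m) 0  ≤⟨ ℚᵘ.*≤* (ℤ.*-monoʳ-≤-nonNeg (ℤ.+ 1) (ℤ.+≤+ m≤n)) ⟩
    ℚᵘ.mkℚᵘ (ℤ.+ n) 0  ≃⟨ ℚ.toℚᵘ-fromℚᵘ (ℚᵘ.mkℚᵘ (ℤ.+ n) 0) ⟨
    ℚ.toℚᵘ (fromℕ n) ∎)
    where open ℚᵘ.≤-Reasoning

  fromℕ-+ : ∀ m n → fromℕ (m ℕ.+ n) ≡ fromℕ m + fromℕ n
  fromℕ-+ m n = ℚ.toℚᵘ-injective (begin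
    ℚ.toℚᵘ (fromℕ (m ℕ.+ n))                       ≈⟨ ℚ.toℚᵘ-fromℚᵘ (ℚᵘ.mkℚᵘ (ℤ.+ (m ℕ.+ n)) 0) ⟩
    ℚᵘ.mkℚᵘ (ℤ.+ (m ℕ.+ n)) 0                        ≈⟨ ℚᵘ.*≡*
        (cong (ℤ._* ℤ.+ 1) (sym (cong₂ ℤ._+_ (ℤ.*-identityʳ (ℤ.+ m)) (ℤ.*-identityʳ (ℤ.+ n))))) ⟩
    ℚᵘ.mkℚᵘ (ℤ.+ m) 0 ℚᵘ.+ ℚᵘ.mkℚᵘ (ℤ.+ n) 0           ≈⟨ ℚᵘ.+-cong (ℚ.toℚᵘ-fromℚᵘ (ℚᵘ.mkℚᵘ (ℤ.+ m) 0))
        (ℚ.toℚᵘ-fromℚᵘ (ℚᵘ.mkℚᵘ (ℤ.+ n) 0)) ⟨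
    ℚ.toℚᵘ (fromℕ m) ℚᵘ.+ ℚ.toℚᵘ (fromℕ n)         ≈⟨ ℚ.toℚᵘ-homo-+ (fromℕ m) (fromℕ n) ⟨
    ℚ.toℚᵘ (fromℕ m + fromℕ n)                     ∎)
    where open ℚᵘ.≃-Reasoning

  fromℕ-* : ∀ m n → fromℕ (m ℕ.* n) ≡ fromℕ m * fromℕ n
  fromℕ-* zero    n = sym (ℚ.*-zeroˡ (fromℕ n))
  fromℕ-* (suc m) n = begin
    fromℕ (n ℕ.+ m ℕ.* n)         ≡⟨ fromℕ-+ n (m ℕ.* n) ⟩
    fromℕ n + fromℕ (m ℕ.* n)     ≡⟨ cong (fromℕ n +_) (fromℕ-* m n) ⟩
    fromℕ n + fromℕ m * fromℕ n   ≡⟨ lemma (fromℕ n) (fromℕ m) ⟩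
    (1ℚ + fromℕ m) * fromℕ n      ≡⟨ cong (_* fromℕ n) (fromℕ-+ 1 m) ⟨
    fromℕ (suc m) * fromℕ n       ∎
    where
    open ≡-Reasoning
    lemma : ∀ n m → n + m * n ≡ (1ℚ + m) * n
    lemma = RingSolver.solve-∀ ℚ-ring

  0≤fromℕ : ∀ n → 0ℚ ≤ fromℕ n
  0≤fromℕ n = fromℕ-mono {0} {n} z≤n

  0<fromℕ : ∀ {n} → 0 ℕ.< n → 0ℚ < fromℕ n
  0<fromℕ {n} 0<n = ℚ.<-≤-trans (ℚ.positive⁻¹ 1ℚ) (fromℕ-mono 0<n)

  fromℕ-∸ : ∀ {m n} → n ℕ.≤ m → fromℕ (m ∸ n) ≡ fromℕ m - fromℕ n
  fromℕ-∸ {m} {n} n≤m = begin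
    fromℕ (m ∸ n)                       ≡⟨ lemma (fromℕ (m ∸ n)) (fromℕ n) ⟩
    fromℕ (m ∸ n) + fromℕ n - fromℕ n   ≡⟨ cong (_- fromℕ n) (fromℕ-+ (m ∸ n) n) ⟨
    fromℕ (m ∸ n ℕ.+ n) - fromℕ n       ≡⟨ cong (λ k → fromℕ k - fromℕ n) (ℕ.m∸n+n≡m n≤m) ⟩
    fromℕ m - fromℕ n                   ∎
    where
    open ≡-Reasoning
    lemma : ∀ x y → x ≡ x + y - y
    lemma = RingSolver.solve-∀ ℚ-ring

  1/1+ : ℕ → ℚ
  1/1+ k = ℤ.+ 1 ℚ./ suc k

  1/suc-inverse : ∀ k → fromℕ (suc k) * (1/1+ k) ≡ 1ℚ
  1/suc-inverse k = ℚ.toℚᵘ-injective (begin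
    ℚ.toℚᵘ (fromℕ (suc k) * (1/1+ k))                     ≈⟨ ℚ.toℚᵘ-homo-* (fromℕ (suc k)) (1/1+ k) ⟩
    ℚ.toℚᵘ (fromℕ (suc k)) ℚᵘ.* ℚ.toℚᵘ (1/1+ k)           ≈⟨ ℚᵘ.*-cong (ℚ.toℚᵘ-fromℚᵘ (ℚᵘ.mkℚᵘ (ℤ.+ suc k) 0))
        (ℚ.toℚᵘ-fromℚᵘ (ℚᵘ.mkℚᵘ (ℤ.+ 1) k)) ⟩
    ℚᵘ.mkℚᵘ (ℤ.+ suc k) 0 ℚᵘ.* ℚᵘ.mkℚᵘ (ℤ.+ 1) k                     ≈⟨ ℚᵘ.*≡* (lemma (ℤ.+ suc k)) ⟩
    ℚ.toℚᵘ 1ℚ                                                    ∎)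
    where
    open ℚᵘ.≃-Reasoning
    lemma : ∀ x → x ℤ.* ℤ.+ 1 ℤ.* ℤ.+ 1 ≡ ℤ.+ 1 ℤ.* (ℤ.+ 1 ℤ.* x)
    lemma x = trans (ℤ.*-identityʳ (x ℤ.* ℤ.+ 1)) (trans (ℤ.*-identityʳ x)
                (sym (trans (ℤ.*-identityˡ (ℤ.+ 1 ℤ.* x)) (ℤ.*-identityˡ x))))

  ∑ : ℕ → (ℕ → ℚ) → ℚ
  ∑ zero    h = 0ℚ
  ∑ (suc N) h = h 0 + ∑ N (h ∘ suc)

  ∑-cong : ∀ N {g h} → g ≗ h → ∑ N g ≡ ∑ N h
  ∑-cong zero    eq = refl
  ∑-cong (suc N) eq = cong₂ _+_ (eq 0) (∑-cong N (eq ∘ suc))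

  ∑-zero : ∀ N → ∑ N (const 0ℚ) ≡ 0ℚ
  ∑-zero zero    = refl
  ∑-zero (suc N) = trans (ℚ.+-identityˡ _) (∑-zero N)

  ∑-linear : ∀ N a (v : ℕ → ℚ) b w → ∑ N (λ i → a * v i + b * w i) ≡ a * ∑ N v + b * ∑ N w
  ∑-linear zero    a v b w = lemma a b
    where
    lemma : ∀ a b → 0ℚ ≡ a * 0ℚ + b * 0ℚ
    lemma = RingSolver.solve-∀ ℚ-ring
  ∑-linear (suc N) a v b w = trans (cong (a * v 0 + b * w 0 +_) (∑-linear N a (v ∘ suc) b (w ∘ suc)))
                                   (lemma a b (v 0) (w 0) (∑ N (v ∘ suc)) (∑ N (w ∘ suc)))
    where
    lemma : ∀ a b v w V W → a * v + b * w + (a * V + b * W) ≡ a * (v + V) + b * (w + W)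
    lemma = RingSolver.solve-∀ ℚ-ring

  ∑-const : ∀ N c → ∑ N (const c) ≡ fromℕ N * c
  ∑-const zero    c = sym (ℚ.*-zeroˡ c)
  ∑-const (suc N) c = trans (cong (c +_) (∑-const N c))
                     (trans (lemma c (fromℕ N)) (cong (_* c) (sym (fromℕ-+ 1 N))))
    where
    lemma : ∀ c n → c + n * c ≡ (1ℚ + n) * c
    lemma = RingSolver.solve-∀ ℚ-ring

  avg : ℕ → (ℕ → ℚ) → ℚ
  avg k h = (1/1+ k) * ∑ (suc k) h

  0≤1/suc : ∀ k → 0ℚ ≤ 1/1+ k
  0≤1/suc k = *-cancelˡ-≤ (0<fromℕ {suc k} z<s)
    (subst₂ _≤_ (sym (ℚ.*-zeroʳ (fromℕ (suc k)))) (sym (1/suc-inverse k)) (ℚ.<⇒≤ (ℚ.positive⁻¹ 1ℚ)))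

  avg-∑ : ∀ k h → fromℕ (suc k) * avg k h ≡ ∑ (suc k) h
  avg-∑ k h = trans (sym (ℚ.*-assoc (fromℕ (suc k)) (1/1+ k) _))
             (trans (cong (_* ∑ (suc k) h) (1/suc-inverse k)) (ℚ.*-identityˡ _))

  avg-cong : ∀ k {g h} → g ≗ h → avg k g ≡ avg k h
  avg-cong k eq = cong ((1/1+ k) *_) (∑-cong (suc k) eq)

  avg-linear : ∀ k a (v : ℕ → ℚ) b w → avg k (λ i → a * v i + b * w i) ≡ a * avg k v + b * avg k w
  avg-linear k a v b w = trans (cong (1/1+ k *_) (∑-linear (suc k) a v b w))
      (lemma (1/1+ k) a b (∑ (suc k) v) (∑ (suc k) w))
    where
    lemma : ∀ r a b v w → r * (a * v + b * w) ≡ a * (r * v) + b * (r * w)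
    lemma = RingSolver.solve-∀ ℚ-ring

  avg-const : ∀ k c → avg k (const c) ≡ c
  avg-const k c = *-cancelˡ (0<fromℕ {suc k} z<s) (trans (avg-∑ k (const c)) (∑-const (suc k) c))

  avg-affine : ∀ k a b (v : ℕ → ℚ) c w → avg k (λ i → a + b * v i + c * w i) ≡ a + b * avg k v + c * avg k w
  avg-affine k a b v c w = begin
    avg k (λ i → a + b * v i + c * w i)            ≡⟨ avg-cong k (λ i → lemma a (b * v i) (c * w i)) ⟩
    avg k (λ i → a * 1ℚ + 1ℚ * (b * v i + c * w i)) ≡⟨ avg-linear k a (const 1ℚ) 1ℚ (λ i → b * v i + c * w i) ⟩
    a * avg k (const 1ℚ) + 1ℚ * avg k (λ i → b * v i + c * w i) ≡⟨ cong₂ (λ x y → a * x + 1ℚ * y) (avg-const k 1ℚ)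
        (avg-linear k b v c w) ⟩
    a * 1ℚ + 1ℚ * (b * avg k v + c * avg k w)      ≡⟨ lemma a (b * avg k v) (c * avg k w) ⟨
    a + b * avg k v + c * avg k w                  ∎
    where
    open ≡-Reasoning
    lemma : ∀ a x y → a + x + y ≡ a * 1ℚ + 1ℚ * (x + y)
    lemma = RingSolver.solve-∀ ℚ-ring

  sum-toℕ : ∀ N h → sum {N} (h ∘ toℕ) ≡ ∑ N h
  sum-toℕ zero    h = refl
  sum-toℕ (suc N) h = cong (h 0 +_) (sum-toℕ N (h ∘ suc))

  sum-mono : ∀ N {f g : Fin N → ℚ} → (∀ i → f i ≤ g i) → sum f ≤ sum g
  sum-mono zero    le = ℚ.≤-refl
  sum-mono (suc N) le = ℚ.+-mono-≤ (le Fin.zero) (sum-mono N (le ∘ Fin.suc))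

  mean-avg : ∀ k {f h} → (∀ i → f i ≤ h (toℕ i)) → mean k f ≤ avg k h
  mean-avg k {f} {h} le = *-monoˡ (0≤1/suc k) (ℚ.≤-trans (sum-mono (suc k) le) (ℚ.≤-reflexive (sum-toℕ (suc k) h)))

  mean-mono : ∀ k {f g} → (∀ i → f i ≤ g i) → mean k f ≤ mean k g
  mean-mono k le = *-monoˡ (0≤1/suc k) (sum-mono (suc k) le)

  mean-cong : ∀ k {f g} → f ≗ g → mean k f ≡ mean k g
  mean-cong k eq = cong ((1/1+ k) *_) (sum-cong-≗ eq)

  mean-const : ∀ k c → mean k (const c) ≡ c
  mean-const k c = trans (cong ((1/1+ k) *_) (sum-toℕ (suc k) (const c))) (avg-const k c)

  sum-linear : ∀ N a (f g : Fin N → ℚ) b → sum (λ i → a * f i + b * g i) ≡ a * sum f + b * sum g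
  sum-linear zero    a f g b = lemma a b
    where
    lemma : ∀ a b → 0ℚ ≡ a * 0ℚ + b * 0ℚ
    lemma = RingSolver.solve-∀ ℚ-ring
  sum-linear (suc N) a f g b =
      trans (cong (a * f Fin.zero + b * g Fin.zero +_) (sum-linear N a (f ∘ Fin.suc) (g ∘ Fin.suc) b))
                                    (lemma a b (f Fin.zero) (g Fin.zero) (sum (f ∘ Fin.suc)) (sum (g ∘ Fin.suc)))
    where
    lemma : ∀ a b v w V W → a * v + b * w + (a * V + b * W) ≡ a * (v + V) + b * (w + W)
    lemma = RingSolver.solve-∀ ℚ-ring

  mean-linear : ∀ k a f g b → mean k (λ i → a * f i + b * g i) ≡ a * mean k f + b * mean k g
  mean-linear k a f g b = trans (cong (1/1+ k *_) (sum-linear (suc k) a f g b)) (lemma (1/1+ k) a b (sum f) (sum g))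
    where
    lemma : ∀ r a b v w → r * (a * v + b * w) ≡ a * (r * v) + b * (r * w)
    lemma = RingSolver.solve-∀ ℚ-ring

  ∑-prefix : ∀ N M x → M ℕ.≤ N → ∑ N (λ y → if M ∸ y ≡ᵇ 0 then 0ℚ else x) ≡ fromℕ M * x
  ∑-prefix N       zero    x M≤N       = trans (∑-cong N λ y → cong (λ k → if k ≡ᵇ 0 then 0ℚ else x) (ℕ.0∸n≡0 y))
                                        (trans (∑-zero N) (sym (ℚ.*-zeroˡ x)))
  ∑-prefix (suc N) (suc M) x (s≤s M≤N) = trans (cong (x +_) (∑-prefix N M x M≤N))
                                        (trans (lemma x (fromℕ M)) (cong (_* x) (sym (fromℕ-+ 1 M))))
    where
    lemma : ∀ c n → c + n * c ≡ (1ℚ + n) * c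
    lemma = RingSolver.solve-∀ ℚ-ring

  module _ {A : Set} where

    ∑ᵗ : (List A → ℚ) → List A → ℚ
    ∑ᵗ h []       = 0ℚ
    ∑ᵗ h (u ∷ us) = h (u ∷ us) + ∑ᵗ h us

    ∑-drop : ∀ N {h : List A → ℚ} us → h [] ≡ 0ℚ → length us ℕ.≤ N → ∑ N (λ y → h (drop y us)) ≡ ∑ᵗ h us
    ∑-drop N       {h} []       h0 le       = trans (∑-cong N λ y → trans (cong h (List.drop-[] y)) h0) (∑-zero N)
    ∑-drop (suc N) {h} (u ∷ us) h0 (s≤s le) = cong (h (u ∷ us) +_) (∑-drop N us h0 le)

    ∑ᵗ-one : (us : List A) → ∀ {h} → (∀ u us → h (u ∷ us) ≡ 1ℚ) → ∑ᵗ h us ≡ fromℕ (length us)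
    ∑ᵗ-one []       h1 = refl
    ∑ᵗ-one (u ∷ us) h1 = trans (cong₂ _+_ (h1 u us) (∑ᵗ-one us h1)) (sym (fromℕ-+ 1 (length us)))

  mean-scale : ∀ k a f → mean k (λ i → a * f i) ≡ a * mean k f
  mean-scale k a f = trans (mean-cong k λ i → lemma₁ a (f i)) (trans (mean-linear k a f f 0ℚ) (lemma₂ a (mean k f)))
    where
    lemma₁ : ∀ a x → a * x ≡ a * x + 0ℚ * x
    lemma₁ = RingSolver.solve-∀ ℚ-ring
    lemma₂ : ∀ a x → a * x + 0ℚ * x ≡ a * x
    lemma₂ = RingSolver.solve-∀ ℚ-ring

  mean-minus : ∀ k f g → mean k (λ i → f i - g i) ≡ mean k f - mean k g
  mean-minus k f g = trans (mean-cong k λ i → lemma (f i) (g i))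
      (trans (mean-linear k 1ℚ f g (- 1ℚ)) (sym (lemma (mean k f) (mean k g))))
    where
    lemma : ∀ x y → x - y ≡ 1ℚ * x + (- 1ℚ) * y
    lemma = RingSolver.solve-∀ ℚ-ring

  ↧*p≡↥p : ∀ {p} → 0ℚ ≤ p → fromℕ (↧ₙ p) * p ≡ fromℕ ℤ.∣ ↥ p ∣
  ↧*p≡↥p {mkℚ (ℤ.+ k) d c} 0≤p = ℚ.toℚᵘ-injective (begin
    ℚ.toℚᵘ (fromℕ (suc d) * mkℚ (ℤ.+ k) d c)           ≈⟨ ℚ.toℚᵘ-homo-* (fromℕ (suc d)) (mkℚ (ℤ.+ k) d c) ⟩
    ℚ.toℚᵘ (fromℕ (suc d)) ℚᵘ.* ℚᵘ.mkℚᵘ (ℤ.+ k) d      ≈⟨ ℚᵘ.*-cong (ℚ.toℚᵘ-fromℚᵘ (ℚᵘ.mkℚᵘ (ℤ.+ suc d) 0))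
        (ℚᵘ.≃-refl {ℚᵘ.mkℚᵘ (ℤ.+ k) d}) ⟩
    ℚᵘ.mkℚᵘ (ℤ.+ suc d) 0 ℚᵘ.* ℚᵘ.mkℚᵘ (ℤ.+ k) d       ≈⟨ ℚᵘ.*≡* (lemma (ℤ.+ suc d) (ℤ.+ k)) ⟩
    ℚᵘ.mkℚᵘ (ℤ.+ k) 0                                  ≈⟨ ℚ.toℚᵘ-fromℚᵘ (ℚᵘ.mkℚᵘ (ℤ.+ k) 0) ⟨
    ℚ.toℚᵘ (fromℕ k)                                   ∎)
    where
    open ℚᵘ.≃-Reasoning
    lemma : ∀ d k → d ℤ.* k ℤ.* ℤ.+ 1 ≡ k ℤ.* (ℤ.+ 1 ℤ.* d)
    lemma d k = trans (ℤ.*-identityʳ (d ℤ.* k)) (trans (ℤ.*-comm d k) (cong (k ℤ.*_) (sym (ℤ.*-identityˡ d))))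
  ↧*p≡↥p {mkℚ -[1+ k ] d c} (*≤* ())

  0<↥p : ∀ {p} → 0ℚ < p → 0 ℕ.< ℤ.∣ ↥ p ∣
  0<↥p {mkℚ +[1+ k ] d c} _ = z<s
  0<↥p {mkℚ (ℤ.+ 0) d c} 0<p = ⊥-elim (ℚ.<-irrefl refl (ℚ.<-≤-trans 0<p (*≤* ℤ.≤-refl)))
  0<↥p {mkℚ -[1+ k ] d c} 0<p = ⊥-elim (ℚ.<-irrefl refl (ℚ.<-≤-trans 0<p (*≤* ℤ.-≤+)))

  archimedean : ∀ {p η} → 0ℚ ≤ p → 0ℚ < η → ∃ λ t → p ≤ fromℕ t * η × 0 ℕ.< t
  archimedean {p} {η} 0≤p 0<η = suc (ℤ.∣ ↥ p ∣ ℕ.* ↧ₙ η) , (begin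
    p                                        ≡⟨ ℚ.*-identityˡ p ⟨
    1ℚ * p                                   ≤⟨ *-monoʳ 0≤p (fromℕ-mono {1} {↧ₙ p} (s≤s z≤n)) ⟩
    fromℕ (↧ₙ p) * p                         ≡⟨ ↧*p≡↥p 0≤p ⟩
    P                                        ≡⟨ ℚ.*-identityʳ P ⟨
    P * 1ℚ                                   ≤⟨ *-monoˡ (0≤fromℕ ℤ.∣ ↥ p ∣) (fromℕ-mono (0<↥p 0<η)) ⟩
    P * fromℕ ℤ.∣ ↥ η ∣                      ≡⟨ cong (P *_) (↧*p≡↥p (ℚ.<⇒≤ 0<η)) ⟨
    P * (fromℕ (↧ₙ η) * η)                   ≡⟨ ℚ.*-assoc P (fromℕ (↧ₙ η)) η ⟨
    P * fromℕ (↧ₙ η) * η                     ≡⟨ cong (_* η) (fromℕ-* ℤ.∣ ↥ p ∣ (↧ₙ η)) ⟨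
    fromℕ (ℤ.∣ ↥ p ∣ ℕ.* ↧ₙ η) * η           ≤⟨ *-monoʳ (ℚ.<⇒≤ 0<η) (fromℕ-mono (ℕ.n≤1+n (ℤ.∣ ↥ p ∣ ℕ.* ↧ₙ η))) ⟩
    fromℕ (suc (ℤ.∣ ↥ p ∣ ℕ.* ↧ₙ η)) * η     ∎) , z<s
    where
    open ℚ.≤-Reasoning
    P : ℚ
    P = fromℕ ℤ.∣ ↥ p ∣

open Rationals

module Execution where

  open import Data.Rational using (_+_; _*_; _-_; -_; _≤_; _<_)

  module Paths (O : Oracle) where

    infix 4 _⇒[_]_
    data _⇒[_]_ : Config → ℕ → Config → Set where
      stop : ∀ {c} → c ⇒[ 0 ] c
      step : ∀ {c c′ c″ k} → transition O c ≡ goto c′ → c′ ⇒[ k ] c″ → c ⇒[ suc k ] c″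

    infixr 5 _▷_
    _▷_ : ∀ {c c′ c″ j k} → c ⇒[ j ] c′ → c′ ⇒[ k ] c″ → c ⇒[ j ℕ.+ k ] c″
    stop     ▷ q = q
    step e p ▷ q = step e (p ▷ q)

    next : Config → Maybe Config
    next (assign a i e ∷ ss , m)  = just (ss , write m a (eval m i) (eval m e))
    next (probe a i u j ∷ ss , m) = just (ss , write m a (eval m i) (O (eval m u) (eval m j)))
    next (s ⨾ t ∷ ss , m)         = just (s ∷ t ∷ ss , m)
    next _                        = nothing

    run : ℕ → Config → Maybe Config
    run zero    c = just c
    run (suc k) c = next c Data.Maybe.>>= run k

    next-goto : ∀ c {c′} → next c ≡ just c′ → transition O c ≡ goto c′
    next-goto (assign a i e ∷ ss , m)  refl = refl
    next-goto (probe a i u j ∷ ss , m) refl = refl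
    next-goto (s ⨾ t ∷ ss , m)         refl = refl

    straight : ∀ k {c c′} → run k c ≡ just c′ → c ⇒[ k ] c′
    straight zero            refl = stop
    straight (suc k) {c} eq with next c in e
    ... | just c₁ = step (next-goto c e) (straight k eq)

    module _ {m : Memory} {e : Expr} where

      if-false : ∀ {s t ss} → eval m e ≡ 0 → (ifnz e s t ∷ ss , m) ⇒[ 1 ] (t ∷ ss , m)
      if-false {s} {t} {ss} eq = step (cong (λ k → goto ((if k ≡ᵇ 0 then t else s) ∷ ss , m)) eq) stop

      if-true : ∀ {s t ss k} → eval m e ≡ suc k → (ifnz e s t ∷ ss , m) ⇒[ 1 ] (s ∷ ss , m)
      if-true {s} {t} {ss} eq = step (cong (λ k → goto ((if k ≡ᵇ 0 then t else s) ∷ ss , m)) eq) stop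

      while-false : ∀ {s ss} → eval m e ≡ 0 → (while e s ∷ ss , m) ⇒[ 1 ] (ss , m)
      while-false {s} {ss} eq = step (cong (λ k → goto ((if k ≡ᵇ 0 then ss else s ∷ while e s ∷ ss) , m)) eq) stop

      while-true : ∀ {s ss k} → eval m e ≡ suc k → (while e s ∷ ss , m) ⇒[ 1 ] (s ∷ while e s ∷ ss , m)
      while-true {s} {ss} eq = step (cong (λ k → goto ((if k ≡ᵇ 0 then ss else s ∷ while e s ∷ ss) , m)) eq) stop

  record Reward : Set where
    field
      κ   : ℚ
      0≤κ : 0ℚ ≤ κ
      φ   : Memory → ℚ
      0≤φ : ∀ m → 0ℚ ≤ φ m

  timeReward : Reward
  timeReward = record { κ = 1ℚ ; 0≤κ = ℚ.<⇒≤ (ℚ.positive⁻¹ 1ℚ) ; φ = const 0ℚ ; 0≤φ = λ _ → ℚ.≤-refl }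

  finalReward : (φ : Memory → ℚ) → (∀ m → 0ℚ ≤ φ m) → Reward
  finalReward φ 0≤φ = record { κ = 0ℚ ; 0≤κ = ℚ.≤-refl ; φ = φ ; 0≤φ = 0≤φ }

  -- The expectation of κ · (steps taken) + φ (final memory, if reached), over
  -- fewer than t steps: running time and failure probability are bounded by one
  -- and the same argument.
  module Value (O : Oracle) (rew : Reward) where

    open Paths O using (_⇒[_]_; stop; step)
    open Reward rew

    value : Config → ℕ → ℚ
    value c zero = 0ℚ
    value c (suc t) with transition O c
    ... | halt m     = φ m
    ... | branch k f = κ + mean k λ i → value (f i) t

    value-halt : ∀ {c m} t → transition O c ≡ halt m → value c (suc t) ≡ φ m
    value-halt {c} t eq with transition O c
    value-halt t refl | halt _ = refl

    value-branch : ∀ {c k f} t → transition O c ≡ branch k f → value c (suc t) ≡ κ + mean k λ i → value (f i) t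
    value-branch {c} t eq with transition O c
    value-branch t refl | branch _ _ = refl

    Bounded : ℕ → Config → ℚ → Set
    Bounded t c b = ∀ t′ → t′ ℕ.≤ t → value c t′ ≤ b

    nonneg : ∀ {t c b} → Bounded t c b → 0ℚ ≤ b
    nonneg h = h 0 z≤n

    weaken : ∀ {t c b b′} → b ≤ b′ → Bounded t c b → Bounded t c b′
    weaken le h t′ t′≤t = ℚ.≤-trans (h t′ t′≤t) le

    halt-bound : ∀ {t c m b} → transition O c ≡ halt m → φ m ≤ b → Bounded t c b
    halt-bound {m = m} eq le zero     _ = ℚ.≤-trans (0≤φ m) le
    halt-bound eq le (suc t′) _ = ℚ.≤-trans (ℚ.≤-reflexive (value-halt t′ eq)) le

    random-bound : ∀ {t c k f h} → transition O c ≡ branch k f →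
                   (∀ i → Bounded t (f i) (h (toℕ i))) → Bounded t c (κ + avg k h)
    random-bound {k = k} {h = h} eq bounds zero     _  =
      0≤+ 0≤κ (subst (_≤ avg k h) (mean-const k 0ℚ) (mean-avg k {const 0ℚ} {h} (nonneg ∘ bounds)))
    random-bound {k = k} {f} {h} eq bounds (suc t′) le =
      ℚ.≤-trans (ℚ.≤-reflexive (value-branch t′ eq))
        (ℚ.+-monoʳ-≤ κ (mean-avg k {λ i → value (f i) t′} {h} (λ i → bounds i t′ (ℕ.≤-trans (ℕ.n≤1+n t′) le))))

    step-bound : ∀ {t c c′ b} → transition O c ≡ goto c′ → Bounded t c′ b → Bounded t c (κ + b)
    step-bound {b = b} eq h = weaken (ℚ.≤-reflexive (cong (κ +_) (avg-const 0 b))) (random-bound eq (λ _ → h))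

    path-bound : ∀ {t c c′ b k} → c ⇒[ k ] c′ → Bounded t c′ b → Bounded t c (fromℕ k * κ + b)
    path-bound {b = b} stop h = weaken (ℚ.≤-reflexive (lemma κ b)) h
      where
      lemma : ∀ κ b → b ≡ 0ℚ * κ + b
      lemma = RingSolver.solve-∀ ℚ-ring
    path-bound {b = b} (step {k = k} eq p) h =
      weaken (ℚ.≤-reflexive (trans (lemma κ b (fromℕ k)) (cong (λ x → x * κ + b) (sym (fromℕ-+ 1 k)))))
        (step-bound eq (path-bound p h))
      where
      lemma : ∀ κ b k → κ + (k * κ + b) ≡ (1ℚ + k) * κ + b
      lemma = RingSolver.solve-∀ ℚ-ring

    loop-bound : {S : Set} (c : S → Config) (b : S → ℚ) → (∀ s → 0ℚ ≤ b s) →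
                 (∀ s → ∃ λ c′ → transition O (c s) ≡ goto c′ ×
                   (∀ t → (∀ s′ → Bounded t (c s′) (b s′)) → ∃ λ b′ → κ + b′ ≤ b s × Bounded t c′ b′)) →
                 ∀ t s → Bounded t (c s) (b s)
    loop-bound c b 0≤b body zero s zero z≤n = 0≤b s
    loop-bound c b 0≤b body (suc t) s zero _ = 0≤b s
    loop-bound c b 0≤b body (suc t) s (suc t′) (s≤s t′≤t) with body s
    ... | c′ , eq , bounds with bounds t (loop-bound c b 0≤b body t)
    ... | b′ , le , h = ℚ.≤-trans (ℚ.≤-reflexive (value-branch t′ eq))
      (ℚ.≤-trans (ℚ.+-monoʳ-≤ κ (ℚ.≤-trans (ℚ.≤-reflexive (mean-const 0 (value c′ t′))) (h t′ t′≤t))) le)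

  module _ (O : Oracle) where

    open Value O timeReward using () renaming (value to time)

    expectedSteps≤time : ∀ c t → expectedSteps O c t ≤ time c t
    expectedSteps≤time c zero = ℚ.≤-refl
    expectedSteps≤time c (suc t) with transition O c
    ... | halt m     = ℚ.≤-refl
    ... | branch k f = ℚ.+-monoʳ-≤ 1ℚ (mean-mono k (λ i → expectedSteps≤time (f i) t))

    module _ {P : Pred Memory 0ℓ} (P? : Decidable P) (φ : Memory → ℚ) (0≤φ : ∀ m → 0ℚ ≤ φ m)
             (¬P⇒1≤φ : ∀ m → ¬ P m → 1ℚ ≤ φ m) where

      open Value O (finalReward φ 0≤φ) using () renaming (value to failure)

      private
        0≤mean : ∀ k {f} → (∀ i → 0ℚ ≤ f i) → 0ℚ ≤ mean k f
        0≤mean k 0≤f = ℚ.≤-trans (ℚ.≤-reflexive (sym (mean-const k 0ℚ))) (mean-mono k 0≤f)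

      0≤failure : ∀ c t → 0ℚ ≤ failure c t
      0≤failure c zero = ℚ.≤-refl
      0≤failure c (suc t) with transition O c
      ... | halt m     = 0≤φ m
      ... | branch k f = 0≤+ ℚ.≤-refl (0≤mean k (λ i → 0≤failure (f i) t))

      0≤haltProbability : ∀ c t → 0ℚ ≤ haltProbability O P? c t
      0≤haltProbability c zero = ℚ.≤-refl
      0≤haltProbability c (suc t) with transition O c
      ... | halt m with P? m
      ...   | yes _ = ℚ.<⇒≤ (ℚ.positive⁻¹ 1ℚ)
      ...   | no  _ = ℚ.≤-refl
      0≤haltProbability c (suc t) | branch k f = 0≤mean k (λ i → 0≤haltProbability (f i) t)

      markov : ∀ c t → fromℕ t * (1ℚ - haltProbability O P? c t - failure c t) ≤ time c t
      markov c zero = ℚ.≤-reflexive (lemma 1ℚ)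
        where
        lemma : ∀ x → 0ℚ * (x - 0ℚ - 0ℚ) ≡ 0ℚ
        lemma = RingSolver.solve-∀ ℚ-ring
      markov c (suc t) with transition O c
      ... | halt m with P? m
      ...   | yes _ = 0≤q-p⇒p≤q (subst (0ℚ ≤_) (lemma (fromℕ (suc t)) (φ m)) (0≤* (0≤fromℕ (suc t)) (0≤φ m)))
        where
        lemma : ∀ t f → t * f ≡ 0ℚ - t * (1ℚ - 1ℚ - f)
        lemma = RingSolver.solve-∀ ℚ-ring
      ...   | no ¬p = 0≤q-p⇒p≤q (subst (0ℚ ≤_) (lemma (fromℕ (suc t)) (φ m))
                        (0≤* (0≤fromℕ (suc t)) (p≤q⇒0≤q-p (¬P⇒1≤φ m ¬p))))
        where
        lemma : ∀ t f → t * (f - 1ℚ) ≡ 0ℚ - t * (1ℚ - 0ℚ - f)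
        lemma = RingSolver.solve-∀ ℚ-ring
      markov c (suc t) | branch k f = begin
        fromℕ (suc t) * X                ≡⟨ cong (_* X) (fromℕ-+ 1 t) ⟩
        (1ℚ + fromℕ t) * X               ≡⟨ lemma (fromℕ t) X ⟩
        X + fromℕ t * X                  ≤⟨ ℚ.+-monoˡ-≤ (fromℕ t * X) X≤1 ⟩
        1ℚ + fromℕ t * X                 ≡⟨ cong (λ x → 1ℚ + fromℕ t * x) X-mean ⟩
        1ℚ + fromℕ t * mean k x          ≡⟨ cong (1ℚ +_) (mean-scale k (fromℕ t) x) ⟨
        1ℚ + mean k (λ i → fromℕ t * x i) ≤⟨ ℚ.+-monoʳ-≤ 1ℚ (mean-mono k (λ i → markov (f i) t)) ⟩
        1ℚ + mean k (λ i → time (f i) t) ∎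
        where
        open ℚ.≤-Reasoning
        h g x : Fin (suc k) → ℚ
        h i = haltProbability O P? (f i) t
        g i = failure (f i) t
        x i = 1ℚ - h i - g i
        X : ℚ
        X = 1ℚ - mean k h - (0ℚ + mean k g)
        lemma : ∀ t x → (1ℚ + t) * x ≡ x + t * x
        lemma = RingSolver.solve-∀ ℚ-ring
        lemma₁ : ∀ h g → h + (0ℚ + g) ≡ 1ℚ - (1ℚ - h - (0ℚ + g))
        lemma₁ = RingSolver.solve-∀ ℚ-ring
        X≤1 : X ≤ 1ℚ
        X≤1 = 0≤q-p⇒p≤q (subst (0ℚ ≤_) (lemma₁ (mean k h) (mean k g))
                (0≤+ (0≤mean k (λ i → 0≤haltProbability (f i) t)) (0≤+ ℚ.≤-refl (0≤mean k (λ i → 0≤failure (f i) t)))))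
        X-mean : X ≡ mean k x
        X-mean = trans (cong (λ z → 1ℚ - mean k h - z) (ℚ.+-identityˡ (mean k g)))
          (sym (trans (mean-minus k (λ i → 1ℚ - h i) g)
            (cong (_- mean k g) (trans (mean-minus k (const 1ℚ) h) (cong (_- mean k h) (mean-const k 1ℚ))))))

      haltProbability≥ : ∀ c (p B : ℚ) → (∀ t → failure c t ≤ p) → (∀ t → time c t ≤ B) →
                         (1ℚ - p) ≤sup haltProbability O P? c
      haltProbability≥ c p B failure≤ time≤ η 0<η = enough (archimedean (time≤ 0) 0<η)
        where
        enough : (∃ λ t → B ≤ fromℕ t * η × 0 ℕ.< t) → ∃ λ t → 1ℚ - p - η ≤ haltProbability O P? c t
        enough (t , B≤tη , 0<t) = t , 0≤q-p⇒p≤q (subst (0ℚ ≤_) (lemma (haltProbability O P? c t) (failure c t) p η)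
                                      (0≤+ (p≤q⇒0≤q-p (failure≤ t)) (p≤q⇒0≤q-p X≤η)))
          where
          X≤η : 1ℚ - haltProbability O P? c t - failure c t ≤ η
          X≤η = *-cancelˡ-≤ (0<fromℕ 0<t) (ℚ.≤-trans (markov c t) (ℚ.≤-trans (time≤ t) B≤tη))
          lemma : ∀ h f p η → p - f + (η - (1ℚ - h - f)) ≡ h - (1ℚ - p - η)
          lemma = RingSolver.solve-∀ ℚ-ring

open Execution

module Colorings where

  open import Algebra.Properties.Semiring.Sum ℕ.+-*-semiring using (sum; sum-cong-≗; ∑-comm; ∑-distrib-+; *-distribˡ-sum)
  open import Data.Vec.Functional using () renaming (_∷_ to _◂_)
  open import Data.Nat using (_+_; _*_; _≤_; _<_)

  ⟦_⟧ : {A : Set} → Dec A → ℕ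
  ⟦ yes _ ⟧ = 1
  ⟦ no  _ ⟧ = 0

  ⟦⟧-mono : ∀ {A B : Set} (a? : Dec A) (b? : Dec B) → (A → B) → ⟦ a? ⟧ ≤ ⟦ b? ⟧
  ⟦⟧-mono (yes a) (yes b) f = ℕ.≤-refl
  ⟦⟧-mono (yes a) (no ¬b) f = contradiction (f a) ¬b
  ⟦⟧-mono (no ¬a) b?      f = z≤n

  ⟦⟧-cong : ∀ {A B : Set} (a? : Dec A) (b? : Dec B) → (A → B) → (B → A) → ⟦ a? ⟧ ≡ ⟦ b? ⟧
  ⟦⟧-cong a? b? f g = ℕ.≤-antisym (⟦⟧-mono a? b? f) (⟦⟧-mono b? a? g)

  ⟦⟧-false : ∀ {A : Set} (a? : Dec A) → ¬ A → ⟦ a? ⟧ ≡ 0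
  ⟦⟧-false (yes a) ¬a = contradiction a ¬a
  ⟦⟧-false (no _)  ¬a = refl

  ⟦⟧-true : ∀ {A : Set} (a? : Dec A) → A → ⟦ a? ⟧ ≡ 1
  ⟦⟧-true (yes _) a = refl
  ⟦⟧-true (no ¬a) a = contradiction a ¬a

  ⟦⟧-split : ∀ {A B C : Set} (a? : Dec A) (b? : Dec B) (c? : Dec C) → (B → A) → (C → A) → (A → B ⊎ C) → (B → ¬ C) →
             ⟦ a? ⟧ ≡ ⟦ b? ⟧ + ⟦ c? ⟧
  ⟦⟧-split a?      (yes b) (yes c) f g h k = contradiction c (k b)
  ⟦⟧-split a?      (yes b) (no _)  f g h k = ⟦⟧-true a? (f b)
  ⟦⟧-split a?      (no _)  (yes c) f g h k = ⟦⟧-true a? (g c)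
  ⟦⟧-split (yes a) (no ¬b) (no ¬c) f g h k with h a
  ... | inj₁ b = contradiction b ¬b
  ... | inj₂ c = contradiction c ¬c
  ⟦⟧-split (no _)  (no _)  (no _)  f g h k = refl

  sum-single : ∀ {N} (c : Fin N) {f} → (∀ a → a ≢ c → f a ≡ 0) → sum f ≡ f c
  sum-single {suc N} Fin.zero    {f} f0 = trans (cong (f Fin.zero +_) (zeros _ (λ a → f0 (Fin.suc a) λ ())))
      (ℕ.+-identityʳ _)
    where
    zeros : ∀ {N} (g : Fin N → ℕ) → (∀ a → g a ≡ 0) → sum g ≡ 0
    zeros {zero}  g g0 = refl
    zeros {suc N} g g0 = cong₂ _+_ (g0 Fin.zero) (zeros (g ∘ Fin.suc) (g0 ∘ Fin.suc))
  sum-single {suc N} (Fin.suc c) {f} f0 =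
      cong₂ _+_ (f0 Fin.zero λ ()) (sum-single c {f ∘ Fin.suc} (λ a a≢c → f0 (Fin.suc a) (a≢c ∘ Fin.suc-injective)))

  sum-mono-≤ : ∀ {N} {f g : Fin N → ℕ} → (∀ i → f i ≤ g i) → sum f ≤ sum g
  sum-mono-≤ {zero}  le = z≤n
  sum-mono-≤ {suc N} le = ℕ.+-mono-≤ (le Fin.zero) (sum-mono-≤ (le ∘ Fin.suc))

  sum-const : ∀ N c → sum {N} (const c) ≡ N * c
  sum-const zero    c = refl
  sum-const (suc N) c = cong (c +_) (sum-const N c)

  sum-↑ : ∀ k {l} (f : Fin (k + l) → ℕ) → sum f ≡ sum (f ∘ (Fin._↑ˡ l)) + sum (f ∘ (k Fin.↑ʳ_))
  sum-↑ zero    f = refl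
  sum-↑ (suc k) f = trans (cong (f Fin.zero +_) (sum-↑ k (f ∘ Fin.suc))) (sym (ℕ.+-assoc (f Fin.zero) _ _))

  sum-combine : ∀ m {k} (f : Fin (m * k) → ℕ) → sum f ≡ sum {m} λ a → sum λ b → f (Fin.combine a b)
  sum-combine zero        f = refl
  sum-combine (suc m) {k} f =
      trans (sum-↑ k f) (cong (sum (f ∘ (Fin._↑ˡ (m * k))) +_) (sum-combine m (f ∘ (k Fin.↑ʳ_))))

  infixl 9 _[_↦_]
  _[_↦_] : (ℕ → ℕ) → ℕ → ℕ → ℕ → ℕ
  (p [ i ↦ a ]) j = if j ≡ᵇ i then a else p j

  ↦-same : ∀ p i a → (p [ i ↦ a ]) i ≡ a
  ↦-same p zero    a = refl
  ↦-same p (suc i) a = ↦-same (p ∘ suc) i a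

  ↦-other : ∀ p {i j} a → j ≢ i → (p [ i ↦ a ]) j ≡ p j
  ↦-other p {zero}  {zero}  a j≢i = contradiction refl j≢i
  ↦-other p {zero}  {suc j} a j≢i = refl
  ↦-other p {suc i} {zero}  a j≢i = refl
  ↦-other p {suc i} {suc j} a j≢i = ↦-other (p ∘ suc) a (j≢i ∘ cong suc)

  ↦-cong : ∀ {p p′} i a → p ≗ p′ → p [ i ↦ a ] ≗ p′ [ i ↦ a ]
  ↦-cong i a eq j with j ≡ᵇ i
  ... | true  = refl
  ... | false = eq j

  ↦-undo : ∀ {p} i a → p i ≡ 0 → p [ i ↦ a ] [ i ↦ 0 ] ≗ p
  ↦-undo {p} i a pi≡0 j with j ℕ.≟ i
  ... | yes refl = trans (↦-same (p [ i ↦ a ]) i 0) (sym pi≡0)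
  ... | no  j≢i  = trans (↦-other (p [ i ↦ a ]) 0 j≢i) (↦-other p a j≢i)

  module _ {q : ℕ} where

    ∑ᶜ : ∀ n → (Coloring n q → ℕ) → ℕ
    ∑ᶜ zero    h = h λ ()
    ∑ᶜ (suc n) h = sum λ a → ∑ᶜ n λ τ → h (a ◂ τ)

    recolor : ∀ {n} → Coloring n q → Fin n → Fin q → Coloring n q
    recolor {suc n} τ Fin.zero    a = a ◂ (τ ∘ Fin.suc)
    recolor {suc n} τ (Fin.suc x) a = τ Fin.zero ◂ recolor (τ ∘ Fin.suc) x a

    recolor-same : ∀ {n} (τ : Coloring n q) x a → recolor τ x a x ≡ a
    recolor-same τ Fin.zero    a = refl
    recolor-same τ (Fin.suc x) a = recolor-same (τ ∘ Fin.suc) x a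

    recolor-other : ∀ {n} (τ : Coloring n q) {x} a {u} → u ≢ x → recolor τ x a u ≡ τ u
    recolor-other τ {Fin.zero}  a {Fin.zero}  u≢x = contradiction refl u≢x
    recolor-other τ {Fin.zero}  a {Fin.suc u} u≢x = refl
    recolor-other τ {Fin.suc x} a {Fin.zero}  u≢x = refl
    recolor-other τ {Fin.suc x} a {Fin.suc u} u≢x = recolor-other (τ ∘ Fin.suc) a (u≢x ∘ cong Fin.suc)

    ∑ᶜ-cong : ∀ n {g h : Coloring n q → ℕ} → (∀ τ → g τ ≡ h τ) → ∑ᶜ n g ≡ ∑ᶜ n h
    ∑ᶜ-cong zero    eq = eq λ ()
    ∑ᶜ-cong (suc n) eq = sum-cong-≗ λ a → ∑ᶜ-cong n λ τ → eq (a ◂ τ)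

    ∑ᶜ-mono : ∀ n {g h : Coloring n q → ℕ} → (∀ τ → g τ ≤ h τ) → ∑ᶜ n g ≤ ∑ᶜ n h
    ∑ᶜ-mono zero    le = le λ ()
    ∑ᶜ-mono (suc n) le = sum-mono-≤ λ a → ∑ᶜ-mono n λ τ → le (a ◂ τ)

    ∑ᶜ-+ : ∀ n (g h : Coloring n q → ℕ) → ∑ᶜ n (λ τ → g τ + h τ) ≡ ∑ᶜ n g + ∑ᶜ n h
    ∑ᶜ-+ zero    g h = refl
    ∑ᶜ-+ (suc n) g h = trans (sum-cong-≗ λ a → ∑ᶜ-+ n (λ τ → g (a ◂ τ)) (λ τ → h (a ◂ τ)))
        (∑-distrib-+ (λ a → ∑ᶜ n λ τ → g (a ◂ τ)) (λ a → ∑ᶜ n λ τ → h (a ◂ τ)))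

    ∑ᶜ-zero : ∀ n → ∑ᶜ n (const 0) ≡ 0
    ∑ᶜ-zero zero    = refl
    ∑ᶜ-zero (suc n) = trans (sum-cong-≗ {q} λ a → ∑ᶜ-zero n) (trans (sum-const q 0) (ℕ.*-zeroʳ q))

    ∑ᶜ-sum : ∀ n {N} (h : Coloring n q → Fin N → ℕ) → ∑ᶜ n (λ τ → sum (h τ)) ≡ sum λ a → ∑ᶜ n λ τ → h τ a
    ∑ᶜ-sum zero    h = refl
    ∑ᶜ-sum (suc n) h = trans (sum-cong-≗ λ b → ∑ᶜ-sum n (λ τ → h (b ◂ τ))) (∑-comm λ b a → ∑ᶜ n λ τ → h (b ◂ τ) a)

    ∑ᶜ-recolor : ∀ {n} x (h : Coloring n q → ℕ) → ∑ᶜ n (λ τ → sum λ a → h (recolor τ x a)) ≡ q * ∑ᶜ n h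
    ∑ᶜ-recolor {suc n} Fin.zero    h = trans (sum-const q _) (cong (q *_) (∑ᶜ-sum n λ τ a → h (a ◂ τ)))
    ∑ᶜ-recolor {suc n} (Fin.suc x) h = trans (sum-cong-≗ λ b → ∑ᶜ-recolor x (λ τ → h (b ◂ τ)))
                                             (sym (*-distribˡ-sum q λ b → ∑ᶜ n λ τ → h (b ◂ τ)))

    ∑ᶜ-positive : ∀ n (h : Coloring n q → ℕ) → (∀ {τ τ′} → τ ≗ τ′ → h τ ≡ h τ′) → ∀ τ → 0 < h τ → 0 < ∑ᶜ n h
    ∑ᶜ-positive zero    h ext τ 0<h = subst (0 <_) (ext λ ()) 0<h
    ∑ᶜ-positive (suc n) h ext τ 0<h = ℕ.<-≤-trans
      (∑ᶜ-positive n (λ τ′ → h (τ Fin.zero ◂ τ′)) (λ eq → ext λ { Fin.zero → refl ; (Fin.suc u) → eq u })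
        (τ ∘ Fin.suc) (subst (0 <_) (ext λ { Fin.zero → refl ; (Fin.suc u) → refl }) 0<h))
      (term≤sum (τ Fin.zero))
      where
      term≤sum : ∀ {N} {f : Fin N → ℕ} a → f a ≤ sum f
      term≤sum {f = f} Fin.zero    = ℕ.m≤m+n (f Fin.zero) _
      term≤sum {f = f} (Fin.suc a) = ℕ.≤-trans (term≤sum a) (ℕ.m≤n+m _ (f Fin.zero))

    ∑ᶜ-finToFun : ∀ n (h : Coloring n q → ℕ) → (∀ {τ τ′} → τ ≗ τ′ → h τ ≡ h τ′) →
                  sum {q ℕ.^ n} (h ∘ Fin.finToFun) ≡ ∑ᶜ n h
    ∑ᶜ-finToFun zero    h ext = trans (ℕ.+-identityʳ _) (ext λ ())
    ∑ᶜ-finToFun (suc n) h ext = trans (sum-combine q (h ∘ Fin.finToFun)) (sum-cong-≗ λ a →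
      trans (sum-cong-≗ λ b → ext λ where
        Fin.zero    → cong proj₁ (Fin.remQuot-combine {q} a b)
        (Fin.suc u) → cong (λ i → Fin.finToFun (proj₂ i) u) (Fin.remQuot-combine {q} a b))
        (∑ᶜ-finToFun n (λ τ → h (a ◂ τ)) (λ eq → ext λ { Fin.zero → refl ; (Fin.suc u) → eq u })))

  length-filter² : ∀ {A : Set} {P Q : Pred A 0ℓ} (P? : Decidable P) (Q? : Decidable Q) {N} (g : Fin N → A) →
                   length (filter P? (filter Q? (map g (allFin N)))) ≡ sum λ i → ⟦ Q? (g i) ×-dec P? (g i) ⟧
  length-filter² {A} P? Q? {N} g = go id
    where
    go : ∀ {M} (h : Fin M → Fin N) → length (filter P? (filter Q? (map g (Data.List.tabulate h)))) ≡ sum λ i →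
        ⟦ Q? (g (h i)) ×-dec P? (g (h i)) ⟧
    go {zero}  h = refl
    go {suc M} h with Q? (g (h Fin.zero))
    ... | no  _ = go (h ∘ Fin.suc)
    ... | yes _ with P? (g (h Fin.zero))
    ...   | no  _ = go (h ∘ Fin.suc)
    ...   | yes _ = cong suc (go (h ∘ Fin.suc))

  module Counting {n : ℕ} (G : Graph n) (q : ℕ) where

    open Graph G using (E; E?; irrefl) renaming (sym to E-sym)

    -- p describes a partial coloring: p u = 0 if u is free, and p u = 1 + a if u
    -- has color a.
    Compatible : (ℕ → ℕ) → Pred (Coloring n q) 0ℓ
    Compatible p τ = ∀ u → p (toℕ u) ≡ 0 ⊎ p (toℕ u) ≡ suc (toℕ (τ u))

    compatible? : ∀ p → Decidable (Compatible p)
    compatible? p τ = Fin.all? λ u → (p (toℕ u) ℕ.≟ 0) Relation.Nullary.⊎-dec (p (toℕ u) ℕ.≟ suc (toℕ (τ u)))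

    Good : (ℕ → ℕ) → Pred (Coloring n q) 0ℓ
    Good p τ = Proper G q τ × Compatible p τ

    good? : ∀ p → Decidable (Good p)
    good? p τ = proper? G q τ ×-dec compatible? p τ

    Avoids : List (Fin n) → Fin q → Pred (Coloring n q) 0ℓ
    Avoids us c τ = All (λ u → τ u ≢ c) us

    avoids? : ∀ us c → Decidable (Avoids us c)
    avoids? us c τ = All.all? (λ u → ¬? (τ u Fin.≟ c)) us

    Z : (ℕ → ℕ) → ℕ
    Z p = ∑ᶜ n λ τ → ⟦ good? p τ ⟧

    F : (ℕ → ℕ) → List (Fin n) → Fin q → ℕ
    F p us c = ∑ᶜ n λ τ → ⟦ good? p τ ×-dec avoids? us c τ ⟧

    X : (ℕ → ℕ) → Fin n → List (Fin n) → Fin q → ℕ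
    X p u us c = ∑ᶜ n λ τ → ⟦ good? p τ ×-dec (τ u Fin.≟ c) ×-dec avoids? us c τ ⟧

    ∑X : (ℕ → ℕ) → List (Fin n) → Fin q → ℕ
    ∑X p []       c = 0
    ∑X p (u ∷ us) c = X p u us c + ∑X p us c

    Z-cong : ∀ {p p′} → p ≗ p′ → Z p ≡ Z p′
    Z-cong {p} {p′} eq = ∑ᶜ-cong n λ τ → ⟦⟧-cong (good? p τ) (good? p′ τ)
      (λ (pr , co) → pr , λ u → subst (λ a → a ≡ 0 ⊎ a ≡ suc (toℕ (τ u))) (eq (toℕ u)) (co u))
      (λ (pr , co) → pr , λ u → subst (λ a → a ≡ 0 ⊎ a ≡ suc (toℕ (τ u))) (sym (eq (toℕ u))) (co u))

    Z-split : ∀ p us c → Z p ≡ F p us c + ∑X p us c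
    Z-split p []       c = trans (∑ᶜ-cong n λ τ → ⟦⟧-cong (good? p τ) (good? p τ ×-dec avoids? [] c τ) (_, []) proj₁)
        (sym (ℕ.+-identityʳ _))
    Z-split p (u ∷ us) c = begin
      Z p                                                  ≡⟨ Z-split p us c ⟩
      F p us c + ∑X p us c                                 ≡⟨ cong (_+ ∑X p us c) (∑ᶜ-cong n split) ⟩
      ∑ᶜ n (λ τ → f τ + x τ) + ∑X p us c                   ≡⟨ cong (_+ ∑X p us c) (∑ᶜ-+ n f x) ⟩
      F p (u ∷ us) c + X p u us c + ∑X p us c              ≡⟨ ℕ.+-assoc (F p (u ∷ us) c) _ _ ⟩
      F p (u ∷ us) c + (X p u us c + ∑X p us c)            ∎
      where
      open ≡-Reasoning
      f x : Coloring n q → ℕ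
      f τ = ⟦ good? p τ ×-dec avoids? (u ∷ us) c τ ⟧
      x τ = ⟦ good? p τ ×-dec (τ u Fin.≟ c) ×-dec avoids? us c τ ⟧
      split : ∀ τ → ⟦ good? p τ ×-dec avoids? us c τ ⟧ ≡ f τ + x τ
      split τ = ⟦⟧-split (good? p τ ×-dec avoids? us c τ) (good? p τ ×-dec avoids? (u ∷ us) c τ)
                         (good? p τ ×-dec (τ u Fin.≟ c) ×-dec avoids? us c τ)
        (λ { (g , _ ∷ av) → g , av }) (λ (g , _ , av) → g , av)
        (λ (g , av) → case τ u Fin.≟ c of λ { (yes τu≡c) → inj₂ (g , τu≡c , av) ; (no τu≢c) → inj₁ (g , τu≢c ∷ av) })
        (λ { (_ , τu≢c ∷ _) (_ , τu≡c , _) → τu≢c τu≡c })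

    F≤Z : ∀ p us c → F p us c ≤ Z p
    F≤Z p us c = ℕ.≤-trans (ℕ.m≤m+n _ _) (ℕ.≤-reflexive (sym (Z-split p us c)))

    F-blocked : ∀ {p us c} → Any (λ u → p (toℕ u) ≡ suc (toℕ c)) us → F p us c ≡ 0
    F-blocked {p} {us} {c} blocked = trans (∑ᶜ-cong n λ τ → ⟦⟧-false (good? p τ ×-dec avoids? us c τ)
      λ ((_ , co) , av) → clash τ co blocked av) (∑ᶜ-zero n)
      where
      clash : ∀ τ → Compatible p τ → ∀ {us} → Any (λ u → p (toℕ u) ≡ suc (toℕ c)) us → ¬ Avoids us c τ
      clash τ co (here {u} pu≡c) (τu≢c ∷ _) with co u
      ... | inj₁ pu≡0 = case trans (sym pu≡0) pu≡c of λ ()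
      ... | inj₂ pu≡τ = τu≢c (Fin.toℕ-injective (ℕ.suc-injective (trans (sym pu≡τ) pu≡c)))
      clash τ co (there b) (_ ∷ av) = clash τ co b av

    X-free : ∀ {p u} us c → p (toℕ u) ≡ 0 → X p u us c ≡ F (p [ toℕ u ↦ suc (toℕ c) ]) us c
    X-free {p} {u} us c pu≡0 = ∑ᶜ-cong n λ τ → ⟦⟧-cong
      (good? p τ ×-dec (τ u Fin.≟ c) ×-dec avoids? us c τ) (good? (p [ toℕ u ↦ suc (toℕ c) ]) τ ×-dec avoids? us c τ)
      (λ ((pr , co) , τu≡c , av) → (pr , to τ co τu≡c) , av)
      (λ ((pr , co) , av) → (pr , from τ co) , at τ co , av)
      where
      to : ∀ τ → Compatible p τ → τ u ≡ c → Compatible (p [ toℕ u ↦ suc (toℕ c) ]) τ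
      to τ co τu≡c w with w Fin.≟ u
      ... | yes refl = inj₂ (trans (↦-same p (toℕ u) _) (cong (suc ∘ toℕ) (sym τu≡c)))
      ... | no  w≢u  = subst (λ a → a ≡ 0 ⊎ a ≡ suc (toℕ (τ w))) (sym (↦-other p _ (w≢u ∘ Fin.toℕ-injective))) (co w)
      at : ∀ τ → Compatible (p [ toℕ u ↦ suc (toℕ c) ]) τ → τ u ≡ c
      at τ co with co u
      ... | inj₁ eq = case trans (sym (↦-same p (toℕ u) _)) eq of λ ()
      ... | inj₂ eq = Fin.toℕ-injective (ℕ.suc-injective (trans (sym eq) (↦-same p (toℕ u) _)))
      from : ∀ τ → Compatible (p [ toℕ u ↦ suc (toℕ c) ]) τ → Compatible p τ
      from τ co w with w Fin.≟ u
      ... | yes refl = inj₁ pu≡0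
      ... | no  w≢u  = subst (λ a → a ≡ 0 ⊎ a ≡ suc (toℕ (τ w))) (↦-other p _ (w≢u ∘ Fin.toℕ-injective)) (co w)

    X-pinned : ∀ {p u} us {a} c → p (toℕ u) ≡ suc (toℕ a) → c ≢ a → X p u us c ≡ 0
    X-pinned {p} {u} us {a} c pu≡a c≢a = trans (∑ᶜ-cong n λ τ → ⟦⟧-false
      (good? p τ ×-dec (τ u Fin.≟ c) ×-dec avoids? us c τ) (λ ((_ , co) , τu≡c , _) →
          c≢a (trans (sym τu≡c) (color τ co)))) (∑ᶜ-zero n)
      where
      color : ∀ τ → Compatible p τ → τ u ≡ a
      color τ co with co u
      ... | inj₁ eq = case trans (sym pu≡a) eq of λ ()
      ... | inj₂ eq = Fin.toℕ-injective (ℕ.suc-injective (trans (sym eq) pu≡a))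

    ∑-X-pinned : ∀ {p u} us {a} → p (toℕ u) ≡ suc (toℕ a) → sum (X p u us) ≡ F p us a
    ∑-X-pinned {p} {u} us {a} pu≡a = trans (sum-single a (λ c → X-pinned {p} us c pu≡a)) (∑ᶜ-cong n λ τ → ⟦⟧-cong
      (good? p τ ×-dec (τ u Fin.≟ a) ×-dec avoids? us a τ) (good? p τ ×-dec avoids? us a τ)
      (λ (g , _ , av) → g , av) (λ (g , av) → g , color τ (proj₂ g) , av))
      where
      color : ∀ τ → Compatible p τ → τ u ≡ a
      color τ co with co u
      ... | inj₁ eq = case trans (sym pu≡a) eq of λ ()
      ... | inj₂ eq = Fin.toℕ-injective (ℕ.suc-injective (trans (sym eq) pu≡a))

    ∑-X≤Z : ∀ p u us → sum (X p u us) ≤ Z p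
    ∑-X≤Z p u us = begin
      sum (X p u us)                    ≡⟨ ∑ᶜ-sum n x ⟨
      ∑ᶜ n (λ τ → sum (x τ))            ≤⟨ ∑ᶜ-mono n (λ τ → ℕ.≤-trans (ℕ.≤-reflexive (sum-single (τ u)
                                             (λ a a≢τu → ⟦⟧-false (x? τ a) (λ (_ , τu≡a , _) → a≢τu (sym τu≡a)))))
                                             (⟦⟧-mono (x? τ (τ u)) (good? p τ) proj₁)) ⟩
      Z p                               ∎
      where
      open ℕ.≤-Reasoning
      x? : ∀ τ a → Dec (Good p τ × τ u ≡ a × Avoids us a τ)
      x? τ a = good? p τ ×-dec (τ u Fin.≟ a) ×-dec avoids? us a τ
      x : Coloring n q → Fin q → ℕ
      x τ a = ⟦ x? τ a ⟧

    ∑-∑X≤ : ∀ p us → sum (∑X p us) ≤ length us * Z p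
    ∑-∑X≤ p []       = ℕ.≤-reflexive (trans (sum-const q 0) (ℕ.*-zeroʳ q))
    ∑-∑X≤ p (u ∷ us) = ℕ.≤-trans (ℕ.≤-reflexive (∑-distrib-+ (X p u us) (∑X p us)))
                                 (ℕ.+-mono-≤ (∑-X≤Z p u us) (∑-∑X≤ p us))

    module _ (adj : AdjacencyLists G) where

      open AdjacencyLists adj using (neighbors; correct)

      recolor-good : ∀ {p x τ} c c′ → p (toℕ x) ≡ 0 ⊎ p (toℕ x) ≡ suc (toℕ c′) →
                     Good (p [ toℕ x ↦ 0 ]) (recolor τ x c) × Avoids (neighbors x) c′ (recolor τ x c) →
                     Good p (recolor τ x c′) × Avoids (neighbors x) c (recolor τ x c′)
      recolor-good {p} {x} {τ} c c′ px ((pr , co) , av) = (pr′ , co′) , av′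
        where
        edge≢ : ∀ {u w} → E u w → w ≢ u
        edge≢ e refl = irrefl refl e
        same : ∀ {a u} → u ≢ x → recolor τ x a u ≡ recolor τ x c u
        same {a} u≢x = trans (recolor-other τ a u≢x) (sym (recolor-other τ c u≢x))
        avoid : ∀ {w} → E x w → c′ ≢ recolor τ x c w
        avoid {w} e c′≡ = All.lookup av (Equivalence.from (correct x w) e) (sym c′≡)
        pr′ : Proper G q (recolor τ x c′)
        pr′ u w e with u Fin.≟ x | w Fin.≟ x
        ... | yes refl | yes refl = contradiction e (irrefl refl)
        ... | yes refl | no w≢x   = λ eq → avoid e (trans (sym (recolor-same τ x c′)) (trans eq (same w≢x)))
        ... | no u≢x   | yes refl = λ eq →
            avoid (E-sym e) (trans (sym (recolor-same τ x c′)) (trans (sym eq) (same u≢x)))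
        ... | no u≢x   | no w≢x   = λ eq → pr u w e (trans (sym (same u≢x)) (trans eq (same w≢x)))
        co′ : Compatible p (recolor τ x c′)
        co′ u with u Fin.≟ x
        co′ u | yes refl = Data.Sum.map₂ (λ eq → trans eq (cong (suc ∘ toℕ) (sym (recolor-same τ x c′)))) px
        co′ u | no u≢x with co u | ↦-other p {toℕ x} 0 (u≢x ∘ Fin.toℕ-injective)
        ... | inj₁ eq | eq′ = inj₁ (trans (sym eq′) eq)
        ... | inj₂ eq | eq′ = inj₂ (trans (sym eq′) (trans eq (cong (suc ∘ toℕ) (sym (same u≢x)))))
        av′ : Avoids (neighbors x) c (recolor τ x c′)
        av′ = All.tabulate λ {w} w∈ eq → let e = Equivalence.to (correct x w) w∈ in
          pr x w e (trans (recolor-same τ x c) (trans (sym eq) (same (edge≢ e))))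

      -- Both sides count the pairs (τ , c′) such that no neighbor of x has color c
      -- or c′: recolor x from c to c′.
      exchange : ∀ {p x c} → p (toℕ x) ≡ suc (toℕ c) → sum (F p (neighbors x)) ≡ F (p [ toℕ x ↦ 0 ]) (neighbors x) c
      exchange {p} {x} {c} px≡c = ℕ.*-cancelˡ-≡ _ _ q {{ℕ.>-nonZero (ℕ.≤-<-trans z≤n (Fin.toℕ<n c))}} (begin
        q * sum (F p N)                                          ≡⟨ cong (q *_) (∑ᶜ-sum n f) ⟨
        q * ∑ᶜ n (λ τ → sum (f τ))                               ≡⟨ ∑ᶜ-recolor x (λ τ → sum (f τ)) ⟨
        ∑ᶜ n (λ τ → sum λ a → sum (f (recolor τ x a)))           ≡⟨ ∑ᶜ-cong n swap ⟩
        ∑ᶜ n (λ τ → sum λ c′ → f₀ (recolor τ x c′))              ≡⟨ ∑ᶜ-recolor x f₀ ⟩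
        q * F (p [ toℕ x ↦ 0 ]) N c                              ∎)
        where
        open ≡-Reasoning
        N = neighbors x
        f? : ∀ τ c′ → Dec (Good p τ × Avoids N c′ τ)
        f? τ c′ = good? p τ ×-dec avoids? N c′ τ
        f₀? : ∀ τ → Dec (Good (p [ toℕ x ↦ 0 ]) τ × Avoids N c τ)
        f₀? τ = good? (p [ toℕ x ↦ 0 ]) τ ×-dec avoids? N c τ
        f : Coloring n q → Fin q → ℕ
        f τ c′ = ⟦ f? τ c′ ⟧
        f₀ : Coloring n q → ℕ
        f₀ τ = ⟦ f₀? τ ⟧
        color : ∀ τ a → Compatible p (recolor τ x a) → a ≡ c
        color τ a co with co x
        ... | inj₁ eq = case trans (sym px≡c) eq of λ ()
        ... | inj₂ eq = trans (sym (recolor-same τ x a)) (Fin.toℕ-injective (ℕ.suc-injective (trans (sym eq) px≡c)))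
        forget : ∀ {τ} → Good p τ → Good (p [ toℕ x ↦ 0 ]) τ
        forget {τ} (pr , co) = pr , λ u → case u Fin.≟ x of λ where
          (yes refl) → inj₁ (↦-same p (toℕ x) 0)
          (no u≢x)   → subst (λ a → a ≡ 0 ⊎ a ≡ suc (toℕ (τ u))) (sym (↦-other p 0 (u≢x ∘ Fin.toℕ-injective))) (co u)
        forget² : ∀ {τ} → Good (p [ toℕ x ↦ 0 ]) τ → Good (p [ toℕ x ↦ 0 ] [ toℕ x ↦ 0 ]) τ
        forget² {τ} (pr , co) = pr , λ u → case u Fin.≟ x of λ where
          (yes refl) → inj₁ (↦-same (p [ toℕ x ↦ 0 ]) (toℕ x) 0)
          (no u≢x)   → subst (λ a → a ≡ 0 ⊎ a ≡ suc (toℕ (τ u)))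
              (sym (↦-other (p [ toℕ x ↦ 0 ]) 0 (u≢x ∘ Fin.toℕ-injective))) (co u)
        swap : ∀ τ → sum (λ a → sum (f (recolor τ x a))) ≡ sum (λ c′ → f₀ (recolor τ x c′))
        swap τ = trans (∑-comm (λ a c′ → f (recolor τ x a) c′)) (sum-cong-≗ λ c′ →
          trans (sum-single c (λ a a≢c → ⟦⟧-false (f? (recolor τ x a) c′) (λ ((_ , co) , _) → a≢c (color τ a co))))
            (⟦⟧-cong (f? (recolor τ x c) c′) (f₀? (recolor τ x c′))
              (λ (g , av) → recolor-good {p [ toℕ x ↦ 0 ]} {x} {τ} c c′ (inj₁ (↦-same p (toℕ x) 0))
                  (forget² (forget g) , av))
              (λ (g , av) → recolor-good {p} {x} {τ} c′ c (inj₂ px≡c) (g , av))))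

      q*Z : ∀ {p x c} → p (toℕ x) ≡ suc (toℕ c) →
            q * Z p ≡ F (p [ toℕ x ↦ 0 ]) (neighbors x) c + sum (∑X p (neighbors x))
      q*Z {p} {x} {c} px≡c = begin
        q * Z p                                                  ≡⟨ sum-const q (Z p) ⟨
        sum {q} (const (Z p))                                    ≡⟨ sum-cong-≗ (Z-split p (neighbors x)) ⟩
        sum (λ c′ → F p (neighbors x) c′ + ∑X p (neighbors x) c′) ≡⟨ ∑-distrib-+ (F p (neighbors x))
            (∑X p (neighbors x)) ⟩
        sum (F p (neighbors x)) + sum (∑X p (neighbors x))       ≡⟨ cong (_+ sum (∑X p (neighbors x)))
            (exchange {p} px≡c) ⟩
        F (p [ toℕ x ↦ 0 ]) (neighbors x) c + sum (∑X p (neighbors x)) ∎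
        where open ≡-Reasoning

open Colorings

module Conditionals where

  open import Data.Nat using (_+_; _*_; _≤_; _<_)
  open import Data.List.Membership.Propositional.Properties using (∈-∃++; ∈-++⁺ˡ; ∈-++⁺ʳ; ∈-++⁻)
  import Data.List.Membership.DecPropositional as DecMembership
  open import Relation.Unary.Properties using (_∩?_)

  unique-⊆-length : ∀ {A : Set} {xs ys : List A} → Unique xs → (∀ {x} → x ∈ xs → x ∈ ys) → length xs ≤ length ys
  unique-⊆-length {xs = []}     _           _  = z≤n
  unique-⊆-length {xs = x ∷ xs} (x∉ ∷ uniq) ⊆ys with ∈-∃++ (⊆ys (here refl))
  ... | as , bs , refl = begin
    suc (length xs)               ≤⟨ s≤s (unique-⊆-length uniq rest) ⟩
    suc (length (as ++ bs))       ≡⟨ cong suc (List.length-++ as) ⟩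
    suc (length as + length bs)   ≡⟨ ℕ.+-suc (length as) (length bs) ⟨
    length as + suc (length bs)   ≡⟨ List.length-++ as ⟨
    length (as ++ x ∷ bs)         ∎
    where
    open ℕ.≤-Reasoning
    rest : ∀ {y} → y ∈ xs → y ∈ as ++ bs
    rest y∈xs with ∈-++⁻ as (⊆ys (there y∈xs))
    ... | inj₁ y∈as         = ∈-++⁺ˡ y∈as
    ... | inj₂ (here refl)  = contradiction refl (All.lookup x∉ y∈xs)
    ... | inj₂ (there y∈bs) = ∈-++⁺ʳ as y∈bs

  _∈ᶠ?_ : ∀ {n} (x : Fin n) xs → Dec (x ∈ xs)
  _∈ᶠ?_ = DecMembership._∈?_ Fin._≟_

  fresh-color : ∀ {q} (cs : List (Fin q)) → length cs < q → ∃ λ a → a ∉ cs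
  fresh-color {q} cs short = Fin.¬∀⟶∃¬ q (_∈ cs) (_∈ᶠ? cs) λ all →
    let i , j , i<j , eq = Fin.pigeonhole short (λ a → Any.index (all a)) in
    Fin.<⇒≢ i<j (trans (Any.lookup-index (all i)) (trans (cong (lookup cs) eq) (sym (Any.lookup-index (all j)))))

  ÷₀-* : ∀ a {b} → 0ℚ ℚ.< b → (a ÷₀ b) ℚ.* b ≡ a
  ÷₀-* a {b} 0<b with b ℚ.≟ 0ℚ
  ... | yes refl = contradiction 0<b (ℚ.<-irrefl refl)
  ... | no b≢0 = trans (ℚ.*-assoc a (ℚ.1/_ b {{ℚ.≢-nonZero b≢0}}) b)
                (trans (cong (a ℚ.*_) (ℚ.*-inverseˡ b {{ℚ.≢-nonZero b≢0}})) (ℚ.*-identityʳ a))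

  module Conditioning {n : ℕ} (G : Graph n) (adj : AdjacencyLists G) (q : ℕ)
    (1≤Δ : 1 ≤ Graph.maxDegree G) (65Δ≤q : 65 * Graph.maxDegree G ≤ q) where

    open Graph G using (E; E?; maxDegree; degree) renaming (sym to E-sym; irrefl to E-irrefl)
    open AdjacencyLists adj
    open Counting G q

    Δ : ℕ
    Δ = maxDegree

    length-neighbors : ∀ x → length (neighbors x) ≤ Δ
    length-neighbors x = ℕ.≤-trans
      (unique-⊆-length (unique x) (λ {w} w∈ → ∈-filter⁺ (E? x) (∈-allFin w) (Equivalence.to (correct x w) w∈)))
      (All.lookup (xs≤max 0 (map degree (allFin n))) (∈-map⁺ degree (∈-allFin x)))

    Δ<q : Δ < q
    Δ<q = begin-strict
      Δ              <⟨ ℕ.m<m+n Δ 1≤Δ ⟩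
      Δ + Δ          ≤⟨ ℕ.+-monoʳ-≤ Δ (ℕ.m≤m+n Δ (63 * Δ)) ⟩
      65 * Δ         ≤⟨ 65Δ≤q ⟩
      q              ∎
      where open ℕ.≤-Reasoning

    Z-unpin : ∀ {p x c} k → k + Δ ≤ q → p (toℕ x) ≡ suc (toℕ c) → k * Z p ≤ Z (p [ toℕ x ↦ 0 ])
    Z-unpin {p} {x} {c} k le px≡c = ℕ.+-cancelʳ-≤ (Δ * Z p) _ _ (begin
      k * Z p + Δ * Z p            ≡⟨ ℕ.*-distribʳ-+ (Z p) k Δ ⟨
      (k + Δ) * Z p                ≤⟨ ℕ.*-monoˡ-≤ (Z p) le ⟩
      q * Z p                      ≡⟨ q*Z adj {p} px≡c ⟩
      F p₀ N c + sum (∑X p N)      ≤⟨ ℕ.+-mono-≤ (F≤Z p₀ N c) (∑-∑X≤ p N) ⟩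
      Z p₀ + length N * Z p        ≤⟨ ℕ.+-monoʳ-≤ (Z p₀) (ℕ.*-monoˡ-≤ (Z p) (length-neighbors x)) ⟩
      Z p₀ + Δ * Z p               ∎)
      where
      open ℕ.≤-Reasoning
      open import Algebra.Properties.Semiring.Sum ℕ.+-*-semiring using (sum)
      N = neighbors x
      p₀ = p [ toℕ x ↦ 0 ]

    Z-blocked : ∀ {p x c} → p (toℕ x) ≡ suc (toℕ c) → Any (λ u → p (toℕ u) ≡ suc (toℕ c)) (neighbors x) → Z p ≡ 0
    Z-blocked {p} {x} {c} px≡c blocked = trans (∑ᶜ-cong n λ τ → ⟦⟧-false (good? p τ) λ (pr , co) →
      let u , u∈ , pu≡c = Data.List.Membership.Propositional.find blocked in
      pr x u (Equivalence.to (correct x u) u∈) (trans (color co px≡c) (sym (color co pu≡c)))) (∑ᶜ-zero n)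
      where
      color : ∀ {τ u} → Compatible p τ → p (toℕ u) ≡ suc (toℕ c) → τ u ≡ c
      color {u = u} co pu≡c with co u
      ... | inj₁ pu≡0 = case trans (sym pu≡0) pu≡c of λ ()
      ... | inj₂ pu≡τ = Fin.toℕ-injective (ℕ.suc-injective (trans (sym pu≡τ) pu≡c))

    ∑X-small : ∀ p us c → ¬ Any (λ u → p (toℕ u) ≡ suc (toℕ c)) us → (∀ (u : Fin n) → p (toℕ u) ≤ q) →
        64 * Δ * ∑X p us c ≤ length us * Z p
    ∑X-small p []       c free p≤q = ℕ.≤-reflexive (ℕ.*-zeroʳ (64 * Δ))
    ∑X-small p (u ∷ us) c free p≤q = begin
      64 * Δ * (X p u us c + ∑X p us c)              ≡⟨ ℕ.*-distribˡ-+ (64 * Δ) (X p u us c) _ ⟩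
      64 * Δ * X p u us c + 64 * Δ * ∑X p us c       ≤⟨ ℕ.+-mono-≤ head (∑X-small p us c (free ∘ there) p≤q) ⟩
      Z p + length us * Z p                          ∎
      where
      open ℕ.≤-Reasoning
      head : 64 * Δ * X p u us c ≤ Z p
      head with p (toℕ u) in eq
      ... | suc a = ℕ.≤-trans
          (ℕ.≤-reflexive (trans
          (cong (64 * Δ *_) (X-pinned {p} us c pu≡
          (λ c≡a → free (here (subst (λ b → p (toℕ u) ≡ suc (toℕ b)) (sym c≡a) pu≡))))) (ℕ.*-zeroʳ (64 * Δ)))) z≤n
        where
        a<q : a < q
        a<q = subst (_≤ q) eq (p≤q u)
        pu≡ : p (toℕ u) ≡ suc (toℕ (fromℕ< a<q))
        pu≡ = trans eq (cong suc (sym (Fin.toℕ-fromℕ< a<q)))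
      ... | zero = begin
        64 * Δ * X p u us c                   ≡⟨ cong (64 * Δ *_) (X-free {p} us c eq) ⟩
        64 * Δ * F p₁ us c                    ≤⟨ ℕ.*-monoʳ-≤ (64 * Δ) (F≤Z p₁ us c) ⟩
        64 * Δ * Z p₁                         ≤⟨ Z-unpin {p₁} (64 * Δ)
            (ℕ.≤-trans (ℕ.≤-reflexive (ℕ.+-comm (64 * Δ) Δ)) 65Δ≤q) (↦-same p (toℕ u) _) ⟩
        Z (p₁ [ toℕ u ↦ 0 ])                  ≡⟨ Z-cong (↦-undo {p} (toℕ u) (suc (toℕ c)) eq) ⟩
        Z p                                   ∎
        where
        p₁ = p [ toℕ u ↦ suc (toℕ c) ]

    Z-pin : ∀ p v c → ¬ Any (λ u → p (toℕ u) ≡ suc (toℕ c)) (neighbors v) → (∀ (u : Fin n) → p (toℕ u) ≤ q) →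
        p (toℕ v) ≡ 0 →
            63 * Z p ≤ 64 * (q * Z (p [ toℕ v ↦ suc (toℕ c) ]))
    Z-pin p v c free p≤q pv≡0 = ℕ.+-cancelʳ-≤ (Z p) _ _ (begin
      63 * Z p + Z p                   ≡⟨ ℕ.+-comm (63 * Z p) (Z p) ⟩
      64 * Z p                         ≡⟨ cong (64 *_) (Z-split p N c) ⟩
      64 * (F p N c + ∑X p N c)        ≡⟨ ℕ.*-distribˡ-+ 64 (F p N c) _ ⟩
      64 * F p N c + 64 * ∑X p N c     ≤⟨ ℕ.+-mono-≤ (ℕ.*-monoʳ-≤ 64 F≤) small ⟩
      64 * (q * Z p₁) + Z p            ∎)
      where
      open ℕ.≤-Reasoning
      N = neighbors v
      p₁ = p [ toℕ v ↦ suc (toℕ c) ]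
      small : 64 * ∑X p N c ≤ Z p
      small = ℕ.*-cancelˡ-≤ Δ {{ℕ.>-nonZero 1≤Δ}} (begin
        Δ * (64 * ∑X p N c)   ≡⟨ ℕ.*-assoc Δ 64 _ ⟨
        Δ * 64 * ∑X p N c     ≡⟨ cong (_* ∑X p N c) (ℕ.*-comm Δ 64) ⟩
        64 * Δ * ∑X p N c     ≤⟨ ∑X-small p N c free p≤q ⟩
        length N * Z p        ≤⟨ ℕ.*-monoˡ-≤ (Z p) (length-neighbors v) ⟩
        Δ * Z p               ∎)
      F-local : ∀ {p p′} → p ≗ p′ → F p N c ≡ F p′ N c
      F-local {p} {p′} eq = ∑ᶜ-cong n λ τ → ⟦⟧-cong (good? p τ ×-dec avoids? N c τ) (good? p′ τ ×-dec avoids? N c τ)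
        (λ ((pr , co) , av) → (pr , λ u → subst (λ a → a ≡ 0 ⊎ a ≡ suc (toℕ (τ u))) (eq (toℕ u)) (co u)) , av)
        (λ ((pr , co) , av) → (pr , λ u → subst (λ a → a ≡ 0 ⊎ a ≡ suc (toℕ (τ u))) (sym (eq (toℕ u))) (co u)) , av)
      F≤ : F p N c ≤ q * Z p₁
      F≤ = begin
        F p N c                     ≡⟨ F-local (↦-undo {p} (toℕ v) (suc (toℕ c)) pv≡0) ⟨
        F (p₁ [ toℕ v ↦ 0 ]) N c    ≤⟨ ℕ.m≤m+n _ _ ⟩
        F (p₁ [ toℕ v ↦ 0 ]) N c + _ ≡⟨ q*Z adj {p₁} (↦-same p (toℕ v) (suc (toℕ c))) ⟨
        q * Z p₁                    ∎

    module _ (σ : PartialProperColoring G q) where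

      open PartialProperColoring σ renaming (unique to Λ-unique; proper to σ-proper)

      private
        extension : ∀ es → Unique (map proj₁ es) → ∃ λ (τ : Coloring n q) → All (λ (u , a) → τ u ≡ a) es
        extension []             _           = const (fromℕ< (ℕ.≤-<-trans z≤n Δ<q)) , []
        extension ((u , a) ∷ es) (u∉ ∷ uniq) =
          let τ , ext = extension es uniq in
          recolor τ u a , recolor-same τ u a ∷ All.tabulate λ {(w , b)} w∈ →
            trans (recolor-other τ a λ w≡u → All.lookup u∉ (∈-map⁺ proj₁ w∈) (sym w≡u)) (All.lookup ext w∈)

        ProperOn : List (Fin n) → Set
        ProperOn xs = ∃ λ (τ : Coloring n q) → Extends τ × (∀ {u w} → u ∈ xs ++ Λ → w ∈ xs ++ Λ → E u w → τ u ≢ τ w)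

        insert : ∀ {x xs} (P : ProperOn xs) → x ∉ xs ++ Λ → (∃ λ a → a ∉ map (proj₁ P) (neighbors x)) →
            ProperOn (x ∷ xs)
        insert {x} {xs} (τ , ext , ok) x∉ (a , a∉) = recolor τ x a , ext′ , ok′
          where
          other : ∀ {u} → u ∈ xs ++ Λ → recolor τ x a u ≡ τ u
          other u∈ = recolor-other τ a λ { refl → x∉ u∈ }
          ext′ : Extends (recolor τ x a)
          ext′ = All.tabulate λ u∈ → trans (other (∈-++⁺ʳ xs (∈-map⁺ proj₁ u∈))) (All.lookup ext u∈)
          new : ∀ {w} → w ∈ xs ++ Λ → E x w → recolor τ x a x ≢ recolor τ x a w
          new {w} w∈ e eq = a∉ (subst (_∈ map τ (neighbors x))
            (trans (sym (other w∈)) (trans (sym eq) (recolor-same τ x a)))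
                (∈-map⁺ τ (Equivalence.from (correct x w) e)))
          ok′ : ∀ {u w} → u ∈ x ∷ xs ++ Λ → w ∈ x ∷ xs ++ Λ → E u w → recolor τ x a u ≢ recolor τ x a w
          ok′ (here refl) (here refl) e = contradiction e (E-irrefl refl)
          ok′ (here refl) (there w∈)  e = new w∈ e
          ok′ (there u∈)  (here refl) e = new u∈ (E-sym e) ∘ sym
          ok′ (there u∈)  (there w∈)  e eq = ok u∈ w∈ e (trans (sym (other u∈)) (trans eq (other w∈)))

        insert? : ∀ {x xs} → Dec (x ∈ xs ++ Λ) → ProperOn xs → ProperOn (x ∷ xs)
        insert? {x} {xs} (yes x∈) (τ , ext , ok) = τ , ext , λ u∈ w∈ → ok (shrink u∈) (shrink w∈)
          where
          shrink : ∀ {u} → u ∈ x ∷ xs ++ Λ → u ∈ xs ++ Λ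
          shrink (here refl) = x∈
          shrink (there u∈)  = u∈
        insert? {x} (no x∉) P@(τ , _) = insert P x∉ (fresh-color (map τ (neighbors x))
          (ℕ.≤-<-trans (ℕ.≤-reflexive (List.length-map τ (neighbors x))) (ℕ.≤-<-trans (length-neighbors x) Δ<q)))

        greedy : ∀ xs → ProperOn xs
        greedy [] = let τ , ext = extension entries Λ-unique in τ , ext , λ u∈ w∈ e eq →
          let (u , a) , u,a∈ , u≡ = ∈-map⁻ proj₁ u∈ ; (w , b) , w,b∈ , w≡ = ∈-map⁻ proj₁ w∈ in
          σ-proper u,a∈ w,b∈ (subst₂ E u≡ w≡ e)
            (trans (sym (All.lookup ext u,a∈)) (trans (subst₂ (λ u w → τ u ≡ τ w) u≡ w≡ eq) (All.lookup ext w,b∈)))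
        greedy (x ∷ xs) = insert? (x ∈ᶠ? (xs ++ Λ)) (greedy xs)

      proper-extension : ∃ λ (τ : Coloring n q) → Proper G q τ × Extends τ
      proper-extension = let τ , ext , ok = greedy (allFin n) in
        τ , (λ u w → ok (∈-++⁺ˡ (∈-allFin u)) (∈-++⁺ˡ (∈-allFin w))) , ext

      record Represents (p : ℕ → ℕ) : Set where
        field
          pinned : ∀ {u a} → (u , a) ∈ entries → p (toℕ u) ≡ suc (toℕ a)
          free   : ∀ {u} → u ∉ Λ → p (toℕ u) ≡ 0

        pinned? : ∀ u → p (toℕ u) ≡ 0 ⊎ ∃ λ a → (u , a) ∈ entries
        pinned? u = case u ∈ᶠ? Λ of λ where
          (no u∉)  → inj₁ (free u∉)
          (yes u∈) → let (w , a) , w,a∈ , u≡w = ∈-map⁻ proj₁ u∈ in inj₂ (a , subst (λ u → (u , a) ∈ entries) (sym u≡w) w,a∈)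

        bounded : ∀ u → p (toℕ u) ≤ q
        bounded u = case pinned? u of λ where
          (inj₁ pu≡0)      → subst (_≤ q) (sym pu≡0) z≤n
          (inj₂ (a , u,a∈)) → subst (_≤ q) (sym (pinned u,a∈)) (Fin.toℕ<n a)

        extends⇒compatible : ∀ {τ} → Extends τ → Compatible p τ
        extends⇒compatible {τ} ext u = Data.Sum.map₂ (λ (a , u,a∈) →
          trans (pinned u,a∈) (cong (suc ∘ toℕ) (sym (All.lookup ext u,a∈)))) (pinned? u)

        compatible⇒extends : ∀ {τ} → Compatible p τ → Extends τ
        compatible⇒extends {τ} co = All.tabulate λ {(u , a)} u,a∈ → case co u of λ where
          (inj₁ eq) → case trans (sym (pinned u,a∈)) eq of λ ()
          (inj₂ eq) → Fin.toℕ-injective (ℕ.suc-injective (trans (sym eq) (pinned u,a∈)))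

        private
          proper-cong : ∀ {τ τ′} → τ ≗ τ′ → Proper G q τ → Proper G q τ′
          proper-cong eq pr u w e eq′ = pr u w e (trans (eq u) (trans eq′ (sym (eq w))))

          extends-cong : ∀ {τ τ′} → τ ≗ τ′ → Extends τ → Extends τ′
          extends-cong eq = All.map λ {(u , a)} → trans (sym (eq u))

          count : ∀ {A : Pred (Coloring n q) 0ℓ} (A? : Decidable A) → (∀ {τ τ′} → τ ≗ τ′ → A τ → A τ′) →
                  length (filter A? (properColorings G q)) ≡ ∑ᶜ n λ τ → ⟦ proper? G q τ ×-dec A? τ ⟧
          count A? A-cong = trans (length-filter² A? (proper? G q) Fin.finToFun)
              (∑ᶜ-finToFun n (λ τ → ⟦ proper? G q τ ×-dec A? τ ⟧)
            λ {τ} {τ′} eq → ⟦⟧-cong (proper? G q τ ×-dec A? τ) (proper? G q τ′ ×-dec A? τ′)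
              (λ (pr , a) → proper-cong eq pr , A-cong eq a) (λ (pr , a) → proper-cong (sym ∘ eq) pr ,
                  A-cong (sym ∘ eq) a))

        count-extends : length (filter extends? (properColorings G q)) ≡ Z p
        count-extends = trans (count extends? extends-cong) (∑ᶜ-cong n λ τ →
          ⟦⟧-cong (proper? G q τ ×-dec extends? τ) (good? p τ)
            (λ (pr , ext) → pr , extends⇒compatible ext) (λ (pr , co) → pr , compatible⇒extends co))

        count-extends-at : ∀ v c → v ∉ Λ →
          length (filter ((λ τ → τ v Fin.≟ c) ∩? extends?) (properColorings G q)) ≡ Z (p [ toℕ v ↦ suc (toℕ c) ])
        count-extends-at v c v∉Λ = begin
          length (filter A? (properColorings G q))                   ≡⟨ count A? (λ eq (τv≡c , ext) →
              trans (sym (eq v)) τv≡c , extends-cong eq ext) ⟩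
          ∑ᶜ n (λ τ → ⟦ proper? G q τ ×-dec A? τ ⟧)                  ≡⟨ ∑ᶜ-cong n
              (λ τ → ⟦⟧-cong (proper? G q τ ×-dec A? τ)
                                                                          (good? p τ ×-dec (τ v Fin.≟ c) ×-dec avoids?
                                                                              [] c τ)
                                                                          (λ (pr , τv≡c , ext) →
                                                                              (pr , extends⇒compatible ext) , τv≡c , [])
                                                                          (λ ((pr , co) , τv≡c , _) → pr , τv≡c ,
                                                                              compatible⇒extends co)) ⟩
          X p v [] c                                                 ≡⟨ X-free {p} [] c (free v∉Λ) ⟩
          F (p [ toℕ v ↦ suc (toℕ c) ]) [] c                         ≡⟨ ℕ.+-identityʳ _ ⟨
          F (p [ toℕ v ↦ suc (toℕ c) ]) [] c + 0                     ≡⟨ Z-split (p [ toℕ v ↦ suc (toℕ c) ]) [] c ⟨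
          Z (p [ toℕ v ↦ suc (toℕ c) ])                              ∎
          where
          open ≡-Reasoning
          A? = (λ τ → τ v Fin.≟ c) ∩? extends?

        0<Z : 0 < Z p
        0<Z = let τ , pr , ext = proper-extension in
          ∑ᶜ-positive n (λ τ → ⟦ good? p τ ⟧)
            (λ {τ} {τ′} eq → ⟦⟧-cong (good? p τ) (good? p τ′)
              (λ (pr , co) → proper-cong eq pr , extends⇒compatible (extends-cong eq (compatible⇒extends co)))
              (λ (pr , co) → proper-cong (sym ∘ eq) pr ,
                  extends⇒compatible (extends-cong (sym ∘ eq) (compatible⇒extends co))))
            τ (ℕ.≤-reflexive (sym (⟦⟧-true (good? p τ) (pr , extends⇒compatible ext))))

        marginal-Z : ∀ v c → v ∉ Λ → marginal G q σ v c ℚ.* fromℕ (Z p) ≡ fromℕ (Z (p [ toℕ v ↦ suc (toℕ c) ]))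
        marginal-Z v c v∉Λ = subst₂ (λ b a → marginal G q σ v c ℚ.* fromℕ b ≡ fromℕ a) count-extends
            (count-extends-at v c v∉Λ)
          (quotient (fromℕ ℓ₁) {fromℕ ℓ} {fromℕ L} (0<fromℕ 0<ℓ)
              (0<fromℕ (ℕ.<-≤-trans 0<ℓ (List.length-filter extends? (properColorings G q)))))
          where
          ℓ₁ ℓ L : ℕ
          ℓ₁ = length (filter ((λ τ → τ v Fin.≟ c) ∩? extends?) (properColorings G q))
          ℓ = length (filter extends? (properColorings G q))
          L = length (properColorings G q)
          0<ℓ : 0 < ℓ
          0<ℓ = subst (0 <_) (sym count-extends) 0<Z
          quotient : ∀ a {b t} → 0ℚ ℚ.< b → 0ℚ ℚ.< t → ((a ÷₀ t) ÷₀ (b ÷₀ t)) ℚ.* b ≡ a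
          quotient a {b} {t} 0<b 0<t = begin
            m ℚ.* b           ≡⟨ cong (m ℚ.*_) (÷₀-* b 0<t) ⟨
            m ℚ.* (b′ ℚ.* t)  ≡⟨ ℚ.*-assoc m b′ t ⟨
            m ℚ.* b′ ℚ.* t    ≡⟨ cong (ℚ._* t) (÷₀-* (a ÷₀ t) 0<b′) ⟩
            (a ÷₀ t) ℚ.* t    ≡⟨ ÷₀-* a 0<t ⟩
            a                 ∎
            where
            open ≡-Reasoning
            b′ m : ℚ
            b′ = b ÷₀ t
            m = (a ÷₀ t) ÷₀ b′
            0<b′ : 0ℚ ℚ.< b′
            0<b′ = ℚ.*-cancelʳ-<-nonNeg t {{ℚ.nonNegative (ℚ.<⇒≤ 0<t)}}
                (subst₂ ℚ._<_ (sym (ℚ.*-zeroˡ t)) (sym (÷₀-* b 0<t)) 0<b)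

open Conditionals

module Contributions where

  open import Algebra.Properties.Semiring.Sum ℕ.+-*-semiring using () renaming (sum to sumℕ)
  open import Data.Rational using (_+_; _*_; _-_; -_; _≤_; _<_)

  2ℚ : ℚ
  2ℚ = fromℕ 2

  ¼ : ℚ
  ¼ = ½ * ½

  avg-pred : ∀ {N} h → 0 ℕ.< N → fromℕ N * avg (N ∸ 1) h ≡ ∑ N h
  avg-pred {suc N} h _ = avg-∑ N h

  fromℕ-sum : ∀ {N} (f : Fin N → ℕ) (h : ℕ → ℚ) → (∀ i → fromℕ (f i) ≡ h (toℕ i)) → fromℕ (sumℕ f) ≡ ∑ N h
  fromℕ-sum {zero}  f h eq = refl
  fromℕ-sum {suc N} f h eq =
      trans (fromℕ-+ (f Fin.zero) _) (cong₂ _+_ (eq Fin.zero) (fromℕ-sum (f ∘ Fin.suc) (h ∘ suc) (eq ∘ Fin.suc)))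

  -- p₀ describes the partial coloring σ, which extends to 1 / ζ proper colorings.
  record Instance : Set₁ where
    field
      {n}   : ℕ
      G     : Graph n
      adj   : AdjacencyLists G
      q H   : ℕ
      1≤Δ   : 1 ℕ.≤ Graph.maxDegree G
      65Δ≤q : 65 ℕ.* Graph.maxDegree G ℕ.≤ q
      4Δ≤H  : 4 ℕ.* Graph.maxDegree G ℕ.≤ H
      16H≤q : 16 ℕ.* H ℕ.≤ q
      p₀    : ℕ → ℕ
      p₀≤q  : ∀ (u : Fin n) → p₀ (toℕ u) ℕ.≤ q
      ζ     : ℚ
      0≤ζ   : 0ℚ ≤ ζ
      Zζ≡1  : fromℕ (Counting.Z G q p₀) * ζ ≡ 1ℚ

  -- The value of a state is what the walk from that state contributes in
  -- expectation: the probability of the partial coloring p given σ, scaled by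
  -- 4 H for each of the s vertices that p adds to σ.
  module Values (inst : Instance) where

    open Instance inst

    open AdjacencyLists adj using (neighbors)
    open Counting G q using (Z; F; X; ∑X; F≤Z; Z-split; X-free; X-pinned; ∑-X-pinned; q*Z)
    open Conditioning G adj q 1≤Δ 65Δ≤q using (Δ; Δ<q; length-neighbors)

    0<q : 0 ℕ.< q
    0<q = ℕ.≤-<-trans z≤n Δ<q

    0<H : 0 ℕ.< H
    0<H = ℕ.≤-trans (ℕ.≤-trans 1≤Δ (ℕ.m≤m+n Δ (3 ℕ.* Δ))) 4Δ≤H

    color : ℕ → Fin q
    color k with k ℕ.<? q
    ... | yes k<q = fromℕ< k<q
    ... | no  _   = fromℕ< 0<q

    color-toℕ : ∀ c → color (toℕ c) ≡ c
    color-toℕ c with toℕ c ℕ.<? q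
    ... | yes c<q = Fin.fromℕ<-toℕ c c<q
    ... | no  c≮q = contradiction (Fin.toℕ<n c) c≮q

    toℕ-color : ∀ {k} → k ℕ.< q → toℕ (color k) ≡ k
    toℕ-color {k} k<q with k ℕ.<? q
    ... | yes k<q = Fin.toℕ-fromℕ< k<q
    ... | no  k≮q = contradiction k<q k≮q

    unit : ℕ → ℚ
    unit zero    = ζ
    unit (suc s) = fromℕ (4 ℕ.* H) * unit s

    0≤unit : ∀ s → 0ℚ ≤ unit s
    0≤unit zero    = 0≤ζ
    0≤unit (suc s) = 0≤* (0≤fromℕ (4 ℕ.* H)) (0≤unit s)

    g : (ℕ → ℕ) → ℕ → ℚ
    g p s = fromℕ (Z p) * unit s

    -- Halved so that the coefficients in f-step have absolute sum below 1.
    f : (ℕ → ℕ) → ℕ → List (Fin n) → Fin q → ℚ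
    f p s us c = ½ * fromℕ (F p us c) * unit s

    0≤g : ∀ p s → 0ℚ ≤ g p s
    0≤g p s = 0≤* (0≤fromℕ (Z p)) (0≤unit s)

    0≤f : ∀ p s us c → 0ℚ ≤ f p s us c
    0≤f p s us c = 0≤* (0≤* (ℚ.<⇒≤ (ℚ.positive⁻¹ ½)) (0≤fromℕ (F p us c))) (0≤unit s)

    f≤g : ∀ p s us c → f p s us c ≤ g p s
    f≤g p s us c = *-monoʳ (0≤unit s) (ℚ.≤-trans
      (*-monoʳ {fromℕ (F p us c)} {½} {1ℚ} (0≤fromℕ (F p us c)) (*≤* (ℤ.+≤+ (s≤s z≤n))))
      (ℚ.≤-trans (ℚ.≤-reflexive (ℚ.*-identityˡ (fromℕ (F p us c)))) (fromℕ-mono (F≤Z p us c))))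

    branchValue : (p : ℕ → ℕ) (s : ℕ) (us : List (Fin n)) (u : Fin n) → ℕ → ℚ
    branchValue p s us u zero    = avg (q ∸ 1) λ k → f (p [ toℕ u ↦ suc k ]) (suc s) us (color k)
    branchValue p s us u (suc a) = avg (q ∸ 1) λ z → if 4 ℕ.* H ∸ z ≡ᵇ 0 then 0ℚ else f p s us (color a)

    pushValue : (p : ℕ → ℕ) (s : ℕ) (us : List (Fin n)) (u : Fin n) (c : Fin q) → ℕ → ℚ
    pushValue p s us u c zero    = - f (p [ toℕ u ↦ suc (toℕ c) ]) (suc s) us c
    pushValue p s us u c (suc a) = 0ℚ

    gNext : (ℕ → ℕ) → ℕ → List (Fin n) → ℚ
    gNext p s []       = 0ℚ
    gNext p s (u ∷ us) = branchValue p s us u (p (toℕ u))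

    fNext : (ℕ → ℕ) → ℕ → Fin q → List (Fin n) → ℚ
    fNext p s c []       = 0ℚ
    fNext p s c (u ∷ us) = pushValue p s us u c (p (toℕ u))

    pinned-color : ∀ {p : ℕ → ℕ} {u : Fin n} {a} → p (toℕ u) ℕ.≤ q → p (toℕ u) ≡ suc a → p (toℕ u) ≡ suc (toℕ (color a))
    pinned-color p≤q eq = trans eq (cong suc (sym (toℕ-color (subst (ℕ._≤ q) eq p≤q))))

    branchValue-X : ∀ p s us u → p (toℕ u) ℕ.≤ q → ∀ a → p (toℕ u) ≡ a →
                    fromℕ q * branchValue p s us u a ≡ ½ * (fromℕ (4 ℕ.* H) * (fromℕ (sumℕ (X p u us)) * unit s))
    branchValue-X p s us u p≤q zero pu≡0 = begin
      fromℕ q * avg (q ∸ 1) v                    ≡⟨ avg-pred v 0<q ⟩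
      ∑ q v                                      ≡⟨ ∑-cong q (λ k → lemma₁ ½ (x k) W (unit s)) ⟩
      ∑ q (λ k → W½ * x k + 0ℚ * x k)            ≡⟨ ∑-linear q W½ x 0ℚ x ⟩
      W½ * ∑ q x + 0ℚ * ∑ q x                    ≡⟨ lemma₂ ½ W (unit s) (∑ q x) ⟩
      ½ * (W * (∑ q x * unit s))                 ≡⟨ cong (λ S → ½ * (W * (S * unit s))) (fromℕ-sum (X p u us) x X≡x) ⟨
      ½ * (W * (fromℕ (sumℕ (X p u us)) * unit s)) ∎
      where
      open ≡-Reasoning
      W W½ : ℚ
      W = fromℕ (4 ℕ.* H)
      W½ = ½ * (W * unit s)
      v x : ℕ → ℚ
      v k = f (p [ toℕ u ↦ suc k ]) (suc s) us (color k)
      x k = fromℕ (F (p [ toℕ u ↦ suc k ]) us (color k))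
      X≡x : ∀ c → fromℕ (X p u us c) ≡ x (toℕ c)
      X≡x c = cong fromℕ (trans (X-free {p} us c pu≡0) (cong (F (p [ toℕ u ↦ suc (toℕ c) ]) us) (sym (color-toℕ c))))
      lemma₁ : ∀ h x w u → h * x * (w * u) ≡ h * (w * u) * x + 0ℚ * x
      lemma₁ = RingSolver.solve-∀ ℚ-ring
      lemma₂ : ∀ h w u S → h * (w * u) * S + 0ℚ * S ≡ h * (w * (S * u))
      lemma₂ = RingSolver.solve-∀ ℚ-ring
    branchValue-X p s us u p≤q (suc a) pu≡a = begin
      fromℕ q * avg (q ∸ 1) v                    ≡⟨ avg-pred v 0<q ⟩
      ∑ q v                                      ≡⟨ ∑-prefix q (4 ℕ.* H) (f p s us (color a)) 4H≤q ⟩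
      W * (½ * fromℕ (F p us (color a)) * unit s) ≡⟨ lemma W ½ (fromℕ (F p us (color a))) (unit s) ⟩
      ½ * (W * (fromℕ (F p us (color a)) * unit s)) ≡⟨ cong (λ S → ½ * (W * (fromℕ S * unit s)))
          (∑-X-pinned {p} us (pinned-color {p} p≤q pu≡a)) ⟨
      ½ * (W * (fromℕ (sumℕ (X p u us)) * unit s)) ∎
      where
      open ≡-Reasoning
      W : ℚ
      W = fromℕ (4 ℕ.* H)
      v : ℕ → ℚ
      v z = if 4 ℕ.* H ∸ z ≡ᵇ 0 then 0ℚ else f p s us (color a)
      4H≤q : 4 ℕ.* H ℕ.≤ q
      4H≤q = ℕ.≤-trans (ℕ.*-monoˡ-≤ H (s≤s (s≤s (s≤s (s≤s (z≤n {12})))))) 16H≤q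
      lemma : ∀ w h x u → w * (h * x * u) ≡ h * (w * (x * u))
      lemma = RingSolver.solve-∀ ℚ-ring

    gNext-∑X : ∀ p s us → (∀ (u : Fin n) → p (toℕ u) ℕ.≤ q) →
               fromℕ q * ∑ᵗ (gNext p s) us ≡ ½ * (fromℕ (4 ℕ.* H) * (fromℕ (sumℕ (∑X p us)) * unit s))
    gNext-∑X p s [] p≤q = begin
      fromℕ q * 0ℚ                      ≡⟨ lemma (fromℕ q) ½ W (unit s) ⟩
      ½ * (W * (0ℚ * unit s))           ≡⟨ cong (λ k → ½ * (W * (fromℕ k * unit s)))
          (trans (sum-const q 0) (ℕ.*-zeroʳ q)) ⟨
      ½ * (W * (fromℕ (sumℕ (∑X p [])) * unit s)) ∎
      where
      open ≡-Reasoning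
      W : ℚ
      W = fromℕ (4 ℕ.* H)
      lemma : ∀ q h w u → q * 0ℚ ≡ h * (w * (0ℚ * u))
      lemma = RingSolver.solve-∀ ℚ-ring
    gNext-∑X p s (u ∷ us) p≤q = begin
      fromℕ q * (b + B)                                     ≡⟨ ℚ.*-distribˡ-+ (fromℕ q) b B ⟩
      fromℕ q * b + fromℕ q * B                             ≡⟨ cong₂ _+_
          (branchValue-X p s us u (p≤q u) (p (toℕ u)) refl) (gNext-∑X p s us p≤q) ⟩
      ½ * (W * (x * unit s)) + ½ * (W * (S * unit s))       ≡⟨ lemma ½ W x S (unit s) ⟩
      ½ * (W * ((x + S) * unit s))                          ≡⟨ cong (λ k → ½ * (W * (k * unit s)))
          (trans (sym (fromℕ-+ (sumℕ (X p u us)) (sumℕ (∑X p us))))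
          (cong fromℕ (sym (∑-distrib-+ (X p u us) (∑X p us))))) ⟩
      ½ * (W * (fromℕ (sumℕ (∑X p (u ∷ us))) * unit s))     ∎
      where
      open ≡-Reasoning
      open import Algebra.Properties.Semiring.Sum ℕ.+-*-semiring using (∑-distrib-+)
      W b B x S : ℚ
      W = fromℕ (4 ℕ.* H)
      b = branchValue p s us u (p (toℕ u))
      B = ∑ᵗ (gNext p s) us
      x = fromℕ (sumℕ (X p u us))
      S = fromℕ (sumℕ (∑X p us))
      lemma : ∀ h w x S u → h * (w * (x * u)) + h * (w * (S * u)) ≡ h * (w * ((x + S) * u))
      lemma = RingSolver.solve-∀ ℚ-ring

    g-step : ∀ {p x c} s → p (toℕ x) ≡ suc (toℕ c) → (∀ (u : Fin n) → p (toℕ u) ℕ.≤ q) →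
             ½ * avg (q ∸ 1) (λ y → if 16 ℕ.* H ∸ y ≡ᵇ 0 then 0ℚ else f (p [ toℕ x ↦ 0 ]) s (neighbors x) c)
           + ½ * avg (H ∸ 1) (λ y → gNext p (suc s) (drop y (neighbors x)))
           ≡ g p (suc s)
    g-step {p} {x} {c} s px≡c p≤q = *-cancelˡ (0<fromℕ 0<q) (*-cancelˡ (0<fromℕ 0<H) (begin
      h * (Q * (½ * A + ½ * B))                    ≡⟨ lemma₁ h Q ½ A B ⟩
      ½ * (h * (Q * A)) + ½ * (Q * (h * B))        ≡⟨ cong₂ (λ a b → ½ * (h * a) + ½ * (Q * b)) A≡ B≡ ⟩
      ½ * (h * (fromℕ (16 ℕ.* H) * (½ * F₀ * unit s))) + ½ * (Q * ∑ᵗ (gNext p (suc s)) N) ≡⟨ cong₂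
          (λ a b → ½ * (h * (a * (½ * F₀ * unit s))) + ½ * b) (fromℕ-* 16 H) (gNext-∑X p (suc s) N p≤q) ⟩
      ½ * (h * (fromℕ 16 * h * (½ * F₀ * unit s))) + ½ * (½ * (fromℕ (4 ℕ.* H) * (S * (fromℕ (4 ℕ.* H) * unit s)))) ≡⟨
          cong (λ w → ½ * (h * (fromℕ 16 * h * (½ * F₀ * unit s))) + ½ * (½ * (w * (S * (w * unit s))))) (fromℕ-* 4 H) ⟩
      ½ * (h * (fromℕ 16 * h * (½ * F₀ * unit s))) + ½ * (½ * (fromℕ 4 * h * (S * (fromℕ 4 * h * unit s)))) ≡⟨ lemma₂ h
          F₀ S (unit s) ⟩
      h * ((F₀ + S) * (fromℕ 4 * h * unit s))      ≡⟨ cong₂ (λ z w → h * (z * (w * unit s))) (sym qZ)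
          (sym (fromℕ-* 4 H)) ⟩
      h * (Q * fromℕ (Z p) * unit (suc s))         ≡⟨ cong (h *_) (ℚ.*-assoc Q (fromℕ (Z p)) (unit (suc s))) ⟩
      h * (Q * g p (suc s))                        ∎))
      where
      open ≡-Reasoning
      N = neighbors x
      h Q A B F₀ S : ℚ
      h = fromℕ H
      Q = fromℕ q
      A = avg (q ∸ 1) (λ y → if 16 ℕ.* H ∸ y ≡ᵇ 0 then 0ℚ else f (p [ toℕ x ↦ 0 ]) s N c)
      B = avg (H ∸ 1) (λ y → gNext p (suc s) (drop y N))
      F₀ = fromℕ (F (p [ toℕ x ↦ 0 ]) N c)
      S = fromℕ (sumℕ (∑X p N))
      A≡ : Q * A ≡ fromℕ (16 ℕ.* H) * (½ * F₀ * unit s)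
      A≡ = trans (avg-pred _ 0<q) (∑-prefix q (16 ℕ.* H) (f (p [ toℕ x ↦ 0 ]) s N c) 16H≤q)
      B≡ : h * B ≡ ∑ᵗ (gNext p (suc s)) N
      B≡ = trans (avg-pred _ 0<H)
          (∑-drop H N refl (ℕ.≤-trans (length-neighbors x) (ℕ.≤-trans (ℕ.m≤m+n Δ (3 ℕ.* Δ)) 4Δ≤H)))
      qZ : Q * fromℕ (Z p) ≡ F₀ + S
      qZ = trans (sym (fromℕ-* q (Z p)))
          (trans (cong fromℕ (q*Z adj {p} px≡c)) (fromℕ-+ (F (p [ toℕ x ↦ 0 ]) N c) (sumℕ (∑X p N))))
      lemma₁ : ∀ h q k A B → h * (q * (k * A + k * B)) ≡ k * (h * (q * A)) + k * (q * (h * B))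
      lemma₁ = RingSolver.solve-∀ ℚ-ring
      lemma₂ : ∀ h F S u → ½ * (h * (fromℕ 16 * h * (½ * F * u))) + ½ * (½ * (fromℕ 4 * h * (S * (fromℕ 4 * h * u)))) ≡
          h * ((F + S) * (fromℕ 4 * h * u))
      lemma₂ h F S u = trans (lemma₃ ½ (fromℕ 16) (fromℕ 4) h F S u) (lemma₄ (fromℕ 4) h F S u)
        where
        lemma₃ : ∀ k a b h F S u → k * (h * (a * h * (k * F * u))) + k * (k * (b * h * (S * (b * h * u)))) ≡ (k * k * a)
            * (h * h * F * u) + (k * k * b) * (b * h * h * S * u)
        lemma₃ = RingSolver.solve-∀ ℚ-ring
        lemma₄ : ∀ b h F S u → b * (h * h * F * u) + 1ℚ * (b * h * h * S * u) ≡ h * ((F + S) * (b * h * u))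
        lemma₄ = RingSolver.solve-∀ ℚ-ring

    fNext-∑X : ∀ p s us c → ¬ Any (λ u → p (toℕ u) ≡ suc (toℕ c)) us → (∀ (u : Fin n) → p (toℕ u) ℕ.≤ q) →
               ∑ᵗ (fNext p s c) us ≡ - (½ * (fromℕ (4 ℕ.* H) * (fromℕ (∑X p us c) * unit s)))
    fNext-∑X p s [] c free p≤q = lemma ½ (fromℕ (4 ℕ.* H)) (unit s)
      where
      lemma : ∀ h w u → 0ℚ ≡ - (h * (w * (0ℚ * u)))
      lemma = RingSolver.solve-∀ ℚ-ring
    fNext-∑X p s (u ∷ us) c free p≤q = begin
      pushValue p s us u c (p (toℕ u)) + ∑ᵗ (fNext p s c) us ≡⟨ cong₂ _+_ (head (p (toℕ u)) refl)
          (fNext-∑X p s us c (free ∘ there) p≤q) ⟩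
      - (½ * (W * (x * unit s))) + - (½ * (W * (S * unit s))) ≡⟨ lemma ½ W x S (unit s) ⟩
      - (½ * (W * ((x + S) * unit s)))                       ≡⟨ cong (λ k → - (½ * (W * (k * unit s))))
          (fromℕ-+ (X p u us c) (∑X p us c)) ⟨
      - (½ * (W * (fromℕ (∑X p (u ∷ us) c) * unit s)))       ∎
      where
      open ≡-Reasoning
      W x S : ℚ
      W = fromℕ (4 ℕ.* H)
      x = fromℕ (X p u us c)
      S = fromℕ (∑X p us c)
      lemma : ∀ h w x S u → - (h * (w * (x * u))) + - (h * (w * (S * u))) ≡ - (h * (w * ((x + S) * u)))
      lemma = RingSolver.solve-∀ ℚ-ring
      head : ∀ a → p (toℕ u) ≡ a → pushValue p s us u c a ≡ - (½ * (W * (x * unit s)))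
      head zero    eq = trans (lemma₁ ½ (fromℕ (F (p [ toℕ u ↦ suc (toℕ c) ]) us c)) W (unit s))
                              (cong (λ k → - (½ * (W * (fromℕ k * unit s)))) (sym (X-free {p} us c eq)))
        where
        lemma₁ : ∀ h x w u → - (h * x * (w * u)) ≡ - (h * (w * (x * u)))
        lemma₁ = RingSolver.solve-∀ ℚ-ring
      head (suc a) eq = trans (lemma₁ ½ W (unit s)) (cong (λ k → - (½ * (W * (fromℕ k * unit s))))
          (sym (X-pinned {p} us c pu≡
                                (λ c≡a → free (here (subst (λ b → p (toℕ u) ≡ suc (toℕ b)) (sym c≡a) pu≡))))))
        where
        pu≡ : p (toℕ u) ≡ suc (toℕ (color a))
        pu≡ = pinned-color {p} (p≤q u) eq
        lemma₁ : ∀ h w u → 0ℚ ≡ - (h * (w * (0ℚ * u)))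
        lemma₁ = RingSolver.solve-∀ ℚ-ring

    f-step : ∀ {p} s us c → ¬ Any (λ u → p (toℕ u) ≡ suc (toℕ c)) us → (∀ (u : Fin n) → p (toℕ u) ℕ.≤ q) →
        length us ℕ.≤ Δ →
             ½ * g p s + ½ * avg (2 ℕ.* H ∸ 1) (λ y → fNext p s c (drop y us)) ≡ f p s us c
    f-step {p} s us c free p≤q short = *-cancelˡ (0<fromℕ 0<2H) (begin
      T * (½ * g p s + ½ * B)                                ≡⟨ lemma₁ T ½ (g p s) B ⟩
      ½ * (T * g p s) + ½ * (T * B)                          ≡⟨ cong₂ (λ a b → ½ * (T * (a * unit s)) + ½ * b)
                                                                (trans (cong fromℕ (Z-split p us c))
                                                                    (fromℕ-+ (F p us c) (∑X p us c))) B≡ ⟩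
      ½ * (T * ((x + S) * unit s)) + ½ * - (½ * (fromℕ (4 ℕ.* H) * (S * unit s))) ≡⟨ cong
          (λ w → ½ * (T * ((x + S) * unit s)) + ½ * - (½ * (w * (S * unit s)))) 4H≡ ⟩
      ½ * (T * ((x + S) * unit s)) + ½ * - (½ * (2ℚ * T * (S * unit s))) ≡⟨ lemma₂ T x S (unit s) ⟩
      T * (½ * x * unit s)                                   ∎)
      where
      open ≡-Reasoning
      0<2H : 0 ℕ.< 2 ℕ.* H
      0<2H = ℕ.<-≤-trans 0<H (ℕ.m≤m+n H (1 ℕ.* H))
      T B x S : ℚ
      T = fromℕ (2 ℕ.* H)
      B = avg (2 ℕ.* H ∸ 1) (λ y → fNext p s c (drop y us))
      x = fromℕ (F p us c)
      S = fromℕ (∑X p us c)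
      4H≡ : fromℕ (4 ℕ.* H) ≡ 2ℚ * T
      4H≡ = trans (cong fromℕ (ℕ.*-assoc 2 2 H)) (fromℕ-* 2 (2 ℕ.* H))
      B≡ : T * B ≡ - (½ * (fromℕ (4 ℕ.* H) * (S * unit s)))
      B≡ = trans (avg-pred _ 0<2H) (trans (∑-drop (2 ℕ.* H) us refl
             (ℕ.≤-trans short (ℕ.≤-trans (ℕ.≤-trans (ℕ.m≤m+n Δ (3 ℕ.* Δ)) 4Δ≤H) (ℕ.m≤m+n H (1 ℕ.* H)))))
                 (fNext-∑X p s us c free p≤q))
      lemma₁ : ∀ t k A B → t * (k * A + k * B) ≡ k * (t * A) + k * (t * B)
      lemma₁ = RingSolver.solve-∀ ℚ-ring
      lemma₂ : ∀ t x S u → ½ * (t * ((x + S) * u)) + ½ * - (½ * (2ℚ * t * (S * u))) ≡ t * (½ * x * u)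
      lemma₂ t x S u = trans (lemma₃ ½ 2ℚ t x S u) (lemma₄ ½ t x S u)
        where
        lemma₃ : ∀ k b t x S u → k * (t * ((x + S) * u)) + k * - (k * (b * t * (S * u))) ≡ k * (t * ((x + S) * u)) + k *
            - ((k * b) * (t * (S * u)))
        lemma₃ = RingSolver.solve-∀ ℚ-ring
        lemma₄ : ∀ k t x S u → k * (t * ((x + S) * u)) + k * - (1ℚ * (t * (S * u))) ≡ t * (k * x * u)
        lemma₄ = RingSolver.solve-∀ ℚ-ring

    occupied : List (Fin n) → ℚ
    occupied []      = 0ℚ
    occupied (_ ∷ _) = 1ℚ

    avg-occupied : ∀ {N} us → H ℕ.≤ N → length us ℕ.≤ Δ → avg (N ∸ 1) (λ y → occupied (drop y us)) ≤ ¼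
    avg-occupied {N} us H≤N short = *-cancelˡ-≤ (0<fromℕ {4} z<s) (*-cancelˡ-≤ (0<fromℕ 0<N) (begin
      fromℕ N * (fromℕ 4 * A)      ≡⟨ lemma (fromℕ N) (fromℕ 4) A ⟩
      fromℕ 4 * (fromℕ N * A)      ≡⟨ cong (fromℕ 4 *_) (trans (avg-pred _ 0<N) (∑-drop N us refl us≤N)) ⟩
      fromℕ 4 * ∑ᵗ occupied us     ≡⟨ cong (fromℕ 4 *_) (∑ᵗ-one us (λ _ _ → refl)) ⟩
      fromℕ 4 * fromℕ (length us)  ≡⟨ fromℕ-* 4 (length us) ⟨
      fromℕ (4 ℕ.* length us)      ≤⟨ fromℕ-mono (ℕ.≤-trans (ℕ.*-monoʳ-≤ 4 short) (ℕ.≤-trans 4Δ≤H H≤N)) ⟩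
      fromℕ N                      ≡⟨ ℚ.*-identityʳ (fromℕ N) ⟨
      fromℕ N * (fromℕ 4 * ¼)      ∎))
      where
      open ℚ.≤-Reasoning
      A : ℚ
      A = avg (N ∸ 1) (λ y → occupied (drop y us))
      0<N : 0 ℕ.< N
      0<N = ℕ.<-≤-trans 0<H H≤N
      us≤N : length us ℕ.≤ N
      us≤N = ℕ.≤-trans short (ℕ.≤-trans (ℕ.≤-trans (ℕ.m≤m+n Δ (3 ℕ.* Δ)) 4Δ≤H) H≤N)
      lemma : ∀ n k A → n * (k * A) ≡ k * (n * A)
      lemma = RingSolver.solve-∀ ℚ-ring

open Contributions

module Algorithm where

  module Program where

    infixr 5 _⨟_
    _⨟_ : Stmt → Stmt → Stmt
    s ⨟ t = s ⨾ t

    infix 6 _≔_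
    _≔_ : ℕ → Expr → Stmt
    a ≔ e = assign a (lit 0) e

    reg : ℕ → Expr
    reg a = read a (lit 0)

    -- Clr and Hue hold 1 + a color.  Mode is 0 in states of value g and 1 in
    -- states of value f, Sgn is 0 for a positive sign, and Walks counts the
    -- walks still to be made for the color in Hue.
    pattern Out   = 3
    pattern Col   = 4
    pattern Stk   = 5
    pattern Sp    = 6
    pattern Vtx   = 7
    pattern Clr   = 8
    pattern Pos   = 9
    pattern Mode  = 12
    pattern Sgn   = 13
    pattern Coin  = 14
    pattern Draw  = 15
    pattern Run   = 17
    pattern Plus  = 18
    pattern Minus = 19
    pattern Walks = 20
    pattern Hue   = 21
    pattern Total = 22
    pattern H1    = 23
    pattern H4    = 24
    pattern H16   = 25
    pattern H2    = 26
    pattern Test  = 27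
    pattern Idx   = 100
    pattern Nbr   = 101
    pattern Blk   = 102

    q-1 nbr : Expr
    q-1 = read 0 (lit 2) ⊖ lit 1
    nbr = reg Nbr ⊖ lit 1

    scanBody scan kill push pop pinned fresh branchG popG stepG toG finish branchF stepF live body clear walk : Stmt

    scanBody = ifnz ((read Col nbr ⊖ reg Clr) ⊕ (reg Clr ⊖ read Col nbr)) (Idx ≔ reg Idx) (Blk ≔ lit 1)
             ⨟ Idx ≔ lit 1 ⊕ reg Idx
             ⨟ probe Nbr (lit 0) (reg Vtx) (reg Idx)

    scan = Blk ≔ lit 0
         ⨟ Idx ≔ reg Pos
         ⨟ probe Nbr (lit 0) (reg Vtx) (reg Idx)
         ⨟ while (reg Nbr) scanBody

    kill = Run ≔ lit 0

    push = assign Col nbr (reg Clr) ⨟ assign Stk (reg Sp) nbr ⨟ Sp ≔ lit 1 ⊕ reg Sp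

    pop = Sp ≔ reg Sp ⊖ lit 1 ⨟ assign Col (reg Vtx) (lit 0) ⨟ Mode ≔ lit 1

    popG = random Draw (lit 0) q-1 ⨟ ifnz (reg H16 ⊖ reg Draw) pop kill

    pinned = random Test (lit 0) q-1
           ⨟ ifnz (reg H4 ⊖ reg Test) (Clr ≔ read Col nbr ⨟ Pos ≔ lit 1 ⊕ reg Draw ⨟ Mode ≔ lit 1) kill

    fresh = random Clr (lit 0) q-1 ⨟ Clr ≔ lit 1 ⊕ reg Clr ⨟ Pos ≔ lit 1 ⊕ reg Draw ⨟ Mode ≔ lit 1 ⨟ push

    branchG = random Draw (lit 0) (reg H1 ⊖ lit 1)
            ⨟ probe Nbr (lit 0) (reg Vtx) (reg Draw)
            ⨟ ifnz (reg Nbr) (ifnz (read Col nbr) pinned fresh) kill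

    stepG = ifnz (reg Coin) branchG popG

    toG = Vtx ≔ read Stk (reg Sp ⊖ lit 1) ⨟ Clr ≔ read Col (reg Vtx) ⨟ Pos ≔ lit 0 ⨟ Mode ≔ lit 0

    finish = Run ≔ lit 0 ⨟ ifnz (reg Sgn) (Minus ≔ lit 1 ⊕ reg Minus) (Plus ≔ lit 1 ⊕ reg Plus)

    branchF = random Draw (lit 0) (reg H2 ⊖ lit 1)
            ⨟ Draw ≔ reg Pos ⊕ reg Draw
            ⨟ probe Nbr (lit 0) (reg Vtx) (reg Draw)
            ⨟ ifnz (reg Nbr) (ifnz (read Col nbr) kill (push ⨟ Pos ≔ lit 1 ⊕ reg Draw ⨟ Sgn ≔ lit 1 ⊖ reg Sgn)) kill

    stepF = ifnz (reg Coin) branchF (ifnz (reg Sp) toG finish)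

    live = random Coin (lit 0) (lit 1) ⨟ ifnz (reg Mode) stepF stepG

    body = scan ⨟ ifnz (reg Blk) kill live

    clear = while (reg Sp) (Sp ≔ reg Sp ⊖ lit 1 ⨟ assign Col (read Stk (reg Sp)) (lit 0))

    walk = assign Col (read 0 (lit 3)) (reg Hue)
         ⨟ assign Stk (lit 0) (read 0 (lit 3))
         ⨟ Sp ≔ lit 1
         ⨟ Vtx ≔ read 0 (lit 3)
         ⨟ Clr ≔ reg Hue
         ⨟ Pos ≔ lit 0
         ⨟ Mode ≔ lit 0
         ⨟ Sgn ≔ lit 0
         ⨟ Run ≔ lit 1
         ⨟ while (reg Run) body
         ⨟ clear

  open Program public

  T? : Bool → Set
  T? true  = ⊤
  T? false = ⊥

  -- The arrays numbered from 100 are scratch space.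
  Agree : Memory → Memory → Set
  Agree m m′ = ∀ a → T? (a ℕ.<ᵇ 100) → m′ a ≡ m a

  agree-refl : ∀ {m} → Agree m m
  agree-refl a _ = refl

  agree-trans : ∀ {m m′ m″} → Agree m m′ → Agree m′ m″ → Agree m m″
  agree-trans h h′ a a< = trans (h′ a a<) (h a a<)

  agree-write : ∀ m b {i x} → ¬ T? (b ℕ.<ᵇ 100) → Agree m (write m b i x)
  agree-write m b {i} {x} b≥ a a< = cong (λ t → λ j → if t ∧ (j ≡ᵇ i) then x else m a j) (differ (a ≡ᵇ b) (ℕ.≡ᵇ⇒≡ a b))
    where
    differ : ∀ t → (Data.Bool.T t → a ≡ b) → t ≡ false
    differ false eq = refl
    differ true  eq = contradiction (subst (λ c → T? (c ℕ.<ᵇ 100)) (eq tt) a<) b≥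

  at : ∀ {f g : ℕ → ℕ} → f ≡ g → ∀ i → f i ≡ g i
  at refl i = refl

  distance-0 : ∀ {a b} → a ≡ b → (a ∸ b) ℕ.+ (b ∸ a) ≡ 0
  distance-0 {a} refl = cong₂ ℕ._+_ (ℕ.n∸n≡0 a) (ℕ.n∸n≡0 a)

  distance-suc : ∀ a b → a ≢ b → ∃ λ k → (a ∸ b) ℕ.+ (b ∸ a) ≡ suc k
  distance-suc zero    zero    a≢b = contradiction refl a≢b
  distance-suc zero    (suc b) a≢b = b , refl
  distance-suc (suc a) zero    a≢b = a ℕ.+ 0 , refl
  distance-suc (suc a) (suc b) a≢b = distance-suc a b (a≢b ∘ cong suc)

  module Scan {n : ℕ} {G : Graph n} (adj : AdjacencyLists G) where

    open AdjacencyLists adj using (neighbors)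
    open Paths (oracle adj)

    look : List (Fin n) → ℕ
    look []      = 0
    look (u ∷ _) = suc (toℕ u)

    entry-drop : ∀ us k → entry (map (suc ∘ toℕ) us) k ≡ look (drop k us)
    entry-drop []       zero    = refl
    entry-drop []       (suc k) = refl
    entry-drop (u ∷ us) zero    = refl
    entry-drop (u ∷ us) (suc k) = entry-drop us k

    oracle-look : ∀ x k → oracle adj (toℕ x) k ≡ look (drop k (neighbors x))
    oracle-look x k with toℕ x ℕ.<? n
    ... | yes x<n = trans (cong (λ w → entry (map (suc ∘ toℕ) (neighbors w)) k) (Fin.fromℕ<-toℕ x x<n))
        (entry-drop (neighbors x) k)
    ... | no  x≮n = contradiction (Fin.toℕ<n x) x≮n

    drop-suc : ∀ {A : Set} k (us : List A) {u us′} → drop k us ≡ u ∷ us′ → drop (suc k) us ≡ us′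
    drop-suc zero    (u ∷ us) refl = refl
    drop-suc (suc k) (u ∷ us) eq   = drop-suc k us eq

    Blocked : (ℕ → ℕ) → ℕ → List (Fin n) → Set
    Blocked p c us = Any (λ u → p (toℕ u) ≡ c) us

    Scanned : Memory → Memory → (ℕ → ℕ) → ℕ → List (Fin n) → Set
    Scanned m m′ p c us = (¬ Blocked p c us × m′ Blk 0 ≡ m Blk 0) ⊎ (Blocked p c us × m′ Blk 0 ≡ 1)

    record ScanState (m : Memory) (p : ℕ → ℕ) (c : ℕ) (x : Fin n) (k : ℕ) (us : List (Fin n)) : Set where
      constructor scanState
      field
        col≡ : m Col ≡ p
        clr≡ : m Clr 0 ≡ c
        vtx≡ : m Vtx 0 ≡ toℕ x
        k≡   : m Idx 0 ≡ k
        nbr≡ : m Nbr 0 ≡ look us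
        us≡  : drop k (neighbors x) ≡ us

    scanCost : List (Fin n) → ℕ
    scanCost []       = 1
    scanCost (u ∷ us) = 7 ℕ.+ scanCost us

    scan-loop : ∀ {p c x} us k m {ss} → ScanState m p c x k us →
                ∃ λ m′ → (while (reg Nbr) scanBody ∷ ss , m) ⇒[ scanCost us ] (ss , m′) × Agree m m′ × Scanned m m′ p c
                    us
    scan-loop [] k m s = m , while-false {e = reg Nbr} (ScanState.nbr≡ s) , agree-refl {m} , inj₁ ((λ ()) , refl)
    scan-loop {p} {c} {x} (u ∷ us) k m {ss} (scanState col≡ clr≡ vtx≡ k≡ nbr≡ us≡) with p (toℕ u) ℕ.≟ c
    ... | yes pu≡c =
      let m₁ = write m Blk 0 1
          m₂ = write m₁ Idx 0 (suc (m Idx 0))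
          m₃ = write m₂ Nbr 0 (oracle adj (m Vtx 0) (suc (m Idx 0)))
          m′ , path , agree , scanned = scan-loop us (suc k) m₃ {ss} (scanState col≡ clr≡ vtx≡ (cong suc k≡)
            (trans (cong₂ (oracle adj) vtx≡ (cong suc k≡))
                (trans (oracle-look x (suc k)) (cong look (drop-suc k (neighbors x) us≡))))
            (drop-suc k (neighbors x) us≡))
      in m′ ,
         while-true {e = reg Nbr} nbr≡ ▷ straight 1 refl ▷
           if-false {e = (read Col nbr ⊖ reg Clr) ⊕ (reg Clr ⊖ read Col nbr)}
               (distance-0 (trans (color≡ nbr≡ col≡) (trans pu≡c (sym clr≡)))) ▷
           straight 4 refl ▷ path ,
         agree-trans {m} {m₁} (agree-write m Blk λ ()) (agree-trans {m₁} {m₂} (agree-write m₁ Idx λ ())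
             (agree-trans {m₂} {m₃} (agree-write m₂ Nbr λ ()) agree)) ,
         (case scanned of λ where
           (inj₁ (_ , blk)) → inj₂ (here pu≡c , blk)
           (inj₂ (b , blk)) → inj₂ (there b , blk))
      where
      color≡ : m Nbr 0 ≡ suc (toℕ u) → m Col ≡ p → m Col (m Nbr 0 ∸ 1) ≡ p (toℕ u)
      color≡ nbr≡ col≡ = trans (cong (λ w → m Col (w ∸ 1)) nbr≡) (at col≡ (toℕ u))
    ... | no pu≢c =
      let m₁ = write m Idx 0 (m Idx 0)
          m₂ = write m₁ Idx 0 (suc (m Idx 0))
          m₃ = write m₂ Nbr 0 (oracle adj (m Vtx 0) (suc (m Idx 0)))
          d , d≡ = distance-suc (m Col (m Nbr 0 ∸ 1)) (m Clr 0)
              (λ eq → pu≢c (trans (sym (color≡ nbr≡ col≡)) (trans eq clr≡)))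
          m′ , path , agree , scanned = scan-loop us (suc k) m₃ {ss} (scanState col≡ clr≡ vtx≡ (cong suc k≡)
            (trans (cong₂ (oracle adj) vtx≡ (cong suc k≡))
                (trans (oracle-look x (suc k)) (cong look (drop-suc k (neighbors x) us≡))))
            (drop-suc k (neighbors x) us≡))
      in m′ ,
         while-true {e = reg Nbr} nbr≡ ▷ straight 1 refl ▷
           if-true {e = (read Col nbr ⊖ reg Clr) ⊕ (reg Clr ⊖ read Col nbr)} d≡ ▷
           straight 4 refl ▷ path ,
         agree-trans {m} {m₁} (agree-write m Idx λ ()) (agree-trans {m₁} {m₂} (agree-write m₁ Idx λ ())
             (agree-trans {m₂} {m₃} (agree-write m₂ Nbr λ ()) agree)) ,
         (case scanned of λ where
           (inj₁ (¬b , blk)) → inj₁ ((λ { (here pu≡c) → pu≢c pu≡c ; (there b) → ¬b b }) , blk)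
           (inj₂ (b , blk)) → inj₂ (there b , blk))
      where
      color≡ : m Nbr 0 ≡ suc (toℕ u) → m Col ≡ p → m Col (m Nbr 0 ∸ 1) ≡ p (toℕ u)
      color≡ nbr≡ col≡ = trans (cong (λ w → m Col (w ∸ 1)) nbr≡) (at col≡ (toℕ u))

    scan-path : ∀ {p c x j} m {ss} → m Col ≡ p → m Clr 0 ≡ c → m Vtx 0 ≡ toℕ x → m Pos 0 ≡ j →
                let us = drop j (neighbors x) in
                ∃ λ m′ → (scan ∷ ss , m) ⇒[ 6 ℕ.+ scanCost us ] (ss , m′) × Agree m m′ ×
                         ((¬ Blocked p c us × m′ Blk 0 ≡ 0) ⊎ (Blocked p c us × m′ Blk 0 ≡ 1))
    scan-path {x = x} {j} m {ss} col≡ clr≡ vtx≡ pos≡ =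
      let m₁ = write m Blk 0 0
          m₂ = write m₁ Idx 0 (m Pos 0)
          m₃ = write m₂ Nbr 0 (oracle adj (m Vtx 0) (m Pos 0))
          m′ , path , agree , scanned = scan-loop (drop j (neighbors x)) j m₃ {ss}
            (scanState col≡ clr≡ vtx≡ pos≡ (trans (cong₂ (oracle adj) vtx≡ pos≡) (oracle-look x j)) refl)
      in m′ , straight 6 refl ▷ path ,
         agree-trans {m} {m₁} (agree-write m Blk λ ()) (agree-trans {m₁} {m₂} (agree-write m₁ Idx λ ())
             (agree-trans {m₂} {m₃} (agree-write m₂ Nbr λ ()) agree)) ,
         scanned

open Algorithm

module Walks where

  open import Data.Rational using (_+_; _*_; _-_; -_; _≤_; _<_)

  -- Keeps the arguments of a predicate recoverable by unification.
  record Wrapped {A : Set} (P : A → Set) (a : A) : Set where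
    constructor wrap
    field unwrap : P a

  open Wrapped public

  data Outcome : Set where
    none plus minus : Outcome

  data Phase : Set where
    inG inF : Phase

  phaseCode : Phase → ℕ
  phaseCode inG = 0
  phaseCode inF = 1

  sign : ℕ → ℚ
  sign zero    = 1ℚ
  sign (suc _) = - 1ℚ

  sign-flip : ∀ s → sign (1 ∸ s) ≡ - sign s
  sign-flip zero    = refl
  sign-flip (suc s) = trans (cong sign (ℕ.0∸n≡0 s)) refl

  ⅝ : ℚ
  ⅝ = ½ + ½ * ¼

  module Walking (inst : Instance) (rew : Reward) where

    open Instance inst
    open Reward rew using (κ; 0≤κ)
    open AdjacencyLists adj using (neighbors; correct)
    open Graph G using (irrefl)
    open Counting G q using (Z; F; Z-cong; F-blocked)
    open Conditioning G adj q 1≤Δ 65Δ≤q using (Δ; Δ<q; length-neighbors; Z-unpin; Z-blocked)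
    open Values inst
      using (unit; 0≤unit; g; f; 0≤g; 0≤f; f≤g; color; toℕ-color; pinned-color; 0<q; branchValue; pushValue; gNext; fNext; g-step; f-step; occupied; avg-occupied)
    open Scan adj using (Blocked; look; oracle-look; drop-suc; scanCost; scan-path)
    open Paths (oracle adj) using (_⇒[_]_; _▷_; straight; if-true; if-false; while-true; while-false)
    open Value (oracle adj) rew using (Bounded; weaken; path-bound; random-bound; loop-bound)

    data Stack : List (Fin n) → (ℕ → ℕ) → Set where
      []  : ∀ {p} → p ≗ p₀ → Stack [] p
      _∷_ : ∀ {x xs p c} → p (toℕ x) ≡ suc (toℕ {q} c) → Stack xs (p [ toℕ x ↦ 0 ]) → Stack (x ∷ xs) p

    Holds : (ℕ → ℕ) → List (Fin n) → Set
    Holds a []       = ⊤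
    Holds a (x ∷ xs) = a (length xs) ≡ toℕ x × Holds a xs

    holds-above : ∀ {a xs k} u → length xs ℕ.≤ k → Holds a xs → Holds (a [ k ↦ u ]) xs
    holds-above {xs = []}     u le h       = tt
    holds-above {a} {x ∷ xs}  u le (e , h) = trans (↦-other a u (ℕ.<⇒≢ le)) e , holds-above u (ℕ.<⇒≤ le) h

    stack-cong : ∀ {xs p p′} → p ≗ p′ → Stack xs p → Stack xs p′
    stack-cong eq ([] e)       = [] (λ i → trans (sym (eq i)) (e i))
    stack-cong eq (_∷_ {x} {c = c} e s) = trans (sym (eq (toℕ x))) e ∷ stack-cong (↦-cong (toℕ x) 0 eq) s

    stack-push : ∀ {xs p} u (c : Fin q) → p (toℕ u) ≡ 0 → Stack xs p → Stack (u ∷ xs) (p [ toℕ u ↦ suc (toℕ c) ])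
    stack-push {p = p} u c pu≡0 s = ↦-same p (toℕ u) (suc (toℕ c)) ∷ stack-cong
        (λ i → sym (↦-undo {p} (toℕ u) (suc (toℕ c)) pu≡0 i)) s

    stack-≤q : ∀ {xs p} → Stack xs p → ∀ (u : Fin n) → p (toℕ u) ℕ.≤ q
    stack-≤q ([] e) u = subst (ℕ._≤ q) (sym (e (toℕ u))) (p₀≤q u)
    stack-≤q {x ∷ xs} {p} (_∷_ {c = c} e s) u = one (u Fin.≟ x)
      where
      one : Dec (u ≡ x) → p (toℕ u) ℕ.≤ q
      one (yes u≡x) = subst (ℕ._≤ q) (trans (sym e) (cong (λ w → p (toℕ w)) (sym u≡x))) (Fin.toℕ<n c)
      one (no  u≢x) = subst (ℕ._≤ q) (↦-other p {toℕ x} {toℕ u} 0 (u≢x ∘ Fin.toℕ-injective))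
          (stack-≤q {xs} {p [ toℕ x ↦ 0 ]} s u)

    g-empty : ∀ {p} → p ≗ p₀ → g p 0 ≡ 1ℚ
    g-empty {p} eq = trans (cong (λ z → fromℕ z * ζ) (Z-cong {p} {p₀} eq)) Zζ≡1

    4H+Δ≤q : 4 ℕ.* H ℕ.+ Δ ℕ.≤ q
    4H+Δ≤q = begin
      4 ℕ.* H ℕ.+ Δ           ≤⟨ ℕ.+-monoʳ-≤ (4 ℕ.* H) (ℕ.≤-trans (ℕ.m≤m+n Δ (3 ℕ.* Δ)) 4Δ≤H) ⟩
      4 ℕ.* H ℕ.+ H           ≡⟨ ℕ.+-comm (4 ℕ.* H) H ⟩
      5 ℕ.* H                 ≤⟨ ℕ.*-monoˡ-≤ H (s≤s (s≤s (s≤s (s≤s (s≤s (z≤n {11})))))) ⟩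
      16 ℕ.* H                ≤⟨ 16H≤q ⟩
      q                       ∎
      where open ℕ.≤-Reasoning

    g≤1 : ∀ {xs p} → Stack xs p → g p (length xs) ≤ 1ℚ
    g≤1 {p = p} ([] e) = ℚ.≤-reflexive (g-empty {p} e)
    g≤1 {x ∷ xs} {p} (e ∷ s) =
        ℚ.≤-trans (ℚ.≤-reflexive (trans (lemma (fromℕ (Z p)) (fromℕ (4 ℕ.* H)) (unit (length xs)))
        (cong (_* unit (length xs)) (sym (fromℕ-* (4 ℕ.* H) (Z p))))))
      (ℚ.≤-trans (*-monoʳ {unit (length xs)} {fromℕ (4 ℕ.* H ℕ.* Z p)} {fromℕ (Z (p [ toℕ x ↦ 0 ]))}
          (0≤unit (length xs)) (fromℕ-mono {4 ℕ.* H ℕ.* Z p} {Z (p [ toℕ x ↦ 0 ])} (Z-unpin {p} (4 ℕ.* H) 4H+Δ≤q e)))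
          (g≤1 {xs} {p [ toℕ x ↦ 0 ]} s))
      where
      lemma : ∀ z w u → z * (w * u) ≡ w * z * u
      lemma = RingSolver.solve-∀ ℚ-ring

    g-pinned≤1 : ∀ {p} v c → p (toℕ v) ≡ suc (toℕ {q} c) → p [ toℕ v ↦ 0 ] ≗ p₀ → g p 1 ≤ 1ℚ
    g-pinned≤1 {p} v c pv≡c unpin = g≤1 {v ∷ []} {p} (pv≡c ∷ [] unpin)

    stateValue : Phase → (ℕ → ℕ) → List (Fin n) → Fin q → List (Fin n) → ℚ
    stateValue inG p xs c us = g p (length xs)
    stateValue inF p xs c us = f p (length xs) us c

    0≤stateValue : ∀ ph p xs c us → 0ℚ ≤ stateValue ph p xs c us
    0≤stateValue inG p xs c us = 0≤g p (length xs)
    0≤stateValue inF p xs c us = 0≤f p (length xs) us c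

    stateValue≤1 : ∀ ph {p xs} c us → Stack xs p → stateValue ph p xs c us ≤ 1ℚ
    stateValue≤1 inG {p} {xs} c us s = g≤1 {xs} {p} s
    stateValue≤1 inF {p} {xs} c us s = ℚ.≤-trans (f≤g p (length xs) us c) (g≤1 {xs} {p} s)

    Top : Phase → (ℕ → ℕ) → List (Fin n) → Fin n → Fin q → ℕ → Set
    Top inG p xs x c j = ∃ λ xs′ → xs ≡ x ∷ xs′ × p (toℕ x) ≡ suc (toℕ c) × j ≡ 0
    Top inF p xs x c j = ⊤

    value-blocked : ∀ ph {p xs x c j} → Top ph p xs x c j → Blocked p (suc (toℕ c)) (drop j (neighbors x)) →
                    stateValue ph p xs c (drop j (neighbors x)) ≡ 0ℚ
    value-blocked inG {p} {xs} (_ , _ , px≡c , refl) b =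
        trans (cong (λ z → fromℕ z * unit (length xs)) (Z-blocked {p} px≡c b)) (ℚ.*-zeroˡ (unit (length xs)))
    value-blocked inF {p} {xs} {x} {c} {j} _ b =
        trans (cong (λ z → ½ * fromℕ z * unit (length xs)) (F-blocked {p} {drop j (neighbors x)} {c} b))
        (lemma ½ (unit (length xs)))
      where
      lemma : ∀ h u → h * 0ℚ * u ≡ 0ℚ
      lemma = RingSolver.solve-∀ ℚ-ring

    roundCost walkCost : ℕ
    roundCost = 40 ℕ.+ 7 ℕ.* Δ
    walkCost = 8 ℕ.* roundCost

    scanCost≤ : ∀ us → scanCost us ≡ 1 ℕ.+ 7 ℕ.* length us
    scanCost≤ []       = refl
    scanCost≤ (u ∷ us) = trans (cong (7 ℕ.+_) (scanCost≤ us)) (lemma (length us))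
      where
      lemma : ∀ l → 7 ℕ.+ (1 ℕ.+ 7 ℕ.* l) ≡ 1 ℕ.+ 7 ℕ.* (1 ℕ.+ l)
      lemma = ℕ-Ring.solve-∀

    record Constants (m : Memory) : Set where
      field
        q≡   : m 0 2 ≡ q
        H≡   : m H1 0 ≡ H
        4H≡  : m H4 0 ≡ 4 ℕ.* H
        16H≡ : m H16 0 ≡ 16 ℕ.* H
        2H≡  : m H2 0 ≡ 2 ℕ.* H

    Unchanged : Memory → ℕ → ℕ → Memory → Set
    Unchanged m₀ P Q m = m 0 ≡ m₀ 0 × m Out ≡ m₀ Out × m Walks ≡ m₀ Walks × m Hue ≡ m₀ Hue × m Total ≡ m₀ Total ×
                         m H1 ≡ m₀ H1 × m H4 ≡ m₀ H4 × m H16 ≡ m₀ H16 × m H2 ≡ m₀ H2 × m Plus 0 ≡ P × m Minus 0 ≡ Q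

    Outcomes : Memory → Outcome → Memory → Set
    Outcomes m₀ none  = Unchanged m₀ (m₀ Plus 0) (m₀ Minus 0)
    Outcomes m₀ plus  = Unchanged m₀ (suc (m₀ Plus 0)) (m₀ Minus 0)
    Outcomes m₀ minus = Unchanged m₀ (m₀ Plus 0) (suc (m₀ Minus 0))

    Payoff : (L β γ : ℚ) → Outcome → ℚ
    Payoff L β γ none  = L
    Payoff L β γ plus  = L + β + γ
    Payoff L β γ minus = L - β + γ

    module OneWalk (m₀ : Memory) (constants : Constants m₀) (rest : List Stmt)
      (L β γ : ℚ) (0≤L : 0ℚ ≤ L) (0≤γ : 0ℚ ≤ γ) (0≤L+β+γ : 0ℚ ≤ L + β + γ) (0≤L-β+γ : 0ℚ ≤ L - β + γ) where

      open Constants constants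

      P₀ Q₀ : ℕ
      P₀ = m₀ Plus 0
      Q₀ = m₀ Minus 0

      Outer : ℕ → ℕ → Memory → Set
      Outer = Unchanged m₀

      Finished : Outcome → Memory → Set
      Finished = Outcomes m₀

      payoff : Outcome → ℚ
      payoff = Payoff L β γ

      0≤payoff : ∀ o → 0ℚ ≤ payoff o
      0≤payoff none  = 0≤L
      0≤payoff plus  = 0≤L+β+γ
      0≤payoff minus = 0≤L-β+γ

      module _ (after : ∀ o t m → Finished o m → m Col ≗ p₀ → Bounded t (rest , m) (payoff o)) where

        Pinned : Memory → (ℕ → ℕ) → List (Fin n) → Set
        Pinned m p xs = m Col ≡ p × m Sp 0 ≡ length xs × Holds (m Stk) xs × Stack xs p

        Located : Memory → Fin n → Fin q → ℕ → Set
        Located m x c j = m Vtx 0 ≡ toℕ x × m Clr 0 ≡ suc (toℕ c) × m Pos 0 ≡ j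

        data LoopState (m : Memory) : Set where
          running : ∀ (ph : Phase) {s p xs x c j} (a : ℚ) →
                    let v = stateValue ph p xs c (drop j (neighbors x)) in
                    Outer P₀ Q₀ m → m Run 0 ≡ 1 → m Mode 0 ≡ phaseCode ph → m Sgn 0 ≡ s →
                    Pinned m p xs → Located m x c j → Top ph p xs x c j →
                    v ≤ a → a ≤ 1ℚ → (¬ Blocked p (suc (toℕ c)) (drop j (neighbors x)) → a ≡ 1ℚ) → LoopState m
          stopped : ∀ o {p xs} → Finished o m → m Run 0 ≡ 0 → Pinned m p xs → LoopState m

        loop : Memory → Config
        loop m = while (reg Run) body ∷ clear ∷ rest , m

        State : Set
        State = ∃ LoopState

        bound : State → ℚ
        bound (m , running ph {s} {p} {xs} {x} {c} {j} a _ _ _ _ _ _ _ _ _ _) =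
          L + κ * fromℕ (walkCost ℕ.+ 4 ℕ.* length xs) + β * sign s * stateValue ph p xs c (drop j (neighbors x)) + γ *
              a
        bound (m , stopped o {p} {xs} _ _ _) = payoff o + κ * fromℕ (2 ℕ.+ 4 ℕ.* length xs)

        0≤convex : ∀ s {v a} → 0ℚ ≤ v → v ≤ a → a ≤ 1ℚ → 0ℚ ≤ L + β * sign s * v + γ * a
        0≤convex zero    {v} {a} 0≤v v≤a a≤1 = subst (0ℚ ≤_) (lemma L β γ v a)
          (0≤+ (0≤+ (0≤* (p≤q⇒0≤q-p a≤1) 0≤L) (0≤* (p≤q⇒0≤q-p v≤a) (0≤+ 0≤L 0≤γ))) (0≤* 0≤v 0≤L+β+γ))
          where
          lemma : ∀ L β γ v a → (1ℚ - a) * L + (a - v) * (L + γ) + v * (L + β + γ) ≡ L + β * 1ℚ * v + γ * a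
          lemma = RingSolver.solve-∀ ℚ-ring
        0≤convex (suc _) {v} {a} 0≤v v≤a a≤1 = subst (0ℚ ≤_) (lemma L β γ v a)
          (0≤+ (0≤+ (0≤* (p≤q⇒0≤q-p a≤1) 0≤L) (0≤* (p≤q⇒0≤q-p v≤a) (0≤+ 0≤L 0≤γ))) (0≤* 0≤v 0≤L-β+γ))
          where
          lemma : ∀ L β γ v a → (1ℚ - a) * L + (a - v) * (L + γ) + v * (L - β + γ) ≡ L + β * (- 1ℚ) * v + γ * a
          lemma = RingSolver.solve-∀ ℚ-ring

        0≤bound : ∀ s → 0ℚ ≤ bound s
        0≤bound (m , running ph {s} {p} {xs} {x} {c} {j} a _ _ _ _ _ _ _ v≤a a≤1 _) =
          subst (0ℚ ≤_) (lemma L (κ * fromℕ (walkCost ℕ.+ 4 ℕ.* length xs)) (β * sign s * v) (γ * a))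
            (0≤+ (0≤* 0≤κ (0≤fromℕ (walkCost ℕ.+ 4 ℕ.* length xs)))
                (0≤convex s (0≤stateValue ph p xs c (drop j (neighbors x))) v≤a a≤1))
          where
          v : ℚ
          v = stateValue ph p xs c (drop j (neighbors x))
          lemma : ∀ L k v a → k + (L + v + a) ≡ L + k + v + a
          lemma = RingSolver.solve-∀ ℚ-ring
        0≤bound (m , stopped o {p} {xs} _ _ _) = 0≤+ (0≤payoff o) (0≤* 0≤κ (0≤fromℕ (2 ℕ.+ 4 ℕ.* length xs)))

        clear-path : ∀ xs {p o} m → Pinned m p xs → Finished o m →
                     ∃ λ m′ → (clear ∷ rest , m) ⇒[ 1 ℕ.+ 4 ℕ.* length xs ] (rest , m′) × Finished o m′ × m′ Col ≗ p₀
        clear-path [] m (col≡ , sp≡ , _ , [] p≗p₀) fin = m , while-false {e = reg Sp} sp≡ , fin , λ i →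
            trans (at col≡ i) (p≗p₀ i)
        clear-path (x ∷ xs) {p} {o} m (col≡ , sp≡ , (x≡ , holds) , px≡c ∷ s) fin =
          let m₁ = write m Sp 0 (m Sp 0 ∸ 1)
              m₂ = write m₁ Col (m Stk (m Sp 0 ∸ 1)) 0
              m′ , path , fin′ , col′ = clear-path xs {p [ toℕ x ↦ 0 ]} {o} m₂
                (cong₂ (λ p i → p [ i ↦ 0 ]) col≡ (trans (cong (λ k → m Stk (k ∸ 1)) sp≡) x≡) ,
                 cong (_∸ 1) sp≡ , holds , s) (finished-col o fin)
          in m′ , subst (λ k → (clear ∷ rest , m) ⇒[ k ] (rest , m′)) (lemma (length xs))
                    (while-true {e = reg Sp} sp≡ ▷ straight 3 refl ▷ path) , fin′ , col′
          where
          finished-col : ∀ o {i k} → Finished o m → Finished o (write (write m Sp 0 k) Col i 0)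
          finished-col none  fin = fin
          finished-col plus  fin = fin
          finished-col minus fin = fin
          lemma : ∀ l → 4 ℕ.+ (1 ℕ.+ 4 ℕ.* l) ≡ 1 ℕ.+ 4 ℕ.* (1 ℕ.+ l)
          lemma = ℕ-Ring.solve-∀

        Loop : List Stmt
        Loop = while (reg Run) body ∷ clear ∷ rest

        -- One round of the loop started with sign s and ℓ stacked vertices.
        module Round (t : ℕ) (IH : ∀ s → Bounded t (loop (proj₁ s)) (bound s)) (s ℓ : ℕ) where

          Γ : ℚ
          Γ = γ + κ * fromℕ walkCost

          0≤Γ : 0ℚ ≤ Γ
          0≤Γ = 0≤+ 0≤γ (0≤* 0≤κ (0≤fromℕ walkCost))

          -- k pays for steps still to be made in this round, v is the expected
          -- contribution of the walk, and h bounds the probability of another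
          -- round.
          budget : ℕ → ℚ → ℚ → ℚ
          budget k v h = L + κ * fromℕ k + β * sign s * v + Γ * h

          Budgeted : Config × ℕ × ℚ × ℚ → Set
          Budgeted (c , k , v , h) = Bounded t c (budget k v h)

          Within : Config → ℕ → ℚ → ℚ → Set
          Within c k v h = Wrapped Budgeted (c , k , v , h)

          budget-mono : ∀ {k k′} v {h h′} → k ℕ.≤ k′ → h ≤ h′ → budget k v h ≤ budget k′ v h′
          budget-mono {k} {k′} v {h} {h′} k≤k′ h≤h′ = ℚ.+-mono-≤ (ℚ.+-monoˡ-≤ (β * sign s * v)
            (ℚ.+-monoʳ-≤ L (*-monoˡ {κ} {fromℕ k} {fromℕ k′} 0≤κ (fromℕ-mono k≤k′)))) (*-monoˡ {Γ} {h} {h′} 0≤Γ h≤h′)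

          slack : ∀ j {c k v h} → Within c k v h → Within c (j ℕ.+ k) v h
          slack j {c} {k} {v} {h} w = wrap (weaken (budget-mono {k} {j ℕ.+ k} v {h} (ℕ.m≤n+m k j) ℚ.≤-refl) (unwrap w))

          hit≤ : ∀ {c k v h h′} → h ≤ h′ → Within c k v h → Within c k v h′
          hit≤ {c} {k} {v} {h} {h′} h≤h′ w = wrap (weaken (budget-mono {k} {k} v {h} {h′} ℕ.≤-refl h≤h′) (unwrap w))

          value≡ : ∀ {c k v v′ h} → v ≡ v′ → Within c k v h → Within c k v′ h
          value≡ refl w = w

          along : ∀ {c c′ j k v h} → c ⇒[ j ] c′ → Within c′ k v h → Within c (j ℕ.+ k) v h
          along {j = j} {k} {v} {h} path w = wrap (weaken (ℚ.≤-reflexive (begin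
            fromℕ j * κ + budget k v h                                      ≡⟨ lemma (fromℕ j) κ L (fromℕ k)
                (β * sign s * v) (Γ * h) ⟩
            L + κ * (fromℕ j + fromℕ k) + β * sign s * v + Γ * h            ≡⟨ cong
                (λ x → L + κ * x + β * sign s * v + Γ * h) (fromℕ-+ j k) ⟨
            budget (j ℕ.+ k) v h                                            ∎)) (path-bound path (unwrap w)))
            where
            open ≡-Reasoning
            lemma : ∀ j κ L k v h → j * κ + (L + κ * k + v + h) ≡ L + κ * (j + k) + v + h
            lemma = RingSolver.solve-∀ ℚ-ring

          choose : ∀ {c K K′ f k} (v h : ℕ → ℚ) → transition (oracle adj) c ≡ branch K f → K ≡ K′ →
                   (∀ i → Within (f i) k (v (toℕ i)) (h (toℕ i))) → Within c (suc k) (avg K′ v) (avg K′ h)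
          choose {K = K} {k = k} v h eq refl ws = wrap (weaken (ℚ.≤-reflexive (begin
            κ + avg K (λ i → A + B * v i + Γ * h i)                  ≡⟨ cong (κ +_) (avg-affine K A B v Γ h) ⟩
            κ + (A + B * avg K v + Γ * avg K h)                      ≡⟨ lemma κ L (fromℕ k) (B * avg K v) (Γ * avg K h)
                ⟩
            L + κ * (1ℚ + fromℕ k) + B * avg K v + Γ * avg K h       ≡⟨ cong
                (λ x → L + κ * x + B * avg K v + Γ * avg K h) (fromℕ-+ 1 k) ⟨
            budget (suc k) (avg K v) (avg K h)                       ∎))
            (random-bound {h = λ i → A + B * v i + Γ * h i} eq (λ i → unwrap (ws i))))
            where
            open ≡-Reasoning
            A B : ℚ
            A = L + κ * fromℕ k
            B = β * sign s
            lemma : ∀ κ L k v h → κ + (L + κ * k + v + h) ≡ L + κ * (1ℚ + k) + v + h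
            lemma = RingSolver.solve-∀ ℚ-ring

          base : ℕ
          base = 8 ℕ.+ 4 ℕ.* ℓ

          again : ∀ {m s′ p xs x c j v} ph → length xs ℕ.≤ suc ℓ → Outer P₀ Q₀ m → m Run 0 ≡ 1 →
              m Mode 0 ≡ phaseCode ph → m Sgn 0 ≡ s′ →
                  Pinned m p xs → Located m x c j → Top ph p xs x c j →
                  sign s′ * stateValue ph p xs c (drop j (neighbors x)) ≡ sign s * v → Within (loop m) base v 1ℚ
          again {m} {s′} {p} {xs} {x} {c} {j} {v} ph short out run mode sgn pin@(_ , _ , _ , st) loc top eq =
            wrap (weaken (0≤q-p⇒p≤q
                (subst (0ℚ ≤_) difference (0≤* 0≤κ (p≤q⇒0≤q-p (fromℕ-mono {4 ℕ.* length xs} {base} le)))))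
              (IH (m , running ph 1ℚ out run mode sgn pin loc top (stateValue≤1 ph {p} {xs} c (drop j (neighbors x)) st)
                  ℚ.≤-refl (λ _ → refl))))
            where
            open ≡-Reasoning
            V W w b : ℚ
            V = stateValue ph p xs c (drop j (neighbors x))
            W = fromℕ walkCost
            w = fromℕ (4 ℕ.* length xs)
            b = fromℕ base
            le : 4 ℕ.* length xs ℕ.≤ base
            le = ℕ.≤-trans (ℕ.*-monoʳ-≤ 4 short)
                (ℕ.≤-trans (ℕ.≤-reflexive (ℕ.*-suc 4 ℓ)) (ℕ.+-monoˡ-≤ (4 ℕ.* ℓ) (ℕ.m≤m+n 4 4)))
            lemma : ∀ κ L b w W x γ → κ * (b - w) ≡ (L + κ * b + x + (γ + κ * W) * 1ℚ) - (L + κ * (W + w) + x + γ * 1ℚ)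
            lemma = RingSolver.solve-∀ ℚ-ring
            difference : κ * (b - w) ≡ budget base v 1ℚ - (L + κ * fromℕ (walkCost ℕ.+ 4 ℕ.* length xs) + β * sign s′ *
                V + γ * 1ℚ)
            difference = trans (lemma κ L b w W (β * sign s * v) γ)
                (cong₂ (λ x y → budget base v 1ℚ - (L + κ * x + y + γ * 1ℚ))
              (sym (fromℕ-+ walkCost (4 ℕ.* length xs)))
              (trans (ℚ.*-assoc β (sign s) v) (trans (cong (β *_) (sym eq)) (sym (ℚ.*-assoc β (sign s′) V)))))

          kill-within : ∀ {m p xs h} → length xs ≡ ℓ → 0ℚ ≤ h → Outer P₀ Q₀ m → Pinned m p xs →
              Within (kill ∷ Loop , m) (1 ℕ.+ base) 0ℚ h
          kill-within {m} {p} {xs} {h} refl 0≤h out pin =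
              along (straight 1 refl) (wrap (weaken (0≤q-p⇒p≤q (subst (0ℚ ≤_)
            (lemma κ L (fromℕ base) (fromℕ (2 ℕ.+ 4 ℕ.* length xs)) (β * sign s) Γ h)
            (0≤+ (0≤* 0≤κ (p≤q⇒0≤q-p (fromℕ-mono {2 ℕ.+ 4 ℕ.* length xs} {base}
                (ℕ.+-monoˡ-≤ (4 ℕ.* length xs) (ℕ.m≤m+n 2 6))))) (0≤* 0≤Γ 0≤h))))
            (IH (write m Run 0 0 , stopped none out refl pin))))
            where
            lemma : ∀ κ L b w x Γ h → κ * (b - w) + Γ * h ≡ (L + κ * b + x * 0ℚ + Γ * h) - (L + κ * w)
            lemma = RingSolver.solve-∀ ℚ-ring

          test-within : ∀ {m e st k v h} M y → eval m e ≡ M ∸ y → Within (st ∷ Loop , m) k v h →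
              Within (kill ∷ Loop , m) k 0ℚ h →
                        Within (ifnz e st kill ∷ Loop , m) (suc k) (if M ∸ y ≡ᵇ 0 then 0ℚ else v) h
          test-within {m} {e} {st} {k} {v} {h} M y eq yes′ no′ = decide (M ∸ y) eq
            where
            decide : ∀ d → eval m e ≡ d → Within (ifnz e st kill ∷ Loop , m) (suc k) (if d ≡ᵇ 0 then 0ℚ else v) h
            decide zero    eq = along (if-false {e = e} eq) no′
            decide (suc d) eq = along (if-true {e = e} eq) yes′

          average-one : ∀ {c k v} K → Within c k v (avg K (const 1ℚ)) → Within c k v 1ℚ
          average-one K w = hit≤ (ℚ.≤-reflexive (avg-const K 1ℚ)) w

          0≤1 : 0ℚ ≤ 1ℚ
          0≤1 = ℚ.<⇒≤ (ℚ.positive⁻¹ 1ℚ)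

          module PhaseG {p : ℕ → ℕ} {x : Fin n} {xs : List (Fin n)} {c : Fin q} (ℓ≡ : length (x ∷ xs) ≡ ℓ) where

            ready : Memory → Set
            ready m = Outer P₀ Q₀ m × m Run 0 ≡ 1 × m Sgn 0 ≡ s × Pinned m p (x ∷ xs) × m Vtx 0 ≡ toℕ x

            ℓ′ : ℕ
            ℓ′ = suc (length xs)

            q-1≡ : ∀ {m} → ready m → m 0 2 ∸ 1 ≡ q ∸ 1
            q-1≡ (out , _) = cong (_∸ 1) (trans (at (proj₁ out) 2) q≡)

            stack′ : ∀ {m} → ready m → ∃ λ c′ → p (toℕ x) ≡ suc (toℕ {q} c′) × Stack xs (p [ toℕ x ↦ 0 ])
            stack′ (_ , _ , _ , (_ , _ , _ , e ∷ st) , _) = _ , e , st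

            pop-within : ∀ {m} → ready m → m Clr 0 ≡ suc (toℕ c) → m Pos 0 ≡ 0 →
                         Within (pop ∷ Loop , m) (5 ℕ.+ base) (f (p [ toℕ x ↦ 0 ]) (length xs) (neighbors x) c) 1ℚ
            pop-within {m} r@(out , run , sgn , (col≡ , sp≡ , (_ , holds) , _) , vtx≡) clr≡ pos≡ =
              along (straight 5 refl) (again {s′ = s} {p = p [ toℕ x ↦ 0 ]} {xs} {x} {c} {0} inF
                (ℕ.≤-trans (ℕ.n≤1+n (length xs)) (ℕ.≤-trans (ℕ.≤-reflexive ℓ≡) (ℕ.n≤1+n ℓ)))
                out run refl sgn
                (cong₂ (λ p i → p [ i ↦ 0 ]) col≡ vtx≡ , cong (_∸ 1) sp≡ , holds , proj₂ (proj₂ (stack′ {m} r)))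
                (vtx≡ , clr≡ , pos≡) tt refl)

            popG-within : ∀ {m} → ready m → m Clr 0 ≡ suc (toℕ c) → m Pos 0 ≡ 0 →
                          Within (popG ∷ Loop , m) (8 ℕ.+ base)
                            (avg (q ∸ 1) λ y → if 16 ℕ.* H ∸ y ≡ᵇ 0 then 0ℚ else f (p [ toℕ x ↦ 0 ]) (length xs)
                                (neighbors x) c) 1ℚ
            popG-within {m} r@(out , _ , _ , pin , _) clr≡ pos≡ = average-one (q ∸ 1) (along (straight 1 refl)
              (choose (λ y → if 16 ℕ.* H ∸ y ≡ᵇ 0 then 0ℚ else f (p [ toℕ x ↦ 0 ]) (length xs) (neighbors x) c)
                  (const 1ℚ) refl (q-1≡ {m} r) λ y →
                test-within {e = reg H16 ⊖ reg Draw} (16 ℕ.* H) (toℕ y)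
                    (cong (_∸ toℕ y) (trans (at (proj₁ (proj₂ (proj₂ (proj₂ (proj₂ (proj₂ (proj₂ (proj₂ out)))))))) 0)
                    16H≡))
                  (pop-within {write m Draw 0 (toℕ y)} r clr≡ pos≡) (slack 4 (kill-within ℓ≡ 0≤1 out pin))))

            module _ {u : Fin n} {us : List (Fin n)} {y : ℕ} (y≡ : drop y (neighbors x) ≡ u ∷ us) where

              fresh-within : ∀ {m} → ready m → m Nbr 0 ≡ suc (toℕ u) → m Draw 0 ≡ y → p (toℕ u) ≡ 0 →
                             Within (fresh ∷ Loop , m) (13 ℕ.+ base) (branchValue p ℓ′ us u 0) 1ℚ
              fresh-within {m} r@(out , run , sgn , (col≡ , sp≡ , holds , st) , vtx≡) nbr≡ draw≡ pu≡0 =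
                  average-one (q ∸ 1)
                (along (straight 1 refl) (choose (λ k → f (p [ toℕ u ↦ suc k ]) (suc ℓ′) us (color k)) (const 1ℚ) refl
                    (q-1≡ {m} r) λ i →
                  let k = toℕ i
                      k≡ = toℕ-color (subst (k ℕ.<_) (trans (cong suc (q-1≡ {m} r)) (ℕ.suc-pred q {{ℕ.>-nonZero 0<q}}))
                          (Fin.toℕ<n i))
                      nbr-1 = cong (_∸ 1) nbr≡
                  in along (straight 11 refl) (again {s′ = s} {p = p [ toℕ u ↦ suc (toℕ (color k)) ]} {u ∷ x ∷ xs} {x}
                      {color k} {suc y} inF
                       (ℕ.≤-reflexive (cong suc ℓ≡)) out run refl sgn
                       (trans (cong₂ (λ p i → p [ i ↦ suc k ]) col≡ nbr-1) (cong (λ k → p [ toℕ u ↦ suc k ]) (sym k≡)) ,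
                        cong suc sp≡ ,
                        (trans (cong (m Stk [ m Sp 0 ↦ m Nbr 0 ∸ 1 ]) (sym sp≡))
                            (trans (↦-same (m Stk) (m Sp 0) (m Nbr 0 ∸ 1)) nbr-1) ,
                         holds-above {xs = x ∷ xs} (m Nbr 0 ∸ 1) (ℕ.≤-reflexive (sym sp≡)) holds) ,
                        stack-push {x ∷ xs} {p} u (color k) pu≡0 st)
                       (vtx≡ , cong suc (sym k≡) , cong suc draw≡) tt
                       (cong₂ (λ us k′ → sign s * f (p [ toℕ u ↦ suc k′ ]) (suc ℓ′) us (color k))
                           (drop-suc y (neighbors x) y≡) k≡))))

              pinned-within : ∀ {m a} → ready m → m Nbr 0 ≡ suc (toℕ u) → m Draw 0 ≡ y → p (toℕ u) ≡ suc a →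
                              Within (Program.pinned ∷ Loop , m) (8 ℕ.+ base) (branchValue p ℓ′ us u (suc a)) 1ℚ
              pinned-within {m} {a} r@(out , run , sgn , pin@(col≡ , sp≡ , holds , st) , vtx≡) nbr≡ draw≡ pu≡a =
                  average-one (q ∸ 1)
                (along (straight 1 refl) (choose (λ z → if 4 ℕ.* H ∸ z ≡ᵇ 0 then 0ℚ else f p ℓ′ us (color a)) (const 1ℚ)
                    refl (q-1≡ {m} r) λ z →
                  test-within {e = reg H4 ⊖ reg Test} (4 ℕ.* H) (toℕ z)
                      (cong (_∸ toℕ z) (trans (at (proj₁ (proj₂ (proj₂ (proj₂ (proj₂ (proj₂ (proj₂ out))))))) 0) 4H≡))
                    (along (straight 5 refl) (again {s′ = s} {p = p} {x ∷ xs} {x} {color a} {suc y} inF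
                      (ℕ.≤-trans (ℕ.≤-reflexive ℓ≡) (ℕ.n≤1+n ℓ)) out run refl sgn pin
                      (vtx≡ , trans (cong₂ (λ p i → p i) col≡ (cong (_∸ 1) nbr≡))
                          (pinned-color {p} {u} (stack-≤q {x ∷ xs} {p} st u) pu≡a) , cong suc draw≡) tt
                      (cong (λ us → sign s * f p ℓ′ us (color a)) (drop-suc y (neighbors x) y≡))))
                    (slack 4 (kill-within ℓ≡ 0≤1 out pin))))

              color-within : ∀ {m} → ready m → m Nbr 0 ≡ suc (toℕ u) → m Draw 0 ≡ y → ∀ a → p (toℕ u) ≡ a →
                             Within (ifnz (read Col nbr) Program.pinned fresh ∷ Loop , m) (14 ℕ.+ base)
                                 (branchValue p ℓ′ us u a) 1ℚ
              color-within {m} r@(_ , _ , _ , (col≡ , _) , _) nbr≡ draw≡ zero    pu≡ =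
                along (if-false {e = read Col nbr} (trans (cong₂ (λ p i → p i) col≡ (cong (_∸ 1) nbr≡)) pu≡))
                    (fresh-within {m} r nbr≡ draw≡ pu≡)
              color-within {m} r@(_ , _ , _ , (col≡ , _) , _) nbr≡ draw≡ (suc a) pu≡ =
                slack 5 (along (if-true {e = read Col nbr} (trans (cong₂ (λ p i → p i) col≡ (cong (_∸ 1) nbr≡)) pu≡))
                    (pinned-within {m} {a} r nbr≡ draw≡ pu≡))

            branchG-within : ∀ {m} → ready m →
                             Within (branchG ∷ Loop , m) (19 ℕ.+ base) (avg (H ∸ 1) λ y →
                                 gNext p ℓ′ (drop y (neighbors x)))
                                                                       (avg (H ∸ 1) λ y → occupied
                                                                           (drop y (neighbors x)))
            branchG-within {m} r@(out , _ , _ , pin , vtx≡) = along (straight 1 refl)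
              (choose (λ y → gNext p ℓ′ (drop y (neighbors x))) (λ y → occupied (drop y (neighbors x))) refl
                (cong (_∸ 1) (trans (at (proj₁ (proj₂ (proj₂ (proj₂ (proj₂ (proj₂ out)))))) 0) H≡)) λ i →
                along (straight 2 refl) (neighbor (toℕ i) (drop (toℕ i) (neighbors x)) refl))
              where
              after-probe : ℕ → Memory
              after-probe y = write (write m Draw 0 y) Nbr 0 (oracle adj (m Vtx 0) y)
              nbr≡ : ∀ y {us} → drop y (neighbors x) ≡ us → after-probe y Nbr 0 ≡ look us
              nbr≡ y y≡ = trans (cong (λ v → oracle adj v y) vtx≡) (trans (oracle-look x y) (cong look y≡))
              neighbor : ∀ y us → drop y (neighbors x) ≡ us →
                         Within (ifnz (reg Nbr) (ifnz (read Col nbr) Program.pinned fresh) kill ∷ Loop , after-probe y)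
                             (15 ℕ.+ base) (gNext p ℓ′ us) (occupied us)
              neighbor y []       y≡ =
                  slack 13 (along (if-false {e = reg Nbr} (nbr≡ y y≡)) (kill-within ℓ≡ ℚ.≤-refl out pin))
              neighbor y (u ∷ us) y≡ = along (if-true {e = reg Nbr} (nbr≡ y y≡))
                  (color-within y≡ {after-probe y} r (nbr≡ y y≡) refl (p (toℕ u)) refl)

            liveG : ∀ {m} → ready m → m Mode 0 ≡ 0 → m Clr 0 ≡ suc (toℕ c) → m Pos 0 ≡ 0 → p (toℕ x) ≡ suc (toℕ c) →
                    Within (live ∷ Loop , m) (23 ℕ.+ base) (g p (suc (length xs))) ⅝
            liveG {m} r@(_ , _ , _ , (_ , _ , _ , st) , _) mode≡ clr≡ pos≡ px≡c =
              hit≤ hits (value≡ (trans (lemma ½ A B) (g-step {p} {x} {c} (length xs) px≡c (stack-≤q {x ∷ xs} {p} st)))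
                (along (straight 1 refl) (choose {K = 1} coinValue hit refl refl λ where
                  Fin.zero → slack 11 (along (if-false {e = reg Mode} mode≡ ▷ if-false {e = reg Coin} refl)
                      (popG-within {write m Coin 0 0} r clr≡ pos≡))
                  (Fin.suc Fin.zero) → along (if-false {e = reg Mode} mode≡ ▷ if-true {e = reg Coin} refl)
                      (branchG-within {write m Coin 0 1} r))))
              where
              A B h : ℚ
              A = avg (q ∸ 1) λ y → if 16 ℕ.* H ∸ y ≡ᵇ 0 then 0ℚ else f (p [ toℕ x ↦ 0 ]) (length xs) (neighbors x) c
              B = avg (H ∸ 1) λ y → gNext p (suc (length xs)) (drop y (neighbors x))
              h = avg (H ∸ 1) λ y → occupied (drop y (neighbors x))
              coinValue hit : ℕ → ℚ
              coinValue zero    = A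
              coinValue (suc _) = B
              hit zero    = 1ℚ
              hit (suc _) = h
              lemma : ∀ k A B → k * (A + (B + 0ℚ)) ≡ k * A + k * B
              lemma = RingSolver.solve-∀ ℚ-ring
              hits : avg 1 hit ≤ ⅝
              hits = ℚ.≤-trans (ℚ.≤-reflexive (lemma ½ 1ℚ h)) (ℚ.+-monoʳ-≤ (½ * 1ℚ)
                       (*-monoˡ {½} {h} {¼} (ℚ.<⇒≤ (ℚ.positive⁻¹ ½))
                           (avg-occupied (neighbors x) ℕ.≤-refl (length-neighbors x))))

          restart-within : ∀ xs {m p} → length xs ≡ ℓ → Outer P₀ Q₀ m → m Run 0 ≡ 1 → m Sgn 0 ≡ s → Pinned m p xs →
                           Within (ifnz (reg Sp) toG finish ∷ Loop , m) (8 ℕ.+ base) (g p (length xs)) 1ℚ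
          restart-within (x ∷ xs) {m} {p} ℓ≡ out run sgn pin@(col≡ , sp≡ , (x≡ , _) , _∷_ {c = c} px≡c _) =
            along (if-true {e = reg Sp} sp≡ ▷ straight 7 refl) (again {s′ = s} {p = p} {x ∷ xs} {x} {c} {0} inG
              (ℕ.≤-trans (ℕ.≤-reflexive ℓ≡) (ℕ.n≤1+n ℓ)) out run refl sgn pin
              (vtx≡ , trans (cong₂ (λ p i → p i) col≡ vtx≡) px≡c , refl) (xs , refl , px≡c , refl) refl)
            where
            vtx≡ : m Stk (m Sp 0 ∸ 1) ≡ toℕ x
            vtx≡ = trans (cong (λ k → m Stk (k ∸ 1)) sp≡) x≡
          restart-within [] {m} {p} ℓ≡ out@(a , b , c , d , e , f′ , g′ , h , i , plus≡ , minus≡) run sgn pin@(_ , sp≡ ,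
              _ , [] p≗p₀) =
            slack 3 (along (if-false {e = reg Sp} sp≡) (value≡ (sym (g-empty {p} p≗p₀)) (ending s refl)))
            where
            lemma₊ : ∀ κ L b w β γ W → κ * (b - w) + κ * W ≡ (L + κ * b + β * 1ℚ * 1ℚ + (γ + κ * W) * 1ℚ) -
                (L + β + γ + κ * w)
            lemma₊ = RingSolver.solve-∀ ℚ-ring
            lemma₋ : ∀ κ L b w β γ W → κ * (b - w) + κ * W ≡ (L + κ * b + β * (- 1ℚ) * 1ℚ + (γ + κ * W) * 1ℚ) -
                (L - β + γ + κ * w)
            lemma₋ = RingSolver.solve-∀ ℚ-ring
            spare : 0ℚ ≤ κ * (fromℕ base - fromℕ 2) + κ * fromℕ walkCost
            spare = 0≤+ (0≤* 0≤κ (p≤q⇒0≤q-p (fromℕ-mono {2} {base} (s≤s (s≤s z≤n))))) (0≤* 0≤κ (0≤fromℕ walkCost))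
            ending : ∀ s′ → s′ ≡ s → Within (finish ∷ Loop , m) (4 ℕ.+ base) 1ℚ 1ℚ
            ending zero eq = along (straight 2 refl ▷ if-false {e = reg Sgn} (trans sgn (sym eq)) ▷ straight 1 refl)
              (wrap (weaken (subst (λ z → payoff plus + κ * fromℕ 2 ≤ L + κ * fromℕ base + β * sign z * 1ℚ + Γ * 1ℚ) eq
                       (0≤q-p⇒p≤q (subst (0ℚ ≤_) (lemma₊ κ L (fromℕ base) (fromℕ 2) β γ (fromℕ walkCost)) spare)))
                (IH (write (write m Run 0 0) Plus 0 (suc (m Plus 0)) ,
                     stopped plus (a , b , c , d , e , f′ , g′ , h , i , cong suc plus≡ , minus≡) refl pin))))
            ending (suc k) eq = along (straight 2 refl ▷ if-true {e = reg Sgn} (trans sgn (sym eq)) ▷ straight 1 refl)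
              (wrap (weaken (subst (λ z → payoff minus + κ * fromℕ 2 ≤ L + κ * fromℕ base + β * sign z * 1ℚ + Γ * 1ℚ) eq
                       (0≤q-p⇒p≤q (subst (0ℚ ≤_) (lemma₋ κ L (fromℕ base) (fromℕ 2) β γ (fromℕ walkCost)) spare)))
                (IH (write (write m Run 0 0) Minus 0 (suc (m Minus 0)) ,
                     stopped minus (a , b , c , d , e , f′ , g′ , h , i , plus≡ , cong suc minus≡) refl pin))))

          module PhaseF {p : ℕ → ℕ} {xs : List (Fin n)} {x : Fin n} {c : Fin q} {j : ℕ} (ℓ≡ : length xs ≡ ℓ) where

            ready : Memory → Set
            ready m = Outer P₀ Q₀ m × m Run 0 ≡ 1 × m Mode 0 ≡ 1 × m Sgn 0 ≡ s × Pinned m p xs × Located m x c j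

            us : List (Fin n)
            us = drop j (neighbors x)

            push-within : ∀ {m u us′ y} → drop y (neighbors x) ≡ u ∷ us′ → ready m → m Nbr 0 ≡ suc (toℕ u) →
                m Draw 0 ≡ y → p (toℕ u) ≡ 0 →
                          Within ((push ⨟ Pos ≔ lit 1 ⊕ reg Draw ⨟ Sgn ≔ lit 1 ⊖ reg Sgn) ∷ Loop , m) (9 ℕ.+ base)
                              (pushValue p (length xs) us′ u c 0) 1ℚ
            push-within {m} {u} {us′} {y} y≡ (out , run , mode , sgn , (col≡ , sp≡ , holds , st) , (vtx≡ , clr≡ , _))
                nbr≡ draw≡ pu≡0 =
              along (straight 9 refl) (again {s′ = 1 ∸ s} {p = p′} {u ∷ xs} {x} {c} {suc y} inF
                (ℕ.≤-reflexive (cong suc ℓ≡)) out run mode (cong (1 ∸_) sgn)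
                (trans (cong₂ (λ p i → p [ i ↦ m Clr 0 ]) col≡ nbr-1) (cong (λ k → p [ toℕ u ↦ k ]) clr≡) ,
                 cong suc sp≡ ,
                 (trans (cong (m Stk [ m Sp 0 ↦ m Nbr 0 ∸ 1 ]) (sym sp≡))
                     (trans (↦-same (m Stk) (m Sp 0) (m Nbr 0 ∸ 1)) nbr-1) ,
                  holds-above {xs = xs} (m Nbr 0 ∸ 1) (ℕ.≤-reflexive (sym sp≡)) holds) ,
                 stack-push {xs} {p} u c pu≡0 st)
                (vtx≡ , clr≡ , cong suc draw≡) tt
                (trans (cong₂ (λ σ us → σ * f p′ (suc (length xs)) us c) (sign-flip s) (drop-suc y (neighbors x) y≡))
                       (lemma (sign s) (f p′ (suc (length xs)) us′ c))))
              where
              p′ = p [ toℕ u ↦ suc (toℕ c) ]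
              nbr-1 = cong (_∸ 1) nbr≡
              lemma : ∀ s v → (- s) * v ≡ s * (- v)
              lemma = RingSolver.solve-∀ ℚ-ring

            branchF-within : ∀ {m} → ready m →
                             Within (branchF ∷ Loop , m) (17 ℕ.+ base) (avg (2 ℕ.* H ∸ 1) λ y →
                                 fNext p (length xs) c (drop y us))
                                                                       (avg (2 ℕ.* H ∸ 1) λ y → occupied (drop y us))
            branchF-within {m} r@(out , run , mode , sgn , pin@(col≡ , _) , loc@(vtx≡ , _ , pos≡)) =
                along (straight 1 refl)
              (choose (λ y → fNext p (length xs) c (drop y us)) (λ y → occupied (drop y us)) refl
                (cong (_∸ 1) (trans (at (proj₁ (proj₂ (proj₂ (proj₂ (proj₂ (proj₂ (proj₂ (proj₂ (proj₂ out))))))))) 0)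
                    2H≡)) λ i →
                along (straight 4 refl)
                    (neighbor (toℕ i) (drop (toℕ i) us) (sym (List.drop-drop j (toℕ i) (neighbors x)))))
              where
              after-probe : ℕ → Memory
              after-probe y = write (write (write m Draw 0 y) Draw 0 (m Pos 0 ℕ.+ y)) Nbr 0
                  (oracle adj (m Vtx 0) (m Pos 0 ℕ.+ y))
              nbr≡ : ∀ y {us} → drop (j ℕ.+ y) (neighbors x) ≡ us → after-probe y Nbr 0 ≡ look us
              nbr≡ y y≡ = trans (cong₂ (oracle adj) vtx≡ (cong (ℕ._+ y) pos≡))
                  (trans (oracle-look x (j ℕ.+ y)) (cong look y≡))
              occupant : ∀ y {u us′} → drop (j ℕ.+ y) (neighbors x) ≡ u ∷ us′ → ∀ a → p (toℕ u) ≡ a →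
                         Within (ifnz (read Col nbr) kill (push ⨟ Pos ≔ lit 1 ⊕ reg Draw ⨟ Sgn ≔ lit 1 ⊖ reg Sgn) ∷ Loop
                             , after-probe y)
                                (10 ℕ.+ base) (pushValue p (length xs) us′ u c a) 1ℚ
              occupant y y≡ zero    pu≡ =
                  along (if-false {e = read Col nbr} (trans (cong₂ (λ p i → p i) col≡ (cong (_∸ 1) (nbr≡ y y≡))) pu≡))
                (push-within {after-probe y} y≡ r (nbr≡ y y≡) (cong (ℕ._+ y) pos≡) pu≡)
              occupant y y≡ (suc a) pu≡ =
                  along (if-true {e = read Col nbr} (trans (cong₂ (λ p i → p i) col≡ (cong (_∸ 1) (nbr≡ y y≡))) pu≡))
                (slack 8 (kill-within ℓ≡ 0≤1 out pin))
              neighbor : ∀ y us′ → drop (j ℕ.+ y) (neighbors x) ≡ us′ →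
                         Within (ifnz (reg Nbr)
                             (ifnz (read Col nbr) kill (push ⨟ Pos ≔ lit 1 ⊕ reg Draw ⨟ Sgn ≔ lit 1 ⊖ reg Sgn)) kill ∷
                             Loop , after-probe y)
                                (11 ℕ.+ base) (fNext p (length xs) c us′) (occupied us′)
              neighbor y []        y≡ =
                  slack 9 (along (if-false {e = reg Nbr} (nbr≡ y y≡)) (kill-within ℓ≡ ℚ.≤-refl out pin))
              neighbor y (u ∷ us′) y≡ = along (if-true {e = reg Nbr} (nbr≡ y y≡)) (occupant y y≡ (p (toℕ u)) refl)

            us-short : length us ℕ.≤ Δ
            us-short = ℕ.≤-trans (ℕ.≤-reflexive (List.length-drop j (neighbors x)))
                (ℕ.≤-trans (ℕ.m∸n≤m (length (neighbors x)) j) (length-neighbors x))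

            liveF : ∀ {m} → ready m → ¬ Blocked p (suc (toℕ c)) us → Within (live ∷ Loop , m) (23 ℕ.+ base)
                (f p (length xs) us c) ⅝
            liveF {m} r@(out , run , mode , sgn , pin@(_ , _ , _ , st) , _) free =
              hit≤ hits (value≡ (trans (lemma ½ A B) (f-step {p} (length xs) us c free (stack-≤q {xs} {p} st) us-short))
                (along (straight 1 refl) (choose {K = 1} coinValue hit refl refl λ where
                  Fin.zero → slack 11 (along (if-true {e = reg Mode} mode ▷ if-false {e = reg Coin} refl)
                      (restart-within xs {write m Coin 0 0} ℓ≡ out run sgn pin))
                  (Fin.suc Fin.zero) → slack 2 (along (if-true {e = reg Mode} mode ▷ if-true {e = reg Coin} refl)
                      (branchF-within {write m Coin 0 1} r)))))
              where
              A B h : ℚ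
              A = g p (length xs)
              B = avg (2 ℕ.* H ∸ 1) λ y → fNext p (length xs) c (drop y us)
              h = avg (2 ℕ.* H ∸ 1) λ y → occupied (drop y us)
              coinValue hit : ℕ → ℚ
              coinValue zero    = A
              coinValue (suc _) = B
              hit zero    = 1ℚ
              hit (suc _) = h
              lemma : ∀ k A B → k * (A + (B + 0ℚ)) ≡ k * A + k * B
              lemma = RingSolver.solve-∀ ℚ-ring
              hits : avg 1 hit ≤ ⅝
              hits = ℚ.≤-trans (ℚ.≤-reflexive (lemma ½ 1ℚ h)) (ℚ.+-monoʳ-≤ (½ * 1ℚ)
                       (*-monoˡ {½} {h} {¼} (ℚ.<⇒≤ (ℚ.positive⁻¹ ½)) (avg-occupied us (ℕ.m≤m+n H (1 ℕ.* H)) us-short)))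

          live-within : ∀ ph {m p xs x c j} → length xs ≡ ℓ → Outer P₀ Q₀ m → m Run 0 ≡ 1 → m Mode 0 ≡ phaseCode ph →
              m Sgn 0 ≡ s →
                        Pinned m p xs → Located m x c j → Top ph p xs x c j →
                            ¬ Blocked p (suc (toℕ c)) (drop j (neighbors x)) →
                        Within (live ∷ Loop , m) (23 ℕ.+ base) (stateValue ph p xs c (drop j (neighbors x))) ⅝
          live-within inG {m} {p} {x = x} {c} ℓ≡ out run mode sgn pin (vtx≡ , clr≡ , pos≡) (xs′ , refl , px≡c , refl)
              free =
            PhaseG.liveG {p} {x} {xs′} {c} ℓ≡ {m} (out , run , sgn , pin , vtx≡) mode clr≡ pos≡ px≡c
          live-within inF {m} {p} {xs} {x} {c} {j} ℓ≡ out run mode sgn pin loc top free =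
            PhaseF.liveF {p} {xs} {x} {c} {j} ℓ≡ {m} (out , run , mode , sgn , pin , loc) free

          outer-agree : ∀ {m m′ P Q} → Agree m m′ → Outer P Q m → Outer P Q m′
          outer-agree ag (a , b , c , d , e , f′ , g′ , h , i , plus≡ , minus≡) =
            trans (ag 0 tt) a , trans (ag Out tt) b , trans (ag Walks tt) c , trans (ag Hue tt) d ,
                trans (ag Total tt) e ,
            trans (ag H1 tt) f′ , trans (ag H4 tt) g′ , trans (ag H16 tt) h , trans (ag H2 tt) i ,
            trans (at (ag Plus tt) 0) plus≡ , trans (at (ag Minus tt) 0) minus≡

          pinned-agree : ∀ {m m′ p xs} → Agree m m′ → Pinned m p xs → Pinned m′ p xs
          pinned-agree {xs = xs} ag (col≡ , sp≡ , holds , st) =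
            trans (ag Col tt) col≡ , trans (at (ag Sp tt) 0) sp≡ , subst (λ a → Holds a xs) (sym (ag Stk tt)) holds , st

          body-within : ∀ ph {m p xs x c j} → length xs ≡ ℓ → Outer P₀ Q₀ m → m Run 0 ≡ 1 → m Mode 0 ≡ phaseCode ph →
              m Sgn 0 ≡ s →
                        Pinned m p xs → Located m x c j → Top ph p xs x c j →
                        let v = stateValue ph p xs c (drop j (neighbors x)) ; k = roundCost ℕ.+ 4 ℕ.* ℓ in
                        (Blocked p (suc (toℕ c)) (drop j (neighbors x)) × Within (body ∷ Loop , m) k 0ℚ 0ℚ) ⊎
                        (¬ Blocked p (suc (toℕ c)) (drop j (neighbors x)) × Within (body ∷ Loop , m) k v ⅝)
          body-within ph {m} {p} {xs} {x} {c} {j} ℓ≡ out run mode sgn pin loc@(vtx≡ , clr≡ , pos≡) top =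
            after-scan (scan-path {p} {suc (toℕ c)} {x} {j} m {ifnz (reg Blk) kill live ∷ Loop} (proj₁ pin) clr≡ vtx≡
                pos≡)
            where
            us : List (Fin n)
            us = drop j (neighbors x)
            k : ℕ
            k = roundCost ℕ.+ 4 ℕ.* ℓ
            affordable : 1 ℕ.+ ((6 ℕ.+ scanCost us) ℕ.+ 1) ℕ.+ (23 ℕ.+ base) ℕ.≤ k
            affordable = begin
              1 ℕ.+ ((6 ℕ.+ scanCost us) ℕ.+ 1) ℕ.+ (23 ℕ.+ base)  ≡⟨ lemma (scanCost us) (4 ℕ.* ℓ) ⟩
              39 ℕ.+ scanCost us ℕ.+ 4 ℕ.* ℓ                       ≡⟨ cong (λ z → 39 ℕ.+ z ℕ.+ 4 ℕ.* ℓ) (scanCost≤ us) ⟩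
              40 ℕ.+ 7 ℕ.* length us ℕ.+ 4 ℕ.* ℓ                   ≤⟨ ℕ.+-monoˡ-≤ (4 ℕ.* ℓ)
                  (ℕ.+-monoʳ-≤ 40 (ℕ.*-monoʳ-≤ 7 short)) ⟩
              k                                                    ∎
              where
              open ℕ.≤-Reasoning
              short : length us ℕ.≤ Δ
              short = ℕ.≤-trans (ℕ.≤-reflexive (List.length-drop j (neighbors x)))
                  (ℕ.≤-trans (ℕ.m∸n≤m (length (neighbors x)) j) (length-neighbors x))
              lemma : ∀ z a → 1 ℕ.+ ((6 ℕ.+ z) ℕ.+ 1) ℕ.+ (23 ℕ.+ (8 ℕ.+ a)) ≡ 39 ℕ.+ z ℕ.+ a
              lemma = ℕ-Ring.solve-∀
            pay : ∀ {v h} → Within (body ∷ Loop , m) (1 ℕ.+ ((6 ℕ.+ scanCost us) ℕ.+ 1) ℕ.+ (23 ℕ.+ base)) v h →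
                Within (body ∷ Loop , m) k v h
            pay {v} {h} w = wrap (weaken (budget-mono {_} {k} v {h} affordable ℚ.≤-refl) (unwrap w))
            after-scan : (∃ λ m′ → (scan ∷ ifnz (reg Blk) kill live ∷ Loop , m) ⇒[ 6 ℕ.+ scanCost us ]
                (ifnz (reg Blk) kill live ∷ Loop , m′) × Agree m m′ ×
                           ((¬ Blocked p (suc (toℕ c)) us × m′ Blk 0 ≡ 0) ⊎
                               (Blocked p (suc (toℕ c)) us × m′ Blk 0 ≡ 1))) →
                         (Blocked p (suc (toℕ c)) us × Within (body ∷ Loop , m) k 0ℚ 0ℚ) ⊎
                         (¬ Blocked p (suc (toℕ c)) us × Within (body ∷ Loop , m) k (stateValue ph p xs c us) ⅝)
            after-scan (m′ , path , ag , inj₂ (blocked , blk)) =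
                inj₁ (blocked , pay (along (straight 1 refl ▷ path ▷ if-true {e = reg Blk} blk)
              (slack 22 (kill-within ℓ≡ ℚ.≤-refl (outer-agree {m} {m′} ag out)
                  (pinned-agree {m} {m′} {p} {xs} ag pin)))))
            after-scan (m′ , path , ag , inj₁ (free , blk)) =
                inj₂ (free , pay (along (straight 1 refl ▷ path ▷ if-false {e = reg Blk} blk)
              (live-within ph {m′} {p} {xs} {x} {c} {j} ℓ≡ (outer-agree {m} {m′} ag out) (trans (at (ag Run tt) 0) run)
                  (trans (at (ag Mode tt) 0) mode)
                (trans (at (ag Sgn tt) 0) sgn) (pinned-agree {m} {m′} {p} {xs} ag pin)
                (trans (at (ag Vtx tt) 0) vtx≡ , trans (at (ag Clr tt) 0) clr≡ , trans (at (ag Pos tt) 0) pos≡) top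
                    free)))

        loop-step : ∀ st → ∃ λ c′ → transition (oracle adj) (loop (proj₁ st)) ≡ goto c′ ×
                      (∀ t → (∀ st′ → Bounded t (loop (proj₁ st′)) (bound st′)) → ∃ λ b′ →
                          κ + b′ ≤ bound st × Bounded t c′ b′)
        loop-step (m , stopped o {p} {xs} fin run pin) = (clear ∷ rest , m) ,
          cong (λ z → goto ((if z ≡ᵇ 0 then clear ∷ rest else body ∷ Loop) , m)) run , λ t IH →
          let m′ , path , fin′ , col′ = clear-path xs {p} {o} m pin fin in
          _ , ℚ.≤-reflexive (trans (lemma κ (fromℕ (1 ℕ.+ 4 ℕ.* length xs)) (payoff o))
                (cong (λ z → payoff o + κ * z) (sym (fromℕ-+ 1 (1 ℕ.+ 4 ℕ.* length xs))))) ,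
          path-bound path (after o t m′ fin′ col′)
          where
          lemma : ∀ κ k U → κ + (k * κ + U) ≡ U + κ * (1ℚ + k)
          lemma = RingSolver.solve-∀ ℚ-ring
        loop-step (m , running ph {s} {p} {xs} {x} {c} {j} a out run mode sgn pin loc top v≤a a≤1 unblocked) =
            (body ∷ Loop , m) ,
          cong (λ z → goto ((if z ≡ᵇ 0 then clear ∷ rest else body ∷ Loop) , m)) run , λ t IH →
          finish-round t IH (Round.body-within t IH s (length xs) ph {m} {p} {xs} {x} {c} {j} refl out run mode sgn pin
              loc top)
          where
          us : List (Fin n)
          us = drop j (neighbors x)
          v R ℓ : ℚ
          v = stateValue ph p xs c us
          R = fromℕ roundCost
          ℓ = fromℕ (4 ℕ.* length xs)
          b : ℚ
          b = β * sign s
          1≤R : 1ℚ ≤ R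
          1≤R = fromℕ-mono {1} {roundCost} (s≤s z≤n)
          0≤a : 0ℚ ≤ a
          0≤a = ℚ.≤-trans (0≤stateValue ph p xs c us) v≤a
          K≡ : fromℕ (roundCost ℕ.+ 4 ℕ.* length xs) ≡ R + ℓ
          K≡ = fromℕ-+ roundCost (4 ℕ.* length xs)
          W≡ : fromℕ walkCost ≡ fromℕ 8 * R
          W≡ = fromℕ-* 8 roundCost
          Wℓ≡ : fromℕ (walkCost ℕ.+ 4 ℕ.* length xs) ≡ fromℕ 8 * R + ℓ
          Wℓ≡ = trans (fromℕ-+ walkCost (4 ℕ.* length xs)) (cong (_+ ℓ) W≡)
          lemma₁ : ∀ κ R ℓ L b γ a → κ * (fromℕ 6 * R + (R - 1ℚ)) + γ * a ≡ (L + κ * (fromℕ 8 * R + ℓ) + b * 0ℚ + γ * a)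
              - (κ + (L + κ * (R + ℓ) + b * 0ℚ + (γ + κ * (fromℕ 8 * R)) * 0ℚ))
          lemma₁ = RingSolver.solve-∀ ℚ-ring
          lemma₂ : ∀ κ R ℓ L x γ → κ * (R + (R - 1ℚ)) + (1ℚ - ⅝) * γ ≡ (L + κ * (fromℕ 8 * R + ℓ) + x + γ * 1ℚ) -
              (κ + (L + κ * (R + ℓ) + x + (γ + κ * (fromℕ 8 * R)) * ⅝))
          lemma₂ = RingSolver.solve-∀ ℚ-ring
          scaled : ∀ y h z e → (L + κ * (fromℕ 8 * R + ℓ) + b * y + γ * z) -
              (κ + (L + κ * (R + ℓ) + b * y + (γ + κ * (fromℕ 8 * R)) * h)) ≡ e →
                   0ℚ ≤ e → κ + (L + κ * fromℕ (roundCost ℕ.+ 4 ℕ.* length xs) + b * y + (γ + κ * fromℕ walkCost) * h)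
                          ≤ L + κ * fromℕ (walkCost ℕ.+ 4 ℕ.* length xs) + b * y + γ * z
          scaled y h z e eq 0≤e = subst₂ _≤_
            (cong₂ (λ k W → κ + (L + κ * k + b * y + (γ + κ * W) * h)) (sym K≡) (sym W≡))
            (cong (λ k → L + κ * k + b * y + γ * z) (sym Wℓ≡)) (0≤q-p⇒p≤q (subst (0ℚ ≤_) (sym eq) 0≤e))
          finish-round : ∀ t IH →
            (Blocked p (suc (toℕ c)) us × Round.Within t IH s (length xs) (body ∷ Loop , m)
                (roundCost ℕ.+ 4 ℕ.* length xs) 0ℚ 0ℚ) ⊎
            (¬ Blocked p (suc (toℕ c)) us × Round.Within t IH s (length xs) (body ∷ Loop , m)
                (roundCost ℕ.+ 4 ℕ.* length xs) v ⅝) →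
            ∃ λ b′ → κ + b′ ≤ L + κ * fromℕ (walkCost ℕ.+ 4 ℕ.* length xs) + b * v + γ * a × Bounded t (body ∷ Loop , m)
                b′
          finish-round t IH (inj₁ (blocked , w)) = _ ,
              subst (λ y → κ + Round.budget t IH s (length xs) (roundCost ℕ.+ 4 ℕ.* length xs) 0ℚ 0ℚ
              ≤ L + κ * fromℕ (walkCost ℕ.+ 4 ℕ.* length xs) + b * y + γ * a)
                  (sym (value-blocked ph {p} {xs} {x} {c} {j} top blocked))
            (scaled 0ℚ 0ℚ a (κ * (fromℕ 6 * R + (R - 1ℚ)) + γ * a) (sym (lemma₁ κ R ℓ L b γ a))
              (0≤+ (0≤* 0≤κ (0≤+ (0≤* (0≤fromℕ 6) (0≤fromℕ roundCost)) (p≤q⇒0≤q-p 1≤R))) (0≤* 0≤γ 0≤a))) , unwrap w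
          finish-round t IH (inj₂ (free , w)) = _ ,
              subst (λ a → κ + Round.budget t IH s (length xs) (roundCost ℕ.+ 4 ℕ.* length xs) v ⅝
              ≤ L + κ * fromℕ (walkCost ℕ.+ 4 ℕ.* length xs) + b * v + γ * a) (sym (unblocked free))
            (scaled v ⅝ 1ℚ (κ * (R + (R - 1ℚ)) + (1ℚ - ⅝) * γ) (sym (lemma₂ κ R ℓ L (b * v) γ))
              (0≤+ (0≤* 0≤κ (0≤+ (0≤fromℕ roundCost) (p≤q⇒0≤q-p 1≤R)))
                  (0≤* (p≤q⇒0≤q-p {⅝} {1ℚ} (*≤* (ℤ.+≤+ (ℕ.m≤m+n 5 3)))) 0≤γ))) , unwrap w

        loop-bounded : ∀ t st → Bounded t (loop (proj₁ st)) (bound st)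
        loop-bounded = loop-bound (loop ∘ proj₁) bound 0≤bound loop-step

        walk-bounded : ∀ t v c a → m₀ 0 3 ≡ toℕ v → m₀ Hue 0 ≡ suc (toℕ {q} c) → m₀ Col ≗ p₀ → p₀ (toℕ v) ≡ 0 →
                       let p₁ = p₀ [ toℕ v ↦ suc (toℕ c) ] in
                       g p₁ 1 ≤ a → a ≤ 1ℚ → (¬ Blocked p₀ (suc (toℕ c)) (neighbors v) → a ≡ 1ℚ) →
                       Bounded t (walk ∷ rest , m₀) (κ * fromℕ (23 ℕ.+ walkCost) + (L + β * g p₁ 1 + γ * a))
        walk-bounded t v c a v≡ c≡ col≗ pv≡0 g≤a a≤1 unblocked = weaken (ℚ.≤-reflexive total)
          (path-bound (straight 19 refl) (loop-bounded t (m₁ , running inG {0} {p} {v ∷ []} {v} {c} {0} a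
            (refl , refl , refl , refl , refl , refl , refl , refl , refl , refl , refl) refl refl refl
            (refl , refl , (v≡ , tt) , pv≡c ∷ [] unpin) (v≡ , c≡ , refl) ([] , refl , pv≡c , refl)
            (ℚ.≤-trans (ℚ.≤-reflexive g≡) g≤a) a≤1 (λ free → unblocked (free ∘ still-blocked)))))
          where
          m₁ : Memory
          m₁ = write (write (write
              (write (write (write (write (write (write m₀ Col (m₀ 0 3) (m₀ Hue 0)) Stk 0 (m₀ 0 3)) Sp 0 1)
                 Vtx 0 (m₀ 0 3)) Clr 0 (m₀ Hue 0)) Pos 0 0) Mode 0 0) Sgn 0 0) Run 0 1
          p : ℕ → ℕ
          p = m₁ Col
          p₁ = p₀ [ toℕ v ↦ suc (toℕ c) ]
          p≗p₁ : p ≗ p₁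
          p≗p₁ i = trans (cong₂ (λ i′ k → (m₀ Col [ i′ ↦ k ]) i) v≡ c≡) (↦-cong (toℕ v) (suc (toℕ c)) col≗ i)
          pv≡c : p (toℕ v) ≡ suc (toℕ c)
          pv≡c = trans (p≗p₁ (toℕ v)) (↦-same p₀ (toℕ v) (suc (toℕ c)))
          unpin : p [ toℕ v ↦ 0 ] ≗ p₀
          unpin i = trans (↦-cong (toℕ v) 0 p≗p₁ i) (↦-undo {p₀} (toℕ v) (suc (toℕ c)) pv≡0 i)
          g≡ : g p 1 ≡ g p₁ 1
          g≡ = cong (λ z → fromℕ z * unit 1) (Z-cong {p} {p₁} p≗p₁)
          still-blocked : Blocked p₀ (suc (toℕ c)) (neighbors v) → Blocked p (suc (toℕ c)) (neighbors v)
          still-blocked blocked = let u , u∈ , eq = find blocked in lose u∈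
            (trans (p≗p₁ (toℕ u)) (trans (↦-other p₀ {toℕ v} {toℕ u} (suc (toℕ c))
              (λ u≡v → irrefl (sym (Fin.toℕ-injective u≡v)) (Equivalence.to (correct v u) u∈))) eq))
          total : fromℕ 19 * κ + (L + κ * fromℕ (walkCost ℕ.+ 4) + β * 1ℚ * g p 1 + γ * a) ≡ κ * fromℕ (23 ℕ.+ walkCost)
              + (L + β * g p₁ 1 + γ * a)
          total = trans (cong₂ (λ W x → fromℕ 19 * κ + (L + κ * W + β * 1ℚ * x + γ * a)) (fromℕ-+ walkCost 4) g≡)
                  (trans (lemma κ L (fromℕ walkCost) β (g p₁ 1) γ a) (cong (λ W → κ * W + (L + β * g p₁ 1 + γ * a))
                      (sym (fromℕ-+ 23 walkCost))))
            where
            lemma : ∀ κ L W β x γ a → fromℕ 19 * κ + (L + κ * (W + fromℕ 4) + β * 1ℚ * x + γ * a) ≡ κ * (fromℕ 23 + W) +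
                (L + β * x + γ * a)
            lemma = RingSolver.solve-∀ ℚ-ring

open Walks

module Estimates where

  open import Data.Rational using (_+_; _*_; _-_; -_; _≤_; _<_)

  hueStep main wbody store : Stmt
  wbody = Walks ≔ reg Walks ⊖ lit 1 ⨟ walk
  store = assign Out (reg Hue) (reg Plus ⊖ reg Minus) ⨟ Hue ≔ reg Hue ⊖ lit 1
  hueStep = Plus ≔ lit 0 ⨟ Minus ≔ lit 0 ⨟ Walks ≔ reg Total ⨟ while (reg Walks) wbody ⨟ store
  main = while (reg Hue) hueStep

  square : ℚ → ℚ
  square x = x * x

  square-∸ : ∀ a b {y} → 0ℚ ≤ y → square (fromℕ (a ∸ b) - y) ≤ square (fromℕ a - fromℕ b - y)
  square-∸ a b {y} 0≤y with ℕ.≤-total b a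
  ... | inj₁ b≤a = ℚ.≤-reflexive (cong (λ x → square (x - y)) (fromℕ-∸ b≤a))
  ... | inj₂ a≤b = subst (λ k → square (fromℕ k - y) ≤ square (fromℕ a - fromℕ b - y)) (sym (ℕ.m≤n⇒m∸n≡0 a≤b))
        (0≤q-p⇒p≤q (subst (0ℚ ≤_) (lemma (fromℕ a) (fromℕ b) y)
            (0≤+ (0≤p² (fromℕ b - fromℕ a)) (0≤* (0≤* (0≤fromℕ 2) 0≤d) 0≤y))))
    where
    0≤d : 0ℚ ≤ fromℕ b - fromℕ a
    0≤d = p≤q⇒0≤q-p (fromℕ-mono a≤b)
    lemma : ∀ a b y → (b - a) * (b - a) + fromℕ 2 * (b - a) * y ≡ (a - b - y) * (a - b - y) - (0ℚ - y) * (0ℚ - y)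
    lemma = RingSolver.solve-∀ ℚ-ring

  module Errors (inst : Instance) (v : Fin (Instance.n inst)) (N : ℕ) (a w : ℕ → ℚ) (0≤w : ∀ k → 0ℚ ≤ w k) where

    open Instance inst using (p₀)
    open Values inst using (g; 0≤g)

    g₁ : ℕ → ℚ
    g₁ k = g (p₀ [ toℕ v ↦ suc k ]) 1

    0≤g₁ : ∀ k → 0ℚ ≤ g₁ k
    0≤g₁ k = 0≤g (p₀ [ toℕ v ↦ suc k ]) 1

    Nℚ : ℚ
    Nℚ = fromℕ N

    error : Memory → ℕ → ℚ
    error m k = w k * square (fromℕ (m Out (suc k)) - Nℚ * g₁ k)

    past : Memory → ℕ → ℕ → ℚ
    past m k zero      = 0ℚ
    past m k (suc len) = error m k + past m (suc k) len

    future : ℕ → ℚ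
    future zero    = 0ℚ
    future (suc k) = w k * (Nℚ * a k) + future k

    0≤past : ∀ m k len → 0ℚ ≤ past m k len
    0≤past m k zero      = ℚ.≤-refl
    0≤past m k (suc len) = 0≤+ (0≤* (0≤w k) (0≤p² (fromℕ (m Out (suc k)) - Nℚ * g₁ k))) (0≤past m (suc k) len)

    past-cong : ∀ {m m′} k len → (∀ i → k ℕ.≤ i → m′ Out (suc i) ≡ m Out (suc i)) → past m′ k len ≡ past m k len
    past-cong k zero      eq = refl
    past-cong k (suc len) eq = cong₂ (λ x y → w k * square (fromℕ x - Nℚ * g₁ k) + y) (eq k ℕ.≤-refl)
      (past-cong (suc k) len (λ i k<i → eq i (ℕ.<⇒≤ k<i)))

    error≤past : ∀ m j len k → j ℕ.≤ k → k ℕ.< j ℕ.+ len → error m k ≤ past m j len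
    error≤past m j zero      k j≤k k< =
        ⊥-elim (ℕ.<-irrefl refl (ℕ.<-≤-trans k< (ℕ.≤-trans (ℕ.≤-reflexive (ℕ.+-identityʳ j)) j≤k)))
    error≤past m j (suc len) k j≤k k< = split (ℕ.m≤n⇒m<n∨m≡n j≤k)
      where
      0≤error : 0ℚ ≤ error m j
      0≤error = 0≤* (0≤w j) (0≤p² (fromℕ (m Out (suc j)) - Nℚ * g₁ j))
      split : j ℕ.< k ⊎ j ≡ k → error m k ≤ past m j (suc len)
      split (inj₂ j≡k) = ℚ.≤-trans (ℚ.≤-reflexive (trans (cong (error m) (sym j≡k)) (sym (ℚ.+-identityʳ (error m j)))))
                                   (ℚ.+-monoʳ-≤ (error m j) (0≤past m (suc j) len))
      split (inj₁ j<k) = ℚ.≤-trans (error≤past m (suc j) len k j<k (subst (k ℕ.<_) (ℕ.+-suc j len) k<))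
        (ℚ.≤-trans (ℚ.≤-reflexive (sym (ℚ.+-identityˡ (past m (suc j) len))))
            (ℚ.+-monoˡ-≤ (past m (suc j) len) 0≤error))

  module Estimating (inst : Instance) (rew : Reward) (v : Fin (Instance.n inst)) (pv≡0 : Instance.p₀ inst (toℕ v) ≡ 0)
    (N D₀ : ℕ) (a w : ℕ → ℚ) (0≤w : ∀ k → 0ℚ ≤ w k) where

    open Instance inst
    open Reward rew
    open AdjacencyLists adj using (neighbors)
    open Conditioning G adj q 1≤Δ 65Δ≤q using (Δ)
    open Values inst using (g; color; toℕ-color)
    open Scan adj using (Blocked)
    open Paths (oracle adj) using (_▷_; straight; while-true; while-false)
    open Value (oracle adj) rew using (Bounded; weaken; path-bound; halt-bound)
    open Walking inst rew using (module OneWalk; walkCost; Constants; Unchanged; Outcomes; Payoff)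
    open Errors inst v N a w 0≤w using (g₁; 0≤g₁; Nℚ; error; past; 0≤past; past-cong; future)

    stepCost hueCost : ℕ
    stepCost = 26 ℕ.+ walkCost
    hueCost = 12 ℕ.+ N ℕ.* stepCost

    Steady : Memory → Set
    Steady m = m 0 2 ≡ q × m 0 3 ≡ toℕ v × m Total 0 ≡ N × m H1 0 ≡ H × m H4 0 ≡ 4 ℕ.* H × m H16 0 ≡ 16 ℕ.* H × m H2 0 ≡
        2 ℕ.* H × m Out 0 ≡ D₀

    module _ (0≤a : ∀ k → 0ℚ ≤ a k) (a≤1 : ∀ k → a k ≤ 1ℚ) (g≤a : ∀ k → k ℕ.< q → g₁ k ≤ a k)
             (unblocked : ∀ k → k ℕ.< q → ¬ Blocked p₀ (suc k) (neighbors v) → a k ≡ 1ℚ)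
             (final : ∀ m → m Out 0 ≡ D₀ → φ m ≤ past m 0 q) where

      0≤future : ∀ k → 0ℚ ≤ future k
      0≤future zero    = ℚ.≤-refl
      0≤future (suc k) = 0≤+ (0≤* (0≤w k) (0≤* (0≤fromℕ N) (0≤a k))) (0≤future k)

      HueBound : ℕ → Set
      HueBound k = ∀ len m t → k ℕ.+ len ≡ q → m Hue 0 ≡ k → Steady m → m Col ≗ p₀ →
                   Bounded t (main ∷ [] , m) (κ * fromℕ (1 ℕ.+ k ℕ.* hueCost) + (future k + past m k len))

      module _ (k len : ℕ) (k+len : suc k ℕ.+ len ≡ q) (next-hue : HueBound k) where

        k<q : k ℕ.< q
        k<q = subst (suc k ℕ.≤_) k+len (ℕ.m≤m+n (suc k) len)

        tail : List Stmt
        tail = store ∷ main ∷ []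

        endCost : ℕ
        endCost = 5 ℕ.+ k ℕ.* hueCost

        rest : Memory → ℚ
        rest m = future k + past m (suc k) len

        walkState : ℚ → ℚ → ℕ → Memory → ℚ
        walkState P Q i m = κ * fromℕ (endCost ℕ.+ i ℕ.* stepCost) + (w k * (square (P - Q) + fromℕ i * a k) + rest m)

        walks-bounded : ∀ i d m t → d ℕ.+ i ≡ N → m Walks 0 ≡ i → m Hue 0 ≡ suc k → Steady m → m Col ≗ p₀ →
                        Bounded t (while (reg Walks) wbody ∷ tail , m)
                          (walkState (fromℕ (m Plus 0) - fromℕ (m Minus 0)) (fromℕ d * g₁ k) i m)
        walks-bounded zero d m t d≡N walks≡ hue≡ (q≡ , v≡ , total≡ , h≡ , 4h≡ , 16h≡ , 2h≡ , den≡) col≗ = weaken le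
          (path-bound (while-false {e = reg Walks} walks≡ ▷ straight 3 refl)
            (next-hue (suc len) m′ t (trans (ℕ.+-suc k len) k+len) (cong (_∸ 1) hue≡)
              (q≡ , v≡ , total≡ , h≡ , 4h≡ , 16h≡ , 2h≡ ,
                  trans (cong (λ h → (m Out [ h ↦ m Plus 0 ∸ m Minus 0 ]) 0) hue≡) den≡) col≗))
          where
          P Q : ℕ
          P = m Plus 0
          Q = m Minus 0
          m′ : Memory
          m′ = write (write m Out (m Hue 0) (P ∸ Q)) Hue 0 (m Hue 0 ∸ 1)
          out≡ : m′ Out (suc k) ≡ P ∸ Q
          out≡ = trans (cong (λ h → (m Out [ h ↦ P ∸ Q ]) (suc k)) hue≡) (↦-same (m Out) (suc k) (P ∸ Q))
          kept : ∀ i → suc k ℕ.≤ i → m′ Out (suc i) ≡ m Out (suc i)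
          kept i k<i = trans (cong (λ h → (m Out [ h ↦ P ∸ Q ]) (suc i)) hue≡) (↦-other (m Out) (P ∸ Q) λ eq →
              ℕ.<⇒≢ k<i (sym (ℕ.suc-injective eq)))
          y : ℚ
          y = Nℚ * g₁ k
          D : ℚ
          D = fromℕ P - fromℕ Q - fromℕ d * g₁ k
          d≡ : fromℕ d ≡ Nℚ
          d≡ = cong fromℕ (trans (sym (ℕ.+-identityʳ d)) d≡N)
          e≤ : error m′ k ≤ w k * square D
          e≤ = *-monoˡ (0≤w k) (subst₂ (λ o z → square (fromℕ o - y) ≤ square (fromℕ P - fromℕ Q - z * g₁ k)) (sym out≡)
              (sym d≡)
                 (square-∸ P Q (0≤* (0≤fromℕ N) (0≤g₁ k))))
          lemma : ∀ κ c w s a f e x → κ * (fromℕ 5 + c) + (w * (s + 0ℚ * a) + (f + x)) -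
              (fromℕ 4 * κ + (κ * (1ℚ + c) + (f + (e + x)))) ≡ w * s - e
          lemma = RingSolver.solve-∀ ℚ-ring
          le : fromℕ 4 * κ + (κ * fromℕ (1 ℕ.+ k ℕ.* hueCost) + (future k + past m′ k (suc len)))
               ≤ walkState (fromℕ P - fromℕ Q) (fromℕ d * g₁ k) 0 m
          le = 0≤q-p⇒p≤q (subst (0ℚ ≤_)
            (trans (sym (lemma κ (fromℕ (k ℕ.* hueCost)) (w k) (square D) (a k) (future k) (error m′ k)
                (past m (suc k) len)))
              (cong₂ (λ A B → κ * A + (w k * (square D + 0ℚ * a k) + rest m) - (fromℕ 4 * κ + B))
                (trans (sym (fromℕ-+ 5 (k ℕ.* hueCost))) (cong fromℕ (sym (ℕ.+-identityʳ endCost))))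
                (cong₂ (λ A x → κ * A + (future k + (error m′ k + x))) (sym (fromℕ-+ 1 (k ℕ.* hueCost)))
                    (sym (past-cong {m} {m′} (suc k) len kept)))))
            (p≤q⇒0≤q-p e≤))
        walks-bounded (suc i) d m t d≡N walks≡ hue≡ (q≡ , v≡ , total≡ , h≡ , 4h≡ , 16h≡ , 2h≡ , den≡) col≗ = weaken le
          (path-bound (while-true {e = reg Walks} walks≡ ▷ straight 2 refl)
            (OneWalk.walk-bounded m₁ constants (while (reg Walks) wbody ∷ tail) L β (w k) (state≥0 E) (0≤w k) 0≤₊ 0≤₋
                after t v (color k) (a k) v≡ (trans hue≡ (cong suc (sym (toℕ-color k<q)))) col≗ pv≡0
              (subst (λ j → g (p₀ [ toℕ v ↦ suc j ]) 1 ≤ a k) (sym (toℕ-color k<q)) (g≤a k k<q)) (a≤1 k)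
              (λ free → unblocked k k<q (free ∘ subst (λ j → Blocked p₀ (suc j) (neighbors v)) (sym (toℕ-color k<q))))))
          where
          m₁ : Memory
          m₁ = write m Walks 0 (m Walks 0 ∸ 1)
          P Q : ℚ
          P = fromℕ (m Plus 0)
          Q = fromℕ (m Minus 0)
          x y E D C c R I : ℚ
          x = g₁ k
          y = fromℕ (suc d) * x
          D = P - Q - fromℕ d * x
          E = P - Q - y
          I = fromℕ i
          R = rest m
          C = fromℕ (endCost ℕ.+ i ℕ.* stepCost)
          c = fromℕ (23 ℕ.+ walkCost)
          L β : ℚ
          L = κ * C + (w k * (square E + I * a k) + R)
          β = fromℕ 2 * (w k * E)
          state≥0 : ∀ z → 0ℚ ≤ κ * C + (w k * (square z + I * a k) + R)
          state≥0 z = 0≤+ (0≤* 0≤κ (0≤fromℕ (endCost ℕ.+ i ℕ.* stepCost)))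
              (0≤+ (0≤* (0≤w k) (0≤+ (0≤p² z) (0≤* (0≤fromℕ i) (0≤a k))))
                        (0≤+ (0≤future k) (0≤past m (suc k) len)))
          lemma₊ : ∀ κC w P Q y I a R → κC + (w * ((P + 1ℚ - Q - y) * (P + 1ℚ - Q - y) + I * a) + R)
                   ≡ κC + (w * ((P - Q - y) * (P - Q - y) + I * a) + R) + fromℕ 2 * (w * (P - Q - y)) + w
          lemma₊ = RingSolver.solve-∀ ℚ-ring
          lemma₋ : ∀ κC w P Q y I a R → κC + (w * ((P - (Q + 1ℚ) - y) * (P - (Q + 1ℚ) - y) + I * a) + R)
                   ≡ κC + (w * ((P - Q - y) * (P - Q - y) + I * a) + R) - fromℕ 2 * (w * (P - Q - y)) + w
          lemma₋ = RingSolver.solve-∀ ℚ-ring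
          constants : Constants m₁
          constants = record { q≡ = q≡ ; H≡ = h≡ ; 4H≡ = 4h≡ ; 16H≡ = 16h≡ ; 2H≡ = 2h≡ }
          0≤₊ : 0ℚ ≤ L + β + w k
          0≤₊ = subst (0ℚ ≤_) (lemma₊ (κ * C) (w k) P Q y I (a k) R) (state≥0 (P + 1ℚ - Q - y))
          0≤₋ : 0ℚ ≤ L - β + w k
          0≤₋ = subst (0ℚ ≤_) (lemma₋ (κ * C) (w k) P Q y I (a k) R) (state≥0 (P - (Q + 1ℚ) - y))
          fromℕ-suc : ∀ j → fromℕ (suc j) ≡ fromℕ j + 1ℚ
          fromℕ-suc j = trans (fromℕ-+ 1 j) (ℚ.+-comm 1ℚ (fromℕ j))
          resume : ∀ {P′ Q′ m′} t → Unchanged m₁ P′ Q′ m′ → m′ Col ≗ p₀ → ∀ {b} →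
                   κ * C + (w k * (square (fromℕ P′ - fromℕ Q′ - y) + I * a k) + R) ≡ b →
                   Bounded t (while (reg Walks) wbody ∷ tail , m′) b
          resume {P′} {Q′} {m′} t (in≡ , out≡ , walks′≡ , hue′≡ , total′≡ , h′≡ , 4h′≡ , 16h′≡ , 2h′≡ , plus≡ , minus≡)
              col′ eq =
            weaken (ℚ.≤-reflexive (trans (cong₂ (λ z r → κ * C + (w k * (square z + I * a k) + r))
                (cong₂ (λ P Q → fromℕ P - fromℕ Q - y) plus≡ minus≡)
                (cong (future k +_) (past-cong {m} {m′} (suc k) len λ i _ → at out≡ (suc i)))) eq))
              (walks-bounded i (suc d) m′ t (trans (sym (ℕ.+-suc d i)) d≡N) (trans (at walks′≡ 0) (cong (_∸ 1) walks≡))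
                  (trans (at hue′≡ 0) hue≡)
                (trans (at in≡ 2) q≡ , trans (at in≡ 3) v≡ , trans (at total′≡ 0) total≡ , trans (at h′≡ 0) h≡ ,
                    trans (at 4h′≡ 0) 4h≡ ,
                 trans (at 16h′≡ 0) 16h≡ , trans (at 2h′≡ 0) 2h≡ , trans (at out≡ 0) den≡) col′)
          after : ∀ o t m′ → Outcomes m₁ o m′ → m′ Col ≗ p₀ → Bounded t (while (reg Walks) wbody ∷ tail , m′)
              (Payoff L β (w k) o)
          after none  t m′ fin col′ = resume {m′ = m′} t fin col′ refl
          after plus  t m′ fin col′ = resume {m′ = m′} t fin col′
            (trans (cong (λ z → κ * C + (w k * (square (z - Q - y) + I * a k) + R)) (fromℕ-suc (m Plus 0)))
                (lemma₊ (κ * C) (w k) P Q y I (a k) R))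
          after minus t m′ fin col′ = resume {m′ = m′} t fin col′
            (trans (cong (λ z → κ * C + (w k * (square (P - z - y) + I * a k) + R)) (fromℕ-suc (m Minus 0)))
                (lemma₋ (κ * C) (w k) P Q y I (a k) R))
          lemma : ∀ κ C c w P Q d x I a R →
                  κ * (fromℕ 3 + c + C) + (w * ((P - Q - d * x) * (P - Q - d * x) + (1ℚ + I) * a) + R)
                  - (fromℕ 3 * κ + (κ * c + (κ * C + (w * ((P - Q - (1ℚ + d) * x) * (P - Q - (1ℚ + d) * x) + I * a) + R)
                      + fromℕ 2 * (w * (P - Q - (1ℚ + d) * x)) * x + w * a)))
                  ≡ w * (x * x)
          lemma = RingSolver.solve-∀ ℚ-ring
          cost≡ : fromℕ 3 + c + C ≡ fromℕ (endCost ℕ.+ suc i ℕ.* stepCost)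
          cost≡ = trans (cong (_+ C) (sym (fromℕ-+ 3 (23 ℕ.+ walkCost))))
              (trans (sym (fromℕ-+ stepCost (endCost ℕ.+ i ℕ.* stepCost)))
            (cong fromℕ (swap stepCost endCost (i ℕ.* stepCost))))
            where
            swap : ∀ a b c → a ℕ.+ (b ℕ.+ c) ≡ b ℕ.+ (a ℕ.+ c)
            swap = ℕ-Ring.solve-∀
          le : fromℕ 3 * κ + (κ * c + (L + β * g (p₀ [ toℕ v ↦ suc (toℕ (color k)) ]) 1 + w k * a k))
               ≤ walkState (P - Q) (fromℕ d * x) (suc i) m
          le = subst (λ j → fromℕ 3 * κ + (κ * c + (L + β * g (p₀ [ toℕ v ↦ suc j ]) 1 + w k * a k)) ≤ walkState (P - Q)
              (fromℕ d * x) (suc i) m)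
            (sym (toℕ-color k<q))
                (0≤q-p⇒p≤q (subst (0ℚ ≤_) (trans (sym (lemma κ C c (w k) P Q (fromℕ d) x I (a k) R)) same)
                (0≤* (0≤w k) (0≤p² x))))
            where
            same : κ * (fromℕ 3 + c + C) + (w k * (square D + (1ℚ + I) * a k) + R)
                   - (fromℕ 3 * κ + (κ * c + (κ * C + (w k * (square (P - Q - (1ℚ + fromℕ d) * x) + I * a k) + R) +
                       fromℕ 2 * (w k * (P - Q - (1ℚ + fromℕ d) * x)) * x + w k * a k)))
                   ≡ walkState (P - Q) (fromℕ d * x) (suc i) m - (fromℕ 3 * κ + (κ * c + (L + β * x + w k * a k)))
            same = cong₂ _-_
              (cong₂ (λ A j → κ * A + (w k * (square D + j * a k) + R)) cost≡ (sym (fromℕ-+ 1 i)))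
              (cong (λ z → fromℕ 3 * κ +
                  (κ * c + (κ * C + (w k * (square (P - Q - z * x) + I * a k) + R) + fromℕ 2 * (w k * (P - Q - z * x)) *
                  x + w k * a k)))
                (sym (fromℕ-+ 1 d)))

        hue-bounded : ∀ m t → m Hue 0 ≡ suc k → Steady m → m Col ≗ p₀ →
                      Bounded t (main ∷ [] , m)
                          (κ * fromℕ (1 ℕ.+ suc k ℕ.* hueCost) + (future (suc k) + past m (suc k) len))
        hue-bounded m t hue≡ steady@(_ , _ , total≡ , _) col≗ = weaken (ℚ.≤-reflexive total)
          (path-bound (while-true {e = reg Hue} hue≡ ▷ straight 7 refl)
            (walks-bounded N 0 m₁ t refl total≡ hue≡ steady col≗))
          where
          m₁ : Memory
          m₁ = write (write (write m Plus 0 0) Minus 0 0) Walks 0 (m Total 0)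
          lemma : ∀ κ C w N a f x g →
              fromℕ 8 * κ + (κ * C + (w * ((0ℚ - 0ℚ - 0ℚ * g) * (0ℚ - 0ℚ - 0ℚ * g) + N * a) + (f + x))) ≡ κ *
              (fromℕ 8 + C) + (w * (N * a) + f + x)
          lemma = RingSolver.solve-∀ ℚ-ring
          rearrange : ∀ A B → 8 ℕ.+ (5 ℕ.+ A ℕ.+ B) ≡ 1 ℕ.+ (12 ℕ.+ B ℕ.+ A)
          rearrange = ℕ-Ring.solve-∀
          total : fromℕ 8 * κ + walkState (fromℕ 0 - fromℕ 0) (fromℕ 0 * g₁ k) N m₁ ≡ κ * fromℕ
              (1 ℕ.+ suc k ℕ.* hueCost) + (future (suc k) + past m (suc k) len)
          total = trans (lemma κ (fromℕ (endCost ℕ.+ N ℕ.* stepCost)) (w k) Nℚ (a k) (future k) (past m₁ (suc k) len)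
              (g₁ k))
            (cong₂ (λ z x → κ * z + (future (suc k) + x))
              (trans (sym (fromℕ-+ 8 (endCost ℕ.+ N ℕ.* stepCost)))
                  (cong fromℕ (rearrange (k ℕ.* hueCost) (N ℕ.* stepCost))))
              (past-cong {m} {m₁} (suc k) len λ _ _ → refl))

      main-bounded : ∀ k → HueBound k
      main-bounded zero len m t refl hue≡ (_ , _ , _ , _ , _ , _ , _ , den≡) col≗ =
          weaken (ℚ.≤-reflexive (lemma κ (past m 0 q)))
        (path-bound (while-false {e = reg Hue} hue≡) (halt-bound refl (final m den≡)))
        where
        lemma : ∀ κ x → 1ℚ * κ + x ≡ κ * 1ℚ + (0ℚ + x)
        lemma = RingSolver.solve-∀ ℚ-ring
      main-bounded (suc k) len m t k+len hue≡ steady col≗ = hue-bounded k len k+len (main-bounded k) m t hue≡ steady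
          col≗

open Estimates

module Initialization where

  open import Data.Nat using (_+_; _*_; _≤_; _<_)

  pattern Ctr  = 103
  pattern Res  = 104
  pattern Arg₁ = 105
  pattern Arg₂ = 106
  pattern Inv₁ = 28
  pattern Inv₂ = 29

  ceilStep ceilDiv mulStep multiply loadStep load invert₁ invert₂ scale repeat denominator algorithm : Stmt

  ceilStep = Ctr ≔ reg Ctr ⊖ reg Arg₁ ⨟ Res ≔ lit 1 ⊕ reg Res
  ceilDiv = Ctr ≔ reg Arg₂ ⨟ Res ≔ lit 0 ⨟ while (reg Ctr) ceilStep

  mulStep = Ctr ≔ reg Ctr ⊖ lit 1 ⨟ Res ≔ reg Res ⊕ reg Arg₂
  multiply = Ctr ≔ reg Arg₁ ⨟ Res ≔ lit 0 ⨟ while (reg Ctr) mulStep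

  loadStep = Ctr ≔ reg Ctr ⊖ lit 1 ⨟ assign Col (read 1 (reg Ctr)) (lit 1 ⊕ read 2 (reg Ctr))
  load = Ctr ≔ read 0 (lit 4) ⨟ while (reg Ctr) loadStep

  denominator = Arg₁ ≔ reg H4 ⨟ Arg₂ ≔ reg Total ⨟ multiply ⨟ assign Out (lit 0) (reg Res) ⨟ Hue ≔ read 0 (lit 2) ⨟ main

  repeat = Arg₁ ≔ reg Inv₁ ⨟ Arg₂ ≔ reg Inv₁ ⨟ multiply
         ⨟ Arg₁ ≔ reg Inv₂ ⨟ Arg₂ ≔ reg Res ⨟ multiply
         ⨟ Arg₁ ≔ read 0 (lit 2) ⨟ Arg₂ ≔ reg Res ⨟ multiply
         ⨟ Arg₁ ≔ lit 64 ⨟ Arg₂ ≔ reg Res ⨟ multiply ⨟ Total ≔ reg Res ⨟ denominator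

  scale = Arg₁ ≔ lit 16 ⨟ Arg₂ ≔ read 0 (lit 2) ⊖ lit 15 ⨟ ceilDiv
        ⨟ H1 ≔ reg Res ⨟ H2 ≔ reg H1 ⊕ reg H1 ⨟ H4 ≔ reg H2 ⊕ reg H2 ⨟ H16 ≔ (reg H4 ⊕ reg H4) ⊕ (reg H4 ⊕ reg H4) ⨟
            repeat

  invert₂ = Arg₁ ≔ read 0 (lit 7) ⨟ Arg₂ ≔ read 0 (lit 8) ⨟ ceilDiv ⨟ Inv₂ ≔ reg Res ⨟ scale

  invert₁ = Arg₁ ≔ read 0 (lit 5) ⨟ Arg₂ ≔ read 0 (lit 6) ⨟ ceilDiv ⨟ Inv₁ ≔ reg Res ⨟ invert₂

  algorithm = load ⨟ invert₁

  module Setup (O : Oracle) where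

    open Paths O

    agree-2 : ∀ {m} b c {i x j y} → ¬ T? (b ℕ.<ᵇ 100) → ¬ T? (c ℕ.<ᵇ 100) → Agree m (write (write m b i x) c j y)
    agree-2 {m} b c {i} {x} b≥ c≥ = agree-trans {m} {write m b i x} (agree-write m b b≥)
        (agree-write (write m b i x) c c≥)

    ceil-loop : ∀ fuel d e m {ss} → d ≤ fuel → m Ctr 0 ≡ d → m Arg₁ 0 ≡ suc e →
                ∃₂ λ r m′ → (while (reg Ctr) ceilStep ∷ ss , m) ⇒[ 1 + r * 4 ] (ss , m′) × Agree m m′ ×
                  m′ Res 0 ≡ r + m Res 0 × d ≤ r * suc e × r * suc e ≤ d + e
    ceil-loop fuel zero e m d≤ ctr≡ arg≡ = 0 , m , while-false {e = reg Ctr} ctr≡ , agree-refl {m} , refl , z≤n , z≤n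
    ceil-loop (suc fuel) (suc d) e m (s≤s d≤) ctr≡ arg≡ =
      let r , m′ , path , agree , res≡ , lower , upper = ceil-loop fuel (d ∸ e) e
            (write (write m Ctr 0 (m Ctr 0 ∸ m Arg₁ 0)) Res 0 (suc (m Res 0)))
            (ℕ.≤-trans (ℕ.m∸n≤m d e) d≤) (cong₂ _∸_ ctr≡ arg≡) arg≡
      in suc r , m′ , while-true {e = reg Ctr} ctr≡ ▷ straight 3 refl ▷ path ,
         agree-trans {m} (agree-2 {m} Ctr Res (λ ()) (λ ())) agree ,
         trans res≡ (ℕ.+-suc r (m Res 0)) ,
         s≤s (ℕ.≤-trans (ℕ.≤-trans (ℕ.m≤n+m∸n d e) (ℕ.+-monoʳ-≤ e lower)) ℕ.≤-refl) ,
         bound r upper (ℕ.≤-total d e)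
      where
      bound : ∀ r → r * suc e ≤ d ∸ e + e → d ≤ e ⊎ e ≤ d → suc r * suc e ≤ suc d + e
      bound r upper (inj₂ e≤d) = s≤s (ℕ.≤-trans (ℕ.+-monoʳ-≤ e (subst (r * suc e ≤_) (ℕ.m∸n+n≡m e≤d) upper))
          (ℕ.≤-reflexive (ℕ.+-comm e d)))
      bound zero    upper (inj₁ d≤e) = s≤s (ℕ.≤-trans (ℕ.≤-reflexive (ℕ.+-identityʳ e)) (ℕ.m≤n+m e d))
      bound (suc r) upper (inj₁ d≤e) = ⊥-elim (ℕ.<-irrefl refl (ℕ.≤-trans (ℕ.m≤m+n (suc e) (r * suc e))
        (subst (λ z → suc r * suc e ≤ z + e) (ℕ.m≤n⇒m∸n≡0 d≤e) upper)))

    ceil-path : ∀ m d e {ss} → m Arg₂ 0 ≡ d → m Arg₁ 0 ≡ suc e →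
                ∃₂ λ r m′ → (ceilDiv ∷ ss , m) ⇒[ 5 + r * 4 ] (ss , m′) × Agree m m′ ×
                  m′ Res 0 ≡ r × d ≤ r * suc e × r * suc e ≤ d + e
    ceil-path m d e d≡ e≡ =
      let r , m′ , path , agree , res≡ , bounds = ceil-loop d d e (write (write m Ctr 0 (m Arg₂ 0)) Res 0 0) ℕ.≤-refl d≡ e≡
      in r , m′ , straight 4 refl ▷ path , agree-trans {m} (agree-2 {m} Ctr Res (λ ()) (λ ())) agree ,
          trans res≡ (ℕ.+-identityʳ r) , bounds

    multiply-loop : ∀ k b m {ss} → m Ctr 0 ≡ k → m Arg₂ 0 ≡ b →
                    ∃ λ m′ → (while (reg Ctr) mulStep ∷ ss , m) ⇒[ 1 + k * 4 ] (ss , m′) × Agree m m′ × m′ Res 0 ≡ m Res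
                        0 + k * b
    multiply-loop zero    b m ctr≡ b≡ = m , while-false {e = reg Ctr} ctr≡ , agree-refl {m} ,
        sym (ℕ.+-identityʳ (m Res 0))
    multiply-loop (suc k) b m ctr≡ b≡ =
      let m′ , path , agree , res≡ = multiply-loop k b (write (write m Ctr 0 (m Ctr 0 ∸ 1)) Res 0 (m Res 0 + m Arg₂ 0)) (cong (_∸ 1) ctr≡) b≡
      in m′ , while-true {e = reg Ctr} ctr≡ ▷ straight 3 refl ▷ path ,
          agree-trans {m} (agree-2 {m} Ctr Res (λ ()) (λ ())) agree ,
         trans res≡ (trans (cong (λ z → m Res 0 + z + k * b) b≡) (ℕ.+-assoc (m Res 0) b (k * b)))

    multiply-path : ∀ m k b {ss} → m Arg₁ 0 ≡ k → m Arg₂ 0 ≡ b →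
                    ∃ λ m′ → (multiply ∷ ss , m) ⇒[ 5 + k * 4 ] (ss , m′) × Agree m m′ × m′ Res 0 ≡ k * b
    multiply-path m k b k≡ b≡ =
      let m′ , path , agree , res≡ = multiply-loop k b (write (write m Ctr 0 (m Arg₁ 0)) Res 0 0) k≡ b≡
      in m′ , straight 4 refl ▷ path , agree-trans {m} (agree-2 {m} Ctr Res (λ ()) (λ ())) agree , res≡

    loaded : (V A : ℕ → ℕ) → ℕ → (ℕ → ℕ) → ℕ → ℕ
    loaded V A zero    p = p
    loaded V A (suc i) p = loaded V A i (p [ V i ↦ suc (A i) ])

    load-loop : ∀ i m {ss} → m Ctr 0 ≡ i →
                ∃ λ m′ → (while (reg Ctr) loadStep ∷ ss , m) ⇒[ 1 + i * 4 ] (ss , m′) × m′ 0 ≡ m 0 × m′ Col ≡ loaded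
                    (m 1) (m 2) i (m Col)
    load-loop zero    m ctr≡ = m , while-false {e = reg Ctr} ctr≡ , refl , refl
    load-loop (suc i) m ctr≡ =
      let m₁ = write m Ctr 0 (m Ctr 0 ∸ 1)
          m′ , path , in≡ , col≡ = load-loop i (write m₁ Col (m 1 (m Ctr 0 ∸ 1)) (suc (m 2 (m Ctr 0 ∸ 1))))
              (cong (_∸ 1) ctr≡)
      in m′ , while-true {e = reg Ctr} ctr≡ ▷ straight 3 refl ▷ path , in≡ ,
         trans col≡ (cong (λ j → loaded (m 1) (m 2) i (m Col [ m 1 j ↦ suc (m 2 j) ])) (cong (_∸ 1) ctr≡))

    loaded-other : ∀ V A i p j → (∀ k → k < i → V k ≢ j) → loaded V A i p j ≡ p j
    loaded-other V A zero    p j other = refl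
    loaded-other V A (suc i) p j other = trans (loaded-other V A i _ j (λ k k<i → other k (ℕ.m<n⇒m<1+n k<i)))
      (↦-other p (suc (A i)) (λ eq → other i ℕ.≤-refl (sym eq)))

    loaded-at : ∀ V A i p → (∀ k k′ → k < k′ → k′ < i → V k ≢ V k′) → ∀ k → k < i → loaded V A i p (V k) ≡ suc (A k)
    loaded-at V A (suc i) p distinct k k<1+i with ℕ.m≤n⇒m<n∨m≡n (s≤s⁻¹ k<1+i)
    ... | inj₁ k<i  = loaded-at V A i _ (λ k k′ k<k′ k′<i → distinct k k′ k<k′ (ℕ.m<n⇒m<1+n k′<i)) k k<i
    ... | inj₂ refl = trans (loaded-other V A i _ (V i) (λ k k<i → distinct k i k<i ℕ.≤-refl))
        (↦-same p (V i) (suc (A i)))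

    load-path : ∀ m → ∃ λ m′ → (algorithm ∷ [] , m) ⇒[ 4 + m 0 4 * 4 ] (invert₁ ∷ [] , m′) ×
                  m′ 0 ≡ m 0 × m′ Col ≡ loaded (m 1) (m 2) (m 0 4) (m Col)
    load-path m = let m′ , path , facts = load-loop (m 0 4) (write m Ctr 0 (m 0 4)) refl in m′ , straight 3 refl ▷ path , facts

    invert₁-path : ∀ m d e → m 0 6 ≡ d → m 0 5 ≡ suc e →
                   ∃₂ λ r m′ → (invert₁ ∷ [] , m) ⇒[ 12 + r * 4 ] (invert₂ ∷ [] , m′) ×
                     (m′ 0 ≡ m 0 × m′ Col ≡ m Col × m′ Inv₁ 0 ≡ r) × d ≤ r * suc e × r * suc e ≤ d + e
    invert₁-path m d e d≡ e≡ =
      let m₁ = write (write m Arg₁ 0 (m 0 5)) Arg₂ 0 (m 0 6)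
          r , m′ , path , ag , res , bounds = ceil-path m₁ d e d≡ e≡
      in r , write m′ Inv₁ 0 (m′ Res 0) ,
         subst (λ k → (invert₁ ∷ [] , m) ⇒[ k ] (invert₂ ∷ [] , write m′ Inv₁ 0 (m′ Res 0))) (cost r) (straight 5 refl ▷
             path ▷ straight 2 refl) ,
         (ag 0 tt , ag Col tt , res) , bounds
      where
      cost : ∀ r → 5 + (5 + r * 4 + 2) ≡ 12 + r * 4
      cost = ℕ-Ring.solve-∀

    invert₂-path : ∀ m d e → m 0 8 ≡ d → m 0 7 ≡ suc e →
                   ∃₂ λ r m′ → (invert₂ ∷ [] , m) ⇒[ 12 + r * 4 ] (scale ∷ [] , m′) ×
                     (m′ 0 ≡ m 0 × m′ Col ≡ m Col × m′ Inv₁ ≡ m Inv₁ × m′ Inv₂ 0 ≡ r) × d ≤ r * suc e × r * suc e ≤ d +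
                         e
    invert₂-path m d e d≡ e≡ =
      let m₁ = write (write m Arg₁ 0 (m 0 7)) Arg₂ 0 (m 0 8)
          r , m′ , path , ag , res , bounds = ceil-path m₁ d e d≡ e≡
      in r , write m′ Inv₂ 0 (m′ Res 0) ,
         subst (λ k → (invert₂ ∷ [] , m) ⇒[ k ] (scale ∷ [] , write m′ Inv₂ 0 (m′ Res 0))) (cost r) (straight 5 refl ▷
             path ▷ straight 2 refl) ,
         (ag 0 tt , ag Col tt , ag Inv₁ tt , res) , bounds
      where
      cost : ∀ r → 5 + (5 + r * 4 + 2) ≡ 12 + r * 4
      cost = ℕ-Ring.solve-∀

    scale-path : ∀ m q → m 0 2 ≡ q →
                 ∃₂ λ h m′ → (scale ∷ [] , m) ⇒[ 18 + h * 4 ] (repeat ∷ [] , m′) ×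
                   (m′ 0 ≡ m 0 × m′ Col ≡ m Col × m′ Inv₁ ≡ m Inv₁ × m′ Inv₂ ≡ m Inv₂) ×
                   (m′ H1 0 ≡ h × m′ H2 0 ≡ 2 * h × m′ H4 0 ≡ 4 * h × m′ H16 0 ≡ 16 * h) ×
                   q ∸ 15 ≤ h * 16 × h * 16 ≤ q ∸ 15 + 15
    scale-path m q q≡ =
      let m₁ = write (write m Arg₁ 0 16) Arg₂ 0 (m 0 2 ∸ 15)
          h , m₂ , path , ag , res , bounds = ceil-path m₁ (q ∸ 15) 15 (cong (_∸ 15) q≡) refl
          m₃ = write (write m₂ H1 0 (m₂ Res 0)) H2 0 (m₂ Res 0 + m₂ Res 0)
          m₄ = write m₃ H4 0 (m₃ H2 0 + m₃ H2 0)
          m′ = write m₄ H16 0 ((m₄ H4 0 + m₄ H4 0) + (m₄ H4 0 + m₄ H4 0))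
      in h , m′ , subst (λ k → (scale ∷ [] , m) ⇒[ k ] (repeat ∷ [] , m′)) (cost h) (straight 5 refl ▷ path ▷
          straight 8 refl) ,
         (ag 0 tt , ag Col tt , ag Inv₁ tt , ag Inv₂ tt) , (res , doubled res , quadrupled res , sixteen res) , bounds
      where
      cost : ∀ h → 5 + (5 + h * 4 + 8) ≡ 18 + h * 4
      cost = ℕ-Ring.solve-∀
      doubled : ∀ {d h} → d ≡ h → d + d ≡ 2 * h
      doubled {d} refl = lemma d
        where
        lemma : ∀ d → d + d ≡ 2 * d
        lemma = ℕ-Ring.solve-∀
      quadrupled : ∀ {d h} → d ≡ h → (d + d) + (d + d) ≡ 4 * h
      quadrupled {d} refl = lemma d
        where
        lemma : ∀ d → (d + d) + (d + d) ≡ 4 * d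
        lemma = ℕ-Ring.solve-∀
      sixteen : ∀ {d h} → d ≡ h → let a = (d + d) + (d + d) in (a + a) + (a + a) ≡ 16 * h
      sixteen {d} refl = lemma d
        where
        lemma : ∀ d → let a = (d + d) + (d + d) in (a + a) + (a + a) ≡ 16 * d
        lemma = ℕ-Ring.solve-∀

    Kept : Memory → Memory → Set
    Kept m m′ = m′ 0 ≡ m 0 × m′ Col ≡ m Col × m′ H1 ≡ m H1 × m′ H2 ≡ m H2 × m′ H4 ≡ m H4 × m′ H16 ≡ m H16

    kept-agree : ∀ {m m′} → Agree m m′ → Kept m m′
    kept-agree ag = ag 0 tt , ag Col tt , ag H1 tt , ag H2 tt , ag H4 tt , ag H16 tt

    load-args : Memory → ℕ → ℕ → Memory
    load-args m x y = write (write m Arg₁ 0 x) Arg₂ 0 y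

    multiply-args : ∀ m x y k b {ss} → x ≡ k → y ≡ b →
                    ∃ λ m′ → (multiply ∷ ss , load-args m x y) ⇒[ 5 + k * 4 ] (ss , m′) × Agree m m′ × m′ Res 0 ≡ k * b
    multiply-args m x y k b x≡ y≡ = let m′ , path , ag , res = multiply-path (load-args m x y) k b x≡ y≡ in
      m′ , path , agree-trans {m} (agree-2 {m} Arg₁ Arg₂ (λ ()) (λ ())) ag , res

    repeat-path : ∀ m q r₁ r₂ → m 0 2 ≡ q → m Inv₁ 0 ≡ r₁ → m Inv₂ 0 ≡ r₂ →
                  ∃ λ m′ → (repeat ∷ [] , m) ⇒[ 298 + (r₁ * 4 + (r₂ * 4 + q * 4)) ] (denominator ∷ [] , m′) ×
                    Kept m m′ × m′ Total 0 ≡ 64 * (q * (r₂ * (r₁ * r₁)))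
    repeat-path m q r₁ r₂ q≡ r₁≡ r₂≡ =
      first (multiply-args m (m Inv₁ 0) (m Inv₁ 0) r₁ r₁ r₁≡ r₁≡)
      where
      Goal : Set
      Goal = ∃ λ m′ → (repeat ∷ [] , m) ⇒[ 298 + (r₁ * 4 + (r₂ * 4 + q * 4)) ] (denominator ∷ [] , m′) ×
               Kept m m′ × m′ Total 0 ≡ 64 * (q * (r₂ * (r₁ * r₁)))
      cost : ∀ r₁ r₂ q → 5 + ((5 + r₁ * 4) + (5 + ((5 + r₂ * 4) + (5 + ((5 + q * 4) + (5 + (261 + 2))))))) ≡ 298 +
          (r₁ * 4 + (r₂ * 4 + q * 4))
      cost = ℕ-Ring.solve-∀
      s₁ s₂ s₃ : Stmt
      s₃ = Arg₁ ≔ lit 64 ⨟ Arg₂ ≔ reg Res ⨟ multiply ⨟ Total ≔ reg Res ⨟ denominator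
      s₂ = Arg₁ ≔ read 0 (lit 2) ⨟ Arg₂ ≔ reg Res ⨟ multiply ⨟ s₃
      s₁ = Arg₁ ≔ reg Inv₂ ⨟ Arg₂ ≔ reg Res ⨟ multiply ⨟ s₂
      fourth : ∀ {g} → (repeat ∷ [] , m) ⇒[ 5 + ((5 + r₁ * 4) + (5 + ((5 + r₂ * 4) + (5 + (5 + q * 4))))) ] (s₃ ∷ [] ,
          g) → Agree m g →
               (∃ λ i → (multiply ∷ (Total ≔ reg Res ⨟ denominator) ∷ [] , load-args g 64 (g Res 0)) ⇒[ 5 + 64 * 4 ]
                   ((Total ≔ reg Res ⨟ denominator) ∷ [] , i) × Agree g i ×
                 i Res 0 ≡ 64 * (q * (r₂ * (r₁ * r₁)))) → Goal
      fourth {g} p ag (i , path , ag′ , res) = write i Total 0 (i Res 0) ,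
        subst (λ k → (repeat ∷ [] , m) ⇒[ k ] (denominator ∷ [] , write i Total 0 (i Res 0)))
          (trans (reassociate (r₁ * 4) (r₂ * 4) (q * 4)) (cost r₁ r₂ q)) (p ▷ straight 5 refl ▷ path ▷ straight 2 refl)
              ,
        kept-agree {m} {i} (agree-trans {m} ag ag′) , res
        where
        reassociate : ∀ a b c → 5 + ((5 + a) + (5 + ((5 + b) + (5 + (5 + c))))) + (5 + (261 + 2)) ≡ 5 +
            ((5 + a) + (5 + ((5 + b) + (5 + ((5 + c) + (5 + (261 + 2)))))))
        reassociate = ℕ-Ring.solve-∀
      third : ∀ {f} → (repeat ∷ [] , m) ⇒[ 5 + ((5 + r₁ * 4) + (5 + (5 + r₂ * 4))) ] (s₂ ∷ [] , f) → Agree m f →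
              (∃ λ g → (multiply ∷ s₃ ∷ [] , load-args f (f 0 2) (f Res 0)) ⇒[ 5 + q * 4 ] (s₃ ∷ [] , g) × Agree f g × g
                  Res 0 ≡ q * (r₂ * (r₁ * r₁))) → Goal
      third {f} p ag (g , path , ag′ , res) =
        fourth {g} (subst (λ k → (repeat ∷ [] , m) ⇒[ k ] (s₃ ∷ [] , g)) (reassociate (r₁ * 4) (r₂ * 4) (q * 4))
            (p ▷ straight 5 refl ▷ path)) (agree-trans {m} ag ag′)
          (multiply-args g 64 (g Res 0) 64 _ refl res)
        where
        reassociate : ∀ a b c → 5 + ((5 + a) + (5 + (5 + b))) + (5 + (5 + c)) ≡ 5 +
            ((5 + a) + (5 + ((5 + b) + (5 + (5 + c)))))
        reassociate = ℕ-Ring.solve-∀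
      second : ∀ {e} → (repeat ∷ [] , m) ⇒[ 5 + (5 + r₁ * 4) ] (s₁ ∷ [] , e) → Agree m e →
               (∃ λ f → (multiply ∷ s₂ ∷ [] , load-args e (e Inv₂ 0) (e Res 0)) ⇒[ 5 + r₂ * 4 ] (s₂ ∷ [] , f) × Agree e
                   f × f Res 0 ≡ r₂ * (r₁ * r₁)) → Goal
      second {e} p ag (f , path , ag′ , res) =
        third {f} (subst (λ k → (repeat ∷ [] , m) ⇒[ k ] (s₂ ∷ [] , f)) (reassociate (r₁ * 4) (r₂ * 4))
            (p ▷ straight 5 refl ▷ path)) (agree-trans {m} ag ag′)
          (multiply-args f (f 0 2) (f Res 0) q _ (trans (at (agree-trans {m} ag ag′ 0 tt) 2) q≡) res)
        where
        reassociate : ∀ a b → 5 + (5 + a) + (5 + (5 + b)) ≡ 5 + ((5 + a) + (5 + (5 + b)))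
        reassociate = ℕ-Ring.solve-∀
      first : (∃ λ e → (multiply ∷ s₁ ∷ [] , load-args m (m Inv₁ 0) (m Inv₁ 0)) ⇒[ 5 + r₁ * 4 ] (s₁ ∷ [] , e) × Agree m
          e × e Res 0 ≡ r₁ * r₁) → Goal
      first (e , path , ag , res) = second {e} (straight 5 refl ▷ path) ag
        (multiply-args e (e Inv₂ 0) (e Res 0) r₂ _ (trans (at (ag Inv₂ tt) 0) r₂≡) res)

    denominator-path : ∀ m x N q → m 0 2 ≡ q → m H4 0 ≡ x → m Total 0 ≡ N →
                       ∃ λ m′ → (denominator ∷ [] , m) ⇒[ 14 + x * 4 ] (main ∷ [] , m′) ×
                         Kept m m′ × m′ Total 0 ≡ N × m′ Out 0 ≡ x * N × m′ Hue 0 ≡ q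
    denominator-path m x N q q≡ x≡ N≡ =
      let m₁ , path , ag , res = multiply-args m (m H4 0) (m Total 0) x N x≡ N≡
          m′ = write (write m₁ Out 0 (m₁ Res 0)) Hue 0 (m₁ 0 2)
      in m′ , subst (λ k → (denominator ∷ [] , m) ⇒[ k ] (main ∷ [] , m′)) (cost x) (straight 5 refl ▷ path ▷
          straight 4 refl) ,
         kept-agree {m} {m₁} ag , trans (at (ag Total tt) 0) N≡ , res , trans (at (ag 0 tt) 2) q≡
      where
      cost : ∀ x → 5 + (5 + x * 4 + 4) ≡ 14 + x * 4
      cost = ℕ-Ring.solve-∀

    record Prepared (m₀ m : Memory) (q r₁ r₂ h : ℕ) : Set where
      field
        input≡ : m 0 ≡ m₀ 0
        col≡   : m Col ≡ loaded (m₀ 1) (m₀ 2) (m₀ 0 4) (m₀ Col)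
        hue≡   : m Hue 0 ≡ q
        h≡     : m H1 0 ≡ h
        2h≡    : m H2 0 ≡ 2 * h
        4h≡    : m H4 0 ≡ 4 * h
        16h≡   : m H16 0 ≡ 16 * h
        total≡ : m Total 0 ≡ 64 * (q * (r₂ * (r₁ * r₁)))
        den≡   : m Out 0 ≡ 4 * h * (64 * (q * (r₂ * (r₁ * r₁))))

    setupCost : (l r₁ r₂ h q : ℕ) → ℕ
    setupCost l r₁ r₂ h q = 358 + (l * 4 + (r₁ * 8 + (r₂ * 8 + (h * 20 + q * 4))))

    record Preparation (m₀ : Memory) (q ε₁ ε₂ δ₁ δ₂ : ℕ) : Set where
      field
        {r₁ r₂ h} : ℕ
        {memory}  : Memory
        path      : (algorithm ∷ [] , m₀) ⇒[ setupCost (m₀ 0 4) r₁ r₂ h q ] (main ∷ [] , memory)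
        prepared  : Prepared m₀ memory q r₁ r₂ h
        ε-lower   : ε₂ ≤ r₁ * suc ε₁
        ε-upper   : r₁ * suc ε₁ ≤ ε₂ + ε₁
        δ-lower   : δ₂ ≤ r₂ * suc δ₁
        δ-upper   : r₂ * suc δ₁ ≤ δ₂ + δ₁
        h-lower   : q ∸ 15 ≤ h * 16
        h-upper   : h * 16 ≤ q ∸ 15 + 15

    prepare : ∀ m₀ q ε₁ ε₂ δ₁ δ₂ → m₀ 0 2 ≡ q → m₀ 0 5 ≡ suc ε₁ → m₀ 0 6 ≡ ε₂ → m₀ 0 7 ≡ suc δ₁ → m₀ 0 8 ≡ δ₂ →
              Preparation m₀ q ε₁ ε₂ δ₁ δ₂
    prepare m₀ q ε₁ ε₂ δ₁ δ₂ q≡ ε₁≡ ε₂≡ δ₁≡ δ₂≡ =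
      let a , pa , ain , acol = load-path m₀ in invert a pa ain acol
      where
      Goal : Set
      Goal = Preparation m₀ q ε₁ ε₂ δ₁ δ₂
      start : Config
      start = algorithm ∷ [] , m₀
      module _ (a : Memory) {k : ℕ} (pa : start ⇒[ k ] (invert₁ ∷ [] , a)) (k≡ : k ≡ 4 + m₀ 0 4 * 4) (ain : a 0 ≡ m₀ 0)
               (acol : a Col ≡ loaded (m₀ 1) (m₀ 2) (m₀ 0 4) (m₀ Col))
               (r₁ : ℕ) (b : Memory) (pb : (invert₁ ∷ [] , a) ⇒[ 12 + r₁ * 4 ] (invert₂ ∷ [] , b)) (bin : b 0 ≡ a 0)
                   (bcol : b Col ≡ a Col)
               (binv : b Inv₁ 0 ≡ r₁) (ε-lower : ε₂ ≤ r₁ * suc ε₁) (ε-upper : r₁ * suc ε₁ ≤ ε₂ + ε₁) where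

        module _ (r₂ : ℕ) (c : Memory) (pc : (invert₂ ∷ [] , b) ⇒[ 12 + r₂ * 4 ] (scale ∷ [] , c)) (cin : c 0 ≡ b 0) (ccol : c Col ≡ b Col)
                 (cinv₁ : c Inv₁ ≡ b Inv₁) (cinv₂ : c Inv₂ 0 ≡ r₂) (δ-lower : δ₂ ≤ r₂ * suc δ₁)
                     (δ-upper : r₂ * suc δ₁ ≤ δ₂ + δ₁)
                 (h : ℕ) (d : Memory) (pd : (scale ∷ [] , c) ⇒[ 18 + h * 4 ] (repeat ∷ [] , d)) (din : d 0 ≡ c 0)
                     (dcol : d Col ≡ c Col)
                 (dinv₁ : d Inv₁ ≡ c Inv₁) (dinv₂ : d Inv₂ ≡ c Inv₂)
                 (h≡ : d H1 0 ≡ h) (2h≡ : d H2 0 ≡ 2 * h) (4h≡ : d H4 0 ≡ 4 * h) (16h≡ : d H16 0 ≡ 16 * h)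
                 (h-lower : q ∸ 15 ≤ h * 16) (h-upper : h * 16 ≤ q ∸ 15 + 15) where

          d-in : d 0 ≡ m₀ 0
          d-in = trans din (trans cin (trans bin ain))

          assemble : ∀ e → (repeat ∷ [] , d) ⇒[ 298 + (r₁ * 4 + (r₂ * 4 + q * 4)) ] (denominator ∷ [] , e) → Kept d e →
                   e Total 0 ≡ 64 * (q * (r₂ * (r₁ * r₁))) →
                   (∃ λ m → (denominator ∷ [] , e) ⇒[ 14 + 4 * h * 4 ] (main ∷ [] , m) × Kept e m ×
                      m Total 0 ≡ 64 * (q * (r₂ * (r₁ * r₁))) × m Out 0 ≡ 4 * h * (64 * (q * (r₂ * (r₁ * r₁)))) × m Hue
                          0 ≡ q) → Goal
          assemble e pe (ein , ecol , e1 , e2 , e4 , e16) etotal (m , pm , (min , mcol , m1 , m2 , m4 , m16) , mtotal ,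
              mout , mhue) = record
            { r₁ = r₁ ; r₂ = r₂ ; h = h ; memory = m
            ; path = subst (λ k → start ⇒[ k ] (main ∷ [] , m)) (trans (cong (_+ _) k≡) (cost (m₀ 0 4) r₁ r₂ h q))
                (pa ▷ pb ▷ pc ▷ pd ▷ pe ▷ pm)
            ; prepared = record
              { input≡ = trans min (trans ein d-in)
              ; col≡   = trans mcol (trans ecol (trans dcol (trans ccol (trans bcol acol))))
              ; hue≡   = mhue
              ; h≡     = trans (at (trans m1 e1) 0) h≡
              ; 2h≡    = trans (at (trans m2 e2) 0) 2h≡
              ; 4h≡    = trans (at (trans m4 e4) 0) 4h≡
              ; 16h≡   = trans (at (trans m16 e16) 0) 16h≡
              ; total≡ = mtotal
              ; den≡   = mout
              }
            ; ε-lower = ε-lower ; ε-upper = ε-upper ; δ-lower = δ-lower ; δ-upper = δ-upper ; h-lower =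
                h-lower ; h-upper = h-upper
            }
            where
            cost : ∀ l r₁ r₂ h q →
                4 + l * 4 + ((12 + r₁ * 4) +
                ((12 + r₂ * 4) + ((18 + h * 4) + ((298 + (r₁ * 4 + (r₂ * 4 + q * 4))) + (14 + 4 * h * 4)))))
                   ≡ 358 + (l * 4 + (r₁ * 8 + (r₂ * 8 + (h * 20 + q * 4))))
            cost = ℕ-Ring.solve-∀

          repeating : (∃ λ e → (repeat ∷ [] , d) ⇒[ 298 + (r₁ * 4 + (r₂ * 4 + q * 4)) ] (denominator ∷ [] , e) × Kept d
              e ×
                        e Total 0 ≡ 64 * (q * (r₂ * (r₁ * r₁)))) → Goal
          repeating (e , pe , kept@(ein , _ , _ , _ , e4 , _) , etotal) = assemble e pe kept etotal
            (denominator-path e (4 * h) _ q (trans (at (trans ein d-in) 2) q≡) (trans (at e4 0) 4h≡) etotal)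

          prepared-goal : Goal
          prepared-goal = repeating (repeat-path d q r₁ r₂ (trans (at d-in 2) q≡)
              (trans (at dinv₁ 0) (trans (at cinv₁ 0) binv)) (trans (at dinv₂ 0) cinv₂))

        scaling : (∃₂ λ r₂ c → (invert₂ ∷ [] , b) ⇒[ 12 + r₂ * 4 ] (scale ∷ [] , c) ×
                    (c 0 ≡ b 0 × c Col ≡ b Col × c Inv₁ ≡ b Inv₁ × c Inv₂ 0 ≡ r₂) × δ₂ ≤ r₂ * suc δ₁ × r₂ * suc δ₁ ≤ δ₂
                        + δ₁) → Goal
        scaling (r₂ , c , pc , (cin , ccol , cinv₁ , cinv₂) , lower , upper) =
          let h , d , pd , (din , dcol , dinv₁ , dinv₂) , (h≡ , 2h≡ , 4h≡ , 16h≡) , h-lower , h-upper =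
                scale-path c q (trans (at (trans cin (trans bin ain)) 2) q≡)
          in prepared-goal r₂ c pc cin ccol cinv₁ cinv₂ lower upper h d pd din dcol dinv₁ dinv₂ h≡ 2h≡ 4h≡ 16h≡ h-lower
              h-upper

      invert : ∀ a → start ⇒[ 4 + m₀ 0 4 * 4 ] (invert₁ ∷ [] , a) → a 0 ≡ m₀ 0 → a Col ≡ loaded (m₀ 1) (m₀ 2) (m₀ 0 4)
          (m₀ Col) → Goal
      invert a pa ain acol =
        let r₁ , b , pb , (bin , bcol , binv) , lower , upper = invert₁-path a ε₂ ε₁ (trans (at ain 6) ε₂≡) (trans (at ain 5) ε₁≡)
        in scaling a pa refl ain acol r₁ b pb bin bcol binv lower upper
             (invert₂-path b δ₂ δ₁ (trans (at (trans bin ain) 8) δ₂≡) (trans (at (trans bin ain) 7) δ₁≡))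

open Initialization

module Arithmetic where

  open import Data.Rational using (_+_; _*_; _-_; -_; _≤_; _<_)

  entry-∈ : ∀ {A : Set} (f g : A → ℕ) {x xs} → x ∈ xs → ∃ λ k → k ℕ.< length xs × entry (map f xs) k ≡ f x × entry
      (map g xs) k ≡ g x
  entry-∈ f g (here refl) = 0 , z<s , refl , refl
  entry-∈ f g (there x∈)  = let k , k< , eqs = entry-∈ f g x∈ in suc k , s<s k< , eqs

  entry-index : ∀ {A : Set} (f : A → ℕ) xs k → k ℕ.< length xs → ∃ λ x → x ∈ xs × entry (map f xs) k ≡ f x
  entry-index f (x ∷ xs) zero    _        = x , here refl , refl
  entry-index f (x ∷ xs) (suc k) (s≤s k<) = let y , y∈ , eq = entry-index f xs k k< in y , there y∈ , eq

  entry-distinct : ∀ {n} {B : Set} (es : List (Fin n × B)) → Unique (map proj₁ es) → ∀ k k′ → k ℕ.< k′ →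
      k′ ℕ.< length es →
                   entry (map (toℕ ∘ proj₁) es) k ≢ entry (map (toℕ ∘ proj₁) es) k′
  entry-distinct (e ∷ es) (e∉ ∷ uniq) zero    (suc k′) _         (s≤s k′<) eq =
    let e′ , e′∈ , eq′ = entry-index (toℕ ∘ proj₁) es k′ k′< in
    All.lookup e∉ (∈-map⁺ proj₁ e′∈) (Fin.toℕ-injective (trans eq eq′))
  entry-distinct (e ∷ es) (e∉ ∷ uniq) (suc k) (suc k′) (s≤s k<k′) (s≤s k′<) eq = entry-distinct es uniq k k′ k<k′ k′< eq

  ceiling-bounds : ∀ {ε e} r → 0ℚ < ε → ε < 1ℚ → ε * e ≡ 1ℚ → 0ℚ ≤ e → ↧ₙ ε ℕ.≤ r ℕ.* ℤ.∣ ↥ ε ∣ →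
      r ℕ.* ℤ.∣ ↥ ε ∣ ℕ.≤ ↧ₙ ε ℕ.+ ℤ.∣ ↥ ε ∣ →
                   1ℚ ≤ fromℕ r * ε × fromℕ r ≤ fromℕ 2 * e
  ceiling-bounds {ε} {e} r 0<ε ε<1 εe≡1 0≤e lower upper = 1≤rε , r≤2e
    where
    open ℚ.≤-Reasoning
    d R : ℚ
    d = fromℕ (↧ₙ ε)
    R = fromℕ r
    0<d : 0ℚ < d
    0<d = 0<fromℕ {↧ₙ ε} z<s
    num : d * ε ≡ fromℕ ℤ.∣ ↥ ε ∣
    num = ↧*p≡↥p (ℚ.<⇒≤ 0<ε)
    r*num : fromℕ (r ℕ.* ℤ.∣ ↥ ε ∣) ≡ d * (R * ε)
    r*num = trans (fromℕ-* r ℤ.∣ ↥ ε ∣) (trans (cong (R *_) (sym num)) (lemma R d ε))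
      where
      lemma : ∀ r d e → r * (d * e) ≡ d * (r * e)
      lemma = RingSolver.solve-∀ ℚ-ring
    1≤rε : 1ℚ ≤ R * ε
    1≤rε = *-cancelˡ-≤ 0<d (begin
      d * 1ℚ                        ≡⟨ ℚ.*-identityʳ d ⟩
      d                             ≤⟨ fromℕ-mono lower ⟩
      fromℕ (r ℕ.* ℤ.∣ ↥ ε ∣)       ≡⟨ r*num ⟩
      d * (R * ε)                   ∎)
    rε≤2 : R * ε ≤ fromℕ 2
    rε≤2 = *-cancelˡ-≤ 0<d (begin
      d * (R * ε)                   ≡⟨ r*num ⟨
      fromℕ (r ℕ.* ℤ.∣ ↥ ε ∣)       ≤⟨ fromℕ-mono upper ⟩
      fromℕ (↧ₙ ε ℕ.+ ℤ.∣ ↥ ε ∣)    ≡⟨ trans (fromℕ-+ (↧ₙ ε) ℤ.∣ ↥ ε ∣) (cong (d +_) (sym num)) ⟩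
      d + d * ε                     ≤⟨ ℚ.+-monoʳ-≤ d (*-monoˡ {d} {ε} {1ℚ} (ℚ.<⇒≤ 0<d) (ℚ.<⇒≤ ε<1)) ⟩
      d + d * 1ℚ                    ≡⟨ lemma d ⟩
      d * fromℕ 2                   ∎)
      where
      lemma : ∀ d → d + d * 1ℚ ≡ d * fromℕ 2
      lemma = RingSolver.solve-∀ ℚ-ring
    r≤2e : R ≤ fromℕ 2 * e
    r≤2e = begin
      R              ≡⟨ ℚ.*-identityʳ R ⟨
      R * 1ℚ         ≡⟨ cong (R *_) εe≡1 ⟨
      R * (ε * e)    ≡⟨ ℚ.*-assoc R ε e ⟨
      R * ε * e      ≤⟨ *-monoʳ {e} {R * ε} {fromℕ 2} 0≤e rε≤2 ⟩
      fromℕ 2 * e    ∎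

  totalCost : (Δ q l r₁ r₂ h : ℕ) → ℕ
  totalCost Δ q l r₁ r₂ h = (358 ℕ.+ (l ℕ.* 4 ℕ.+ (r₁ ℕ.* 8 ℕ.+ (r₂ ℕ.* 8 ℕ.+ (h ℕ.* 20 ℕ.+ q ℕ.* 4))))) ℕ.+
    (1 ℕ.+ q ℕ.* (12 ℕ.+ 64 ℕ.* (q ℕ.* (r₂ ℕ.* (r₁ ℕ.* r₁))) ℕ.* (26 ℕ.+ 8 ℕ.* (40 ℕ.+ 7 ℕ.* Δ))))

  timeConstant : ℕ
  timeConstant = 26143

  totalCost≤ : ∀ {Δ q l r₁ r₂ h} → 1 ℕ.≤ Δ → 1 ℕ.≤ q → 1 ℕ.≤ r₁ → 1 ℕ.≤ r₂ → h ℕ.≤ q →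
               totalCost Δ q l r₁ r₂ h ℕ.≤ timeConstant ℕ.* (r₂ ℕ.* (r₁ ℕ.* r₁) ℕ.* (Δ ℕ.^ 2 ℕ.* q ℕ.^ 3 ℕ.* (l ⊔ 1)))
  totalCost≤ {Δ} {q} {l} {r₁} {r₂} {h} 1≤Δ 1≤q 1≤r₁ 1≤r₂ h≤q = begin
    totalCost Δ q l r₁ r₂ h                      ≡⟨ expand Δ q l r₁ r₂ h ⟩
    359 ℕ.* 1 ℕ.+ 4 ℕ.* l ℕ.+ 8 ℕ.* r₁ ℕ.+ 8 ℕ.* r₂ ℕ.+ 20 ℕ.* h ℕ.+ 16 ℕ.* q ℕ.+ 22144 ℕ.*
        (q ℕ.* q ℕ.* (r₂ ℕ.* (r₁ ℕ.* r₁))) ℕ.+ 3584 ℕ.* (q ℕ.* q ℕ.* (r₂ ℕ.* (r₁ ℕ.* r₁)) ℕ.* Δ)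
      ≤⟨ ℕ.+-mono-≤ (ℕ.+-mono-≤ (ℕ.+-mono-≤ (ℕ.+-mono-≤ (ℕ.+-mono-≤ (ℕ.+-mono-≤ (ℕ.+-mono-≤
           (ℕ.*-monoʳ-≤ 359 1≤B) (ℕ.*-monoʳ-≤ 4 l≤B)) (ℕ.*-monoʳ-≤ 8 r₁≤B)) (ℕ.*-monoʳ-≤ 8 r₂≤B))
               (ℕ.*-monoʳ-≤ 20 (ℕ.≤-trans h≤q q≤B)))
           (ℕ.*-monoʳ-≤ 16 q≤B)) (ℕ.*-monoʳ-≤ 22144 qqR≤B)) (ℕ.*-monoʳ-≤ 3584 qqRΔ≤B) ⟩
    359 ℕ.* B ℕ.+ 4 ℕ.* B ℕ.+ 8 ℕ.* B ℕ.+ 8 ℕ.* B ℕ.+ 20 ℕ.* B ℕ.+ 16 ℕ.* B ℕ.+ 22144 ℕ.* B ℕ.+ 3584 ℕ.* B ≡⟨ collect B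
        ⟩
    timeConstant ℕ.* B                           ∎
    where
    open ℕ.≤-Reasoning
    B L : ℕ
    L = l ⊔ 1
    B = r₂ ℕ.* (r₁ ℕ.* r₁) ℕ.* (Δ ℕ.^ 2 ℕ.* q ℕ.^ 3 ℕ.* L)
    1≤L : 1 ℕ.≤ L
    1≤L = ℕ.m≤n⊔m l 1
    1≤* : ∀ {a b} → 1 ℕ.≤ a → 1 ℕ.≤ b → 1 ℕ.≤ a ℕ.* b
    1≤* = ℕ.*-mono-≤
    factor : ∀ {x} y → 1 ℕ.≤ y → x ℕ.* y ≡ B → x ℕ.≤ B
    factor {x} y 1≤y eq = ℕ.≤-trans (ℕ.≤-reflexive (sym (ℕ.*-identityʳ x)))
        (ℕ.≤-trans (ℕ.*-monoʳ-≤ x 1≤y) (ℕ.≤-reflexive eq))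
    qqRΔ≤B : q ℕ.* q ℕ.* (r₂ ℕ.* (r₁ ℕ.* r₁)) ℕ.* Δ ℕ.≤ B
    qqRΔ≤B = factor (Δ ℕ.* q ℕ.* L) (1≤* (1≤* 1≤Δ 1≤q) 1≤L) (lemma Δ q L r₁ r₂)
      where
      lemma : ∀ Δ q L r₁ r₂ → q ℕ.* q ℕ.* (r₂ ℕ.* (r₁ ℕ.* r₁)) ℕ.* Δ ℕ.* (Δ ℕ.* q ℕ.* L) ≡ r₂ ℕ.* (r₁ ℕ.* r₁) ℕ.*
          (Δ ℕ.* (Δ ℕ.* 1) ℕ.* (q ℕ.* (q ℕ.* (q ℕ.* 1))) ℕ.* L)
      lemma = ℕ-Ring.solve-∀
    qqR≤B : q ℕ.* q ℕ.* (r₂ ℕ.* (r₁ ℕ.* r₁)) ℕ.≤ B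
    qqR≤B = ℕ.≤-trans (ℕ.≤-reflexive (sym (ℕ.*-identityʳ _)))
        (ℕ.≤-trans (ℕ.*-monoʳ-≤ (q ℕ.* q ℕ.* (r₂ ℕ.* (r₁ ℕ.* r₁))) 1≤Δ) qqRΔ≤B)
    q≤B : q ℕ.≤ B
    q≤B = factor (r₂ ℕ.* (r₁ ℕ.* r₁) ℕ.* (Δ ℕ.* Δ) ℕ.* (q ℕ.* q) ℕ.* L)
        (1≤* (1≤* (1≤* (1≤* 1≤r₂ (1≤* 1≤r₁ 1≤r₁)) (1≤* 1≤Δ 1≤Δ)) (1≤* 1≤q 1≤q)) 1≤L) (lemma Δ q L r₁ r₂)
      where
      lemma : ∀ Δ q L r₁ r₂ → q ℕ.* (r₂ ℕ.* (r₁ ℕ.* r₁) ℕ.* (Δ ℕ.* Δ) ℕ.* (q ℕ.* q) ℕ.* L) ≡ r₂ ℕ.* (r₁ ℕ.* r₁) ℕ.*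
          (Δ ℕ.* (Δ ℕ.* 1) ℕ.* (q ℕ.* (q ℕ.* (q ℕ.* 1))) ℕ.* L)
      lemma = ℕ-Ring.solve-∀
    1≤B : 1 ℕ.≤ B
    1≤B = ℕ.≤-trans 1≤q q≤B
    r₁≤B : r₁ ℕ.≤ B
    r₁≤B = factor (r₂ ℕ.* r₁ ℕ.* (Δ ℕ.* Δ) ℕ.* (q ℕ.* q ℕ.* q) ℕ.* L)
        (1≤* (1≤* (1≤* (1≤* 1≤r₂ 1≤r₁) (1≤* 1≤Δ 1≤Δ)) (1≤* (1≤* 1≤q 1≤q) 1≤q)) 1≤L) (lemma Δ q L r₁ r₂)
      where
      lemma : ∀ Δ q L r₁ r₂ → r₁ ℕ.* (r₂ ℕ.* r₁ ℕ.* (Δ ℕ.* Δ) ℕ.* (q ℕ.* q ℕ.* q) ℕ.* L) ≡ r₂ ℕ.* (r₁ ℕ.* r₁) ℕ.*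
          (Δ ℕ.* (Δ ℕ.* 1) ℕ.* (q ℕ.* (q ℕ.* (q ℕ.* 1))) ℕ.* L)
      lemma = ℕ-Ring.solve-∀
    r₂≤B : r₂ ℕ.≤ B
    r₂≤B = factor (r₁ ℕ.* r₁ ℕ.* (Δ ℕ.* Δ) ℕ.* (q ℕ.* q ℕ.* q) ℕ.* L)
        (1≤* (1≤* (1≤* (1≤* 1≤r₁ 1≤r₁) (1≤* 1≤Δ 1≤Δ)) (1≤* (1≤* 1≤q 1≤q) 1≤q)) 1≤L) (lemma Δ q L r₁ r₂)
      where
      lemma : ∀ Δ q L r₁ r₂ → r₂ ℕ.* (r₁ ℕ.* r₁ ℕ.* (Δ ℕ.* Δ) ℕ.* (q ℕ.* q ℕ.* q) ℕ.* L) ≡ r₂ ℕ.* (r₁ ℕ.* r₁) ℕ.*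
          (Δ ℕ.* (Δ ℕ.* 1) ℕ.* (q ℕ.* (q ℕ.* (q ℕ.* 1))) ℕ.* L)
      lemma = ℕ-Ring.solve-∀
    l≤B : l ℕ.≤ B
    l≤B = ℕ.≤-trans (ℕ.m≤m⊔n l 1) (factor (r₂ ℕ.* (r₁ ℕ.* r₁) ℕ.* (Δ ℕ.* Δ) ℕ.* (q ℕ.* q ℕ.* q))
        (1≤* (1≤* (1≤* 1≤r₂ (1≤* 1≤r₁ 1≤r₁)) (1≤* 1≤Δ 1≤Δ)) (1≤* (1≤* 1≤q 1≤q) 1≤q)) (lemma Δ q L r₁ r₂))
      where
      lemma : ∀ Δ q L r₁ r₂ → L ℕ.* (r₂ ℕ.* (r₁ ℕ.* r₁) ℕ.* (Δ ℕ.* Δ) ℕ.* (q ℕ.* q ℕ.* q)) ≡ r₂ ℕ.* (r₁ ℕ.* r₁) ℕ.*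
          (Δ ℕ.* (Δ ℕ.* 1) ℕ.* (q ℕ.* (q ℕ.* (q ℕ.* 1))) ℕ.* L)
      lemma = ℕ-Ring.solve-∀
    expand : ∀ Δ q l r₁ r₂ h → (358 ℕ.+ (l ℕ.* 4 ℕ.+ (r₁ ℕ.* 8 ℕ.+ (r₂ ℕ.* 8 ℕ.+ (h ℕ.* 20 ℕ.+ q ℕ.* 4))))) ℕ.+
      (1 ℕ.+ q ℕ.* (12 ℕ.+ 64 ℕ.* (q ℕ.* (r₂ ℕ.* (r₁ ℕ.* r₁))) ℕ.* (26 ℕ.+ 8 ℕ.* (40 ℕ.+ 7 ℕ.* Δ)))) ≡
      359 ℕ.* 1 ℕ.+ 4 ℕ.* l ℕ.+ 8 ℕ.* r₁ ℕ.+ 8 ℕ.* r₂ ℕ.+ 20 ℕ.* h ℕ.+ 16 ℕ.* q ℕ.+ 22144 ℕ.*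
          (q ℕ.* q ℕ.* (r₂ ℕ.* (r₁ ℕ.* r₁))) ℕ.+ 3584 ℕ.* (q ℕ.* q ℕ.* (r₂ ℕ.* (r₁ ℕ.* r₁)) ℕ.* Δ)
    expand = ℕ-Ring.solve-∀
    collect : ∀ B → 359 ℕ.* B ℕ.+ 4 ℕ.* B ℕ.+ 8 ℕ.* B ℕ.+ 8 ℕ.* B ℕ.+ 20 ℕ.* B ℕ.+ 16 ℕ.* B ℕ.+ 22144 ℕ.* B ℕ.+ 3584 ℕ.*
        B ≡ 26143 ℕ.* B
    collect = ℕ-Ring.solve-∀

  scale-cost : ∀ c T r₁ r₂ Y {e d} → 0ℚ ≤ e → 0ℚ ≤ d → fromℕ r₁ ≤ fromℕ 2 * e → fromℕ r₂ ≤ fromℕ 2 * d →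
               T ℕ.≤ c ℕ.* (r₂ ℕ.* (r₁ ℕ.* r₁) ℕ.* Y) → fromℕ T ≤ fromℕ (c ℕ.* 8) * (e * e * d * fromℕ Y)
  scale-cost c T r₁ r₂ Y {e} {d} 0≤e 0≤d r₁≤ r₂≤ T≤ = begin
    fromℕ T                                          ≤⟨ fromℕ-mono T≤ ⟩
    fromℕ (c ℕ.* (r₂ ℕ.* (r₁ ℕ.* r₁) ℕ.* Y))         ≡⟨ fromℕ-* c (r₂ ℕ.* (r₁ ℕ.* r₁) ℕ.* Y) ⟩
    fromℕ c * fromℕ (r₂ ℕ.* (r₁ ℕ.* r₁) ℕ.* Y)       ≡⟨ cong (fromℕ c *_) (trans (fromℕ-* (r₂ ℕ.* (r₁ ℕ.* r₁)) Y)
                                                          (cong (_* fromℕ Y) (trans (fromℕ-* r₂ (r₁ ℕ.* r₁))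
                                                              (cong (R₂ *_) (fromℕ-* r₁ r₁))))) ⟩
    fromℕ c * (R₂ * (R₁ * R₁) * fromℕ Y)             ≤⟨ *-monoˡ {fromℕ c} (0≤fromℕ c)
        (*-monoʳ {fromℕ Y} {R₂ * (R₁ * R₁)} {E₂ * (E₁ * E₁)} (0≤fromℕ Y)
                                                          (*-mono {R₂} {E₂} {R₁ * R₁} {E₁ * E₁}
                                                              (0≤* (0≤fromℕ r₁) (0≤fromℕ r₁)) (0≤* (0≤fromℕ 2) 0≤d) r₂≤
                                                            (*-mono {R₁} {E₁} {R₁} {E₁} (0≤fromℕ r₁)
                                                                (0≤* (0≤fromℕ 2) 0≤e) r₁≤ r₁≤))) ⟩
    fromℕ c * (E₂ * (E₁ * E₁) * fromℕ Y)             ≡⟨ lemma (fromℕ c) d e (fromℕ Y) ⟩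
    fromℕ c * fromℕ 8 * (e * e * d * fromℕ Y)        ≡⟨ cong (_* (e * e * d * fromℕ Y)) (fromℕ-* c 8) ⟨
    fromℕ (c ℕ.* 8) * (e * e * d * fromℕ Y)          ∎
    where
    open ℚ.≤-Reasoning
    R₁ R₂ E₁ E₂ : ℚ
    R₁ = fromℕ r₁
    R₂ = fromℕ r₂
    E₁ = fromℕ 2 * e
    E₂ = fromℕ 2 * d
    lemma : ∀ c d e y → c * (fromℕ 2 * d * (fromℕ 2 * e * (fromℕ 2 * e)) * y) ≡ c * fromℕ 8 * (e * e * d * y)
    lemma = RingSolver.solve-∀ ℚ-ring

open Arithmetic

module Correctness where

  open import Data.Rational using (_+_; _*_; _-_; -_; _≤_; _<_)

  pick : {A : Set} → Dec A → ℚ → ℚ → ℚ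
  pick (yes _) x y = x
  pick (no  _) x y = y

  pick-elim : ∀ {A : Set} (P : ℚ → Set) (d : Dec A) {x y} → (A → P x) → (¬ A → P y) → P (pick d x y)
  pick-elim P (yes a) px py = px a
  pick-elim P (no ¬a) px py = py ¬a

  pick-yes : ∀ {A : Set} (d : Dec A) {x y} → A → pick d x y ≡ x
  pick-yes (yes _) a = refl
  pick-yes (no ¬a) a = contradiction a ¬a

  pick-no : ∀ {A : Set} (d : Dec A) {x y} → ¬ A → pick d x y ≡ y
  pick-no (yes a) ¬a = contradiction a ¬a
  pick-no (no _)  ¬a = refl

  record Task : Set₁ where
    field
      {n}         : ℕ
      {G}         : Graph n
      adj         : AdjacencyLists G
      q           : ℕ
      1≤Δ         : 1 ℕ.≤ Graph.maxDegree G
      65Δ≤q       : 65 ℕ.* Graph.maxDegree G ℕ.≤ q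
      σ           : PartialProperColoring G q
      v           : Fin n
      v∉Λ         : v ∉ PartialProperColoring.Λ σ
      ε δ e d     : ℚ
      0<ε         : 0ℚ < ε
      ε<1         : ε < 1ℚ
      0<δ         : 0ℚ < δ
      δ<1         : δ < 1ℚ
      εe≡1        : ε * e ≡ 1ℚ
      0≤e         : 0ℚ ≤ e
      δd≡1        : δ * d ≡ 1ℚ
      0≤d         : 0ℚ ≤ d
      ε₁ δ₁       : ℕ
      ε₁≡         : ℤ.∣ ↥ ε ∣ ≡ suc ε₁
      δ₁≡         : ℤ.∣ ↥ δ ∣ ≡ suc δ₁
      preparation : Setup.Preparation (oracle adj) (input q σ v ε δ) q ε₁ (↧ₙ ε) δ₁ (↧ₙ δ)

  module Analysis (task : Task) where

    open Task task
    open Setup (oracle adj) using (loaded; loaded-at; loaded-other; setupCost; module Preparation; module Prepared)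
    open Preparation preparation
    open Prepared prepared
    open PartialProperColoring σ using (entries; Λ) renaming (unique to Λ-unique)
    open AdjacencyLists adj using (neighbors; correct)
    open Counting G q using (Z)
    open Conditioning G adj q 1≤Δ 65Δ≤q using (Δ; Z-pin; Z-blocked; Represents; module Represents)
    open Scan adj using (Blocked)

    m₀ : Memory
    m₀ = input q σ v ε δ

    start : Config
    start = algorithm ∷ [] , m₀

    15≤q : 15 ℕ.≤ q
    15≤q = ℕ.≤-trans (ℕ.≤-trans (ℕ.m≤m+n 15 50) (ℕ.*-monoʳ-≤ 65 1≤Δ)) 65Δ≤q

    16h≤q : 16 ℕ.* h ℕ.≤ q
    16h≤q = ℕ.≤-trans (ℕ.≤-reflexive (ℕ.*-comm 16 h)) (ℕ.≤-trans h-upper (ℕ.≤-reflexive (ℕ.m∸n+n≡m 15≤q)))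

    q≤16h+15 : q ℕ.≤ 16 ℕ.* h ℕ.+ 15
    q≤16h+15 = ℕ.≤-trans (ℕ.≤-reflexive (sym (ℕ.m∸n+n≡m 15≤q)))
        (ℕ.+-monoˡ-≤ 15 (ℕ.≤-trans h-lower (ℕ.≤-reflexive (ℕ.*-comm h 16))))

    4Δ≤h : 4 ℕ.* Δ ℕ.≤ h
    4Δ≤h = ℕ.≮⇒≥ λ h<4Δ → ℕ.<-irrefl refl (begin-strict
      q                        ≤⟨ q≤16h+15 ⟩
      16 ℕ.* h ℕ.+ 15          <⟨ ℕ.+-monoʳ-< (16 ℕ.* h) (ℕ.n<1+n 15) ⟩
      16 ℕ.* h ℕ.+ 16          ≡⟨ ℕ.+-comm (16 ℕ.* h) 16 ⟩
      16 ℕ.+ 16 ℕ.* h          ≡⟨ ℕ.*-suc 16 h ⟨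
      16 ℕ.* suc h             ≤⟨ ℕ.*-monoʳ-≤ 16 h<4Δ ⟩
      16 ℕ.* (4 ℕ.* Δ)         ≡⟨ ℕ.*-assoc 16 4 Δ ⟨
      64 ℕ.* Δ                 ≤⟨ ℕ.*-monoˡ-≤ Δ (ℕ.n≤1+n 64) ⟩
      65 ℕ.* Δ                 ≤⟨ 65Δ≤q ⟩
      q                        ∎)
      where open ℕ.≤-Reasoning

    q≤20h : q ℕ.≤ 20 ℕ.* h
    q≤20h = begin
      q                        ≤⟨ q≤16h+15 ⟩
      16 ℕ.* h ℕ.+ 15          ≤⟨ ℕ.+-monoʳ-≤ (16 ℕ.* h)
          (ℕ.≤-trans (ℕ.n≤1+n 15) (ℕ.*-monoʳ-≤ 4 (ℕ.≤-trans (ℕ.*-monoʳ-≤ 4 1≤Δ) 4Δ≤h))) ⟩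
      16 ℕ.* h ℕ.+ 4 ℕ.* h     ≡⟨ ℕ.*-distribʳ-+ h 16 4 ⟨
      20 ℕ.* h                 ∎
      where open ℕ.≤-Reasoning

    V A : ℕ → ℕ
    V = entry (map (toℕ ∘ proj₁) entries)
    A = entry (map (toℕ ∘ proj₂) entries)

    p₀ : ℕ → ℕ
    p₀ = loaded V A (length entries) (const 0)

    represents : Represents σ p₀
    represents = record
      { pinned = λ {u} {a} ua∈ → let k , k< , u≡ , a≡ = entry-∈ (toℕ ∘ proj₁) (toℕ ∘ proj₂) ua∈ in
          trans (cong p₀ (sym u≡))
              (trans (loaded-at V A (length entries) (const 0) (entry-distinct entries Λ-unique) k k<) (cong suc a≡))
      ; free = λ {u} u∉ → loaded-other V A (length entries) (const 0) (toℕ u) λ k k< eq →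
          let ua , ua∈ , eq′ = entry-index (toℕ ∘ proj₁) entries k k< in
          u∉ (subst (_∈ Λ) (Fin.toℕ-injective (trans (sym eq′) eq)) (∈-map⁺ proj₁ ua∈))
      }

    open Represents represents using (bounded; 0<Z; marginal-Z) renaming (free to p₀-free)

    ζ : ℚ
    ζ = 1/1+ (Z p₀ ∸ 1)

    0≤ζ : 0ℚ ≤ ζ
    0≤ζ = 0≤1/suc (Z p₀ ∸ 1)

    Zζ≡1 : fromℕ (Z p₀) * ζ ≡ 1ℚ
    Zζ≡1 = trans (cong (λ z → fromℕ z * ζ) (sym (ℕ.suc-pred (Z p₀) {{ℕ.>-nonZero 0<Z}}))) (1/suc-inverse (Z p₀ ∸ 1))

    pv≡0 : p₀ (toℕ v) ≡ 0
    pv≡0 = p₀-free v∉Λ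

    inst : Instance
    inst = record
      { G = G ; adj = adj ; q = q ; H = h ; 1≤Δ = 1≤Δ ; 65Δ≤q = 65Δ≤q ; 4Δ≤H = 4Δ≤h ; 16H≤q = 16h≤q
      ; p₀ = p₀ ; p₀≤q = bounded ; ζ = ζ ; 0≤ζ = 0≤ζ ; Zζ≡1 = Zζ≡1 }

    open Values inst using (unit; color; toℕ-color; 0<q; 0<H)

    blocked? : ∀ k → Dec (Blocked p₀ (suc k) (neighbors v))
    blocked? k = any? (λ u → p₀ (toℕ u) ℕ.≟ suc k) (neighbors v)

    a : ℕ → ℚ
    a k = pick (blocked? k) 0ℚ 1ℚ

    N D₀ : ℕ
    N = 64 ℕ.* (q ℕ.* (r₂ ℕ.* (r₁ ℕ.* r₁)))
    D₀ = 4 ℕ.* h ℕ.* N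

    p₁ : ℕ → ℕ → ℕ
    p₁ k = p₀ [ toℕ v ↦ suc k ]

    module Run (rew : Reward) (w : ℕ → ℚ) (0≤w : ∀ k → 0ℚ ≤ w k) where

      open Reward rew
      open Value (oracle adj) rew using (value; path-bound)
      open Walking inst rew using (g-pinned≤1)
      open Errors inst v N a w 0≤w using (g₁; past; future)
      open Estimating inst rew v pv≡0 N D₀ a w 0≤w using (hueCost; main-bounded)

      g≤a : ∀ k → k ℕ.< q → g₁ k ≤ a k
      g≤a k k<q = pick-elim (g₁ k ≤_) (blocked? k)
        (λ blocked → ℚ.≤-reflexive
            (trans (cong (λ z → fromℕ z * unit 1) (Z-blocked {p₁ k} {v} {color k} v-pinned (transfer blocked)))
            (ℚ.*-zeroˡ (unit 1))))
        (λ _ → g-pinned≤1 {p₁ k} v (color k) v-pinned (↦-undo {p₀} (toℕ v) (suc k) pv≡0))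
        where
        v-pinned : p₁ k (toℕ v) ≡ suc (toℕ (color k))
        v-pinned = trans (↦-same p₀ (toℕ v) (suc k)) (cong suc (sym (toℕ-color k<q)))
        transfer : Blocked p₀ (suc k) (neighbors v) → Any (λ u → p₁ k (toℕ u) ≡ suc (toℕ (color k))) (neighbors v)
        transfer blocked = let u , u∈ , eq = find blocked in lose u∈
          (trans (↦-other p₀ {toℕ v} {toℕ u} (suc k) (λ u≡v → Graph.irrefl G (sym (Fin.toℕ-injective u≡v))
              (Equivalence.to (correct v u) u∈)))
            (trans eq (cong suc (sym (toℕ-color k<q)))))

      run-bounded : (∀ m → m Out 0 ≡ D₀ → φ m ≤ past m 0 q) → ∀ t →
                    value start t ≤ fromℕ (totalCost Δ q (length entries) r₁ r₂ h) * κ + future q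
      run-bounded final t = ℚ.≤-trans
        (path-bound path (main-bounded
          (λ k → pick-elim (0ℚ ≤_) (blocked? k) (λ _ → ℚ.≤-refl) (λ _ → ℚ.<⇒≤ (ℚ.positive⁻¹ 1ℚ)))
          (λ k → pick-elim (_≤ 1ℚ) (blocked? k) (λ _ → ℚ.<⇒≤ (ℚ.positive⁻¹ 1ℚ)) (λ _ → ℚ.≤-refl))
          g≤a (λ k _ → pick-no (blocked? k)) final q 0 memory t (ℕ.+-identityʳ q) hue≡
          (at input≡ 2 , at input≡ 3 , total≡ , h≡ , 4h≡ , 16h≡ , 2h≡ , den≡) (at col≡)) t ℕ.≤-refl)
        (ℚ.≤-reflexive (trans (lemma (fromℕ S) κ (fromℕ M) (future q))
            (cong (λ z → z * κ + future q) (sym (fromℕ-+ S M)))))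
        where
        S M : ℕ
        S = setupCost (length entries) r₁ r₂ h q
        M = 1 ℕ.+ q ℕ.* hueCost
        lemma : ∀ s κ m f → s * κ + (κ * m + (f + 0ℚ)) ≡ (s + m) * κ + f
        lemma = RingSolver.solve-∀ ℚ-ring

    ν : ℚ
    ν = 1/1+ (N ∸ 1)

    ε-bounds : 1ℚ ≤ fromℕ r₁ * ε × fromℕ r₁ ≤ fromℕ 2 * e
    ε-bounds = ceiling-bounds r₁ 0<ε ε<1 εe≡1 0≤e (subst (λ z → ↧ₙ ε ℕ.≤ r₁ ℕ.* z) (sym ε₁≡) ε-lower)
      (subst (λ z → r₁ ℕ.* z ℕ.≤ ↧ₙ ε ℕ.+ z) (sym ε₁≡) (ℕ.≤-trans ε-upper (ℕ.+-monoʳ-≤ (↧ₙ ε) (ℕ.n≤1+n ε₁))))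

    δ-bounds : 1ℚ ≤ fromℕ r₂ * δ × fromℕ r₂ ≤ fromℕ 2 * d
    δ-bounds = ceiling-bounds r₂ 0<δ δ<1 δd≡1 0≤d (subst (λ z → ↧ₙ δ ℕ.≤ r₂ ℕ.* z) (sym δ₁≡) δ-lower)
      (subst (λ z → r₂ ℕ.* z ℕ.≤ ↧ₙ δ ℕ.+ z) (sym δ₁≡) (ℕ.≤-trans δ-upper (ℕ.+-monoʳ-≤ (↧ₙ δ) (ℕ.n≤1+n δ₁))))

    0<r : ∀ {r ε} → 1ℚ ≤ fromℕ r * ε → 0 ℕ.< r
    0<r {zero}  {ε} 1≤ = ⊥-elim
        (ℚ.<-irrefl refl (ℚ.<-≤-trans (ℚ.positive⁻¹ 1ℚ) (ℚ.≤-trans 1≤ (ℚ.≤-reflexive (ℚ.*-zeroˡ ε)))))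
    0<r {suc r} _ = z<s

    0<r₁ : 0 ℕ.< r₁
    0<r₁ = 0<r {r₁} {ε} (proj₁ ε-bounds)

    0<r₂ : 0 ℕ.< r₂
    0<r₂ = 0<r {r₂} {δ} (proj₁ δ-bounds)

    0<N : 0 ℕ.< N
    0<N = ℕ.*-mono-≤ {1} {64} (s≤s z≤n) (ℕ.*-mono-≤ 0<q (ℕ.*-mono-≤ 0<r₂ (ℕ.*-mono-≤ 0<r₁ 0<r₁)))

    Nν≡1 : fromℕ N * ν ≡ 1ℚ
    Nν≡1 = trans (cong (λ z → fromℕ z * ν) (sym (ℕ.suc-pred N {{ℕ.>-nonZero 0<N}}))) (1/suc-inverse (N ∸ 1))

    0≤ν : 0ℚ ≤ ν
    0≤ν = 0≤1/suc (N ∸ 1)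

    -- Chebyshev's weight 1 / (ε N g)², with g replaced by its lower bound 1/8.
    ω : ℚ
    ω = fromℕ 64 * ((e * ν) * (e * ν))

    w₁ : ℕ → ℚ
    w₁ k = pick (blocked? k) 1ℚ ω

    0≤ω : 0ℚ ≤ ω
    0≤ω = 0≤* (0≤fromℕ 64) (0≤p² (e * ν))

    0≤w₁ : ∀ k → 0ℚ ≤ w₁ k
    0≤w₁ k = pick-elim (0ℚ ≤_) (blocked? k) (λ _ → ℚ.<⇒≤ (ℚ.positive⁻¹ 1ℚ)) (λ _ → 0≤ω)

    time≤T : ∀ t → Value.value (oracle adj) timeReward start t ≤ fromℕ (totalCost Δ q (length entries) r₁ r₂ h)
    time≤T t = ℚ.≤-trans (Run.run-bounded timeReward (const 0ℚ) (λ _ → ℚ.≤-refl)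
        (λ m _ → Errors.0≤past inst v N a (const 0ℚ) (λ _ → ℚ.≤-refl) m 0 q) t)
        (ℚ.≤-reflexive (trans (cong (fromℕ T * 1ℚ +_) (future-zero q)) (lemma (fromℕ T))))
      where
      T : ℕ
      T = totalCost Δ q (length entries) r₁ r₂ h
      lemma : ∀ t → t * 1ℚ + 0ℚ ≡ t
      lemma = RingSolver.solve-∀ ℚ-ring
      future-zero : ∀ k → Errors.future inst v N a (const 0ℚ) (λ _ → ℚ.≤-refl) k ≡ 0ℚ
      future-zero zero    = refl
      future-zero (suc k) = trans (cong₂ _+_ (ℚ.*-zeroˡ (fromℕ N * a k)) (future-zero k)) (ℚ.+-identityˡ 0ℚ)

    time-bounded : ∀ t → expectedSteps (oracle adj) start t ≤ fromℕ (totalCost Δ q (length entries) r₁ r₂ h)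
    time-bounded t = ℚ.≤-trans (expectedSteps≤time (oracle adj) start t) (time≤T t)

    open Errors inst v N a w₁ 0≤w₁ using (g₁; 0≤g₁; Nℚ; error; past; 0≤past; error≤past; future)

    φ : Memory → ℚ
    φ m = pick (m Out 0 ℕ.≟ D₀) (past m 0 q) 1ℚ

    0≤φ : ∀ m → 0ℚ ≤ φ m
    0≤φ m = pick-elim (0ℚ ≤_) (m Out 0 ℕ.≟ D₀) (λ _ → 0≤past m 0 q) (λ _ → ℚ.<⇒≤ (ℚ.positive⁻¹ 1ℚ))

    D : ℚ
    D = fromℕ D₀

    0<D : 0ℚ < D
    0<D = 0<fromℕ {D₀} (ℕ.*-mono-≤ {1} {4 ℕ.* h} (ℕ.*-mono-≤ {1} {4} (s≤s z≤n) 0<H) 0<N)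

    D*marginal : ∀ c → D * marginal G q σ v c ≡ Nℚ * g₁ (toℕ c)
    D*marginal c = begin
      D * π                                        ≡⟨ cong (_* π) (fromℕ-* (4 ℕ.* h) N) ⟩
      W * Nℚ * π                                   ≡⟨ lemma₁ W Nℚ π ⟩
      Nℚ * (π * 1ℚ * W)                            ≡⟨ cong (λ z → Nℚ * (π * z * W)) Zζ≡1 ⟨
      Nℚ * (π * (fromℕ (Z p₀) * ζ) * W)            ≡⟨ lemma₂ Nℚ π (fromℕ (Z p₀)) ζ W ⟩
      Nℚ * (π * fromℕ (Z p₀) * (W * ζ))            ≡⟨ cong (λ z → Nℚ * (z * (W * ζ))) (marginal-Z v c v∉Λ) ⟩
      Nℚ * g₁ (toℕ c)                              ∎
      where
      open ≡-Reasoning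
      π W : ℚ
      π = marginal G q σ v c
      W = fromℕ (4 ℕ.* h)
      lemma₁ : ∀ W N π → W * N * π ≡ N * (π * 1ℚ * W)
      lemma₁ = RingSolver.solve-∀ ℚ-ring
      lemma₂ : ∀ N π z ζ W → N * (π * (z * ζ) * W) ≡ N * (π * z * (W * ζ))
      lemma₂ = RingSolver.solve-∀ ℚ-ring

    1≤8g : ∀ k → k ℕ.< q → ¬ Blocked p₀ (suc k) (neighbors v) → 1ℚ ≤ fromℕ 8 * g₁ k
    1≤8g k k<q free = begin
      1ℚ                                           ≡⟨ Zζ≡1 ⟨
      fromℕ (Z p₀) * ζ                             ≤⟨ *-monoʳ 0≤ζ (fromℕ-mono Z≤) ⟩
      fromℕ (8 ℕ.* (Z (p₁ k) ℕ.* (4 ℕ.* h))) * ζ   ≡⟨ cong (_* ζ) (trans (fromℕ-* 8 (Z (p₁ k) ℕ.* (4 ℕ.* h)))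
          (cong (fromℕ 8 *_) (fromℕ-* (Z (p₁ k)) (4 ℕ.* h)))) ⟩
      fromℕ 8 * (fromℕ (Z (p₁ k)) * fromℕ (4 ℕ.* h)) * ζ ≡⟨ lemma (fromℕ 8) (fromℕ (Z (p₁ k))) (fromℕ (4 ℕ.* h)) ζ ⟩
      fromℕ 8 * g₁ k                               ∎
      where
      open ℚ.≤-Reasoning
      lemma : ∀ e z w ζ → e * (z * w) * ζ ≡ e * (z * (w * ζ))
      lemma = RingSolver.solve-∀ ℚ-ring
      k≡ : suc (toℕ (color k)) ≡ suc k
      k≡ = cong suc (toℕ-color k<q)
      pin : 63 ℕ.* Z p₀ ℕ.≤ 64 ℕ.* (q ℕ.* Z (p₁ k))
      pin = subst (λ j → 63 ℕ.* Z p₀ ℕ.≤ 64 ℕ.* (q ℕ.* Z (p₀ [ toℕ v ↦ j ]))) k≡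
        (Z-pin p₀ v (color k) (free ∘ subst (λ j → Blocked p₀ j (neighbors v)) k≡) bounded pv≡0)
      Z≤ : Z p₀ ℕ.≤ 8 ℕ.* (Z (p₁ k) ℕ.* (4 ℕ.* h))
      Z≤ = ℕ.*-cancelˡ-≤ 40 (ℕ.≤-trans (ℕ.*-monoˡ-≤ (Z p₀) (ℕ.m≤m+n 40 23)) (ℕ.≤-trans pin
        (ℕ.≤-trans (ℕ.*-monoʳ-≤ 64 (ℕ.*-monoˡ-≤ (Z (p₁ k)) q≤20h)) (ℕ.≤-reflexive (rearrange h (Z (p₁ k)))))))
        where
        rearrange : ∀ h z → 64 ℕ.* (20 ℕ.* h ℕ.* z) ≡ 40 ℕ.* (8 ℕ.* (z ℕ.* (4 ℕ.* h)))
        rearrange = ℕ-Ring.solve-∀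

    1≤square : ∀ {x} → 1ℚ ≤ x → 1ℚ ≤ square x
    1≤square {x} 1≤x = ℚ.≤-trans 1≤x (ℚ.≤-trans (ℚ.≤-reflexive (sym (ℚ.*-identityʳ x)))
      (*-monoˡ {x} {1ℚ} {x} (ℚ.≤-trans (ℚ.<⇒≤ (ℚ.positive⁻¹ 1ℚ)) 1≤x) 1≤x))

    Far : ℚ → ℚ → Set
    Far S M = (S < (1ℚ - ε) * M) ⊎ ((1ℚ + ε) * M < S)

    far-square : ∀ {S M} → 0ℚ ≤ M → Far S M → square (ε * M) ≤ square (S - M)
    far-square {S} {M} 0≤M (inj₁ S<) =
        0≤q-p⇒p≤q (subst (0ℚ ≤_) (lemma S M ε) (0≤* 0≤x (0≤+ 0≤x (0≤* (0≤fromℕ 2) (0≤* (ℚ.<⇒≤ 0<ε) 0≤M)))))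
      where
      0≤x : 0ℚ ≤ (1ℚ - ε) * M - S
      0≤x = p≤q⇒0≤q-p (ℚ.<⇒≤ S<)
      lemma : ∀ S M ε → ((1ℚ - ε) * M - S) * ((1ℚ - ε) * M - S + fromℕ 2 * (ε * M)) ≡ (S - M) * (S - M) - (ε * M) *
          (ε * M)
      lemma = RingSolver.solve-∀ ℚ-ring
    far-square {S} {M} 0≤M (inj₂ <S) =
        0≤q-p⇒p≤q (subst (0ℚ ≤_) (lemma S M ε) (0≤* 0≤x (0≤+ 0≤x (0≤* (0≤fromℕ 2) (0≤* (ℚ.<⇒≤ 0<ε) 0≤M)))))
      where
      0≤x : 0ℚ ≤ S - (1ℚ + ε) * M
      0≤x = p≤q⇒0≤q-p (ℚ.<⇒≤ <S)
      lemma : ∀ S M ε → (S - (1ℚ + ε) * M) * (S - (1ℚ + ε) * M + fromℕ 2 * (ε * M)) ≡ (S - M) * (S - M) - (ε * M) *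
          (ε * M)
      lemma = RingSolver.solve-∀ ℚ-ring

    far-error : ∀ s k → k ℕ.< q → (b : Dec (Blocked p₀ (suc k) (neighbors v))) → g₁ k ≤ pick b 0ℚ 1ℚ →
                Far (fromℕ s) (Nℚ * g₁ k) → 1ℚ ≤ pick b 1ℚ ω * square (fromℕ s - Nℚ * g₁ k)
    far-error s k k<q (no free) g≤ far = begin
      1ℚ                                           ≤⟨ 1≤square (1≤8g k k<q free) ⟩
      square (fromℕ 8 * g₁ k)                      ≡⟨ lemma₁ (g₁ k) ⟩
      fromℕ 64 * (square (1ℚ * 1ℚ) * square (g₁ k)) ≡⟨ cong₂ (λ x y → fromℕ 64 * (square (x * y) * square (g₁ k))) εe≡1
          Nν≡1 ⟨
      fromℕ 64 * (square (ε * e * (Nℚ * ν)) * square (g₁ k)) ≡⟨ lemma₂ (fromℕ 64) ε e Nℚ ν (g₁ k) ⟩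
      ω * square (ε * (Nℚ * g₁ k))                 ≤⟨ *-monoˡ 0≤ω
          (far-square {fromℕ s} {Nℚ * g₁ k} (0≤* (0≤fromℕ N) (0≤g₁ k)) far) ⟩
      ω * square (fromℕ s - Nℚ * g₁ k)             ∎
      where
      open ℚ.≤-Reasoning
      lemma₁ : ∀ g → fromℕ 8 * g * (fromℕ 8 * g) ≡ fromℕ 64 * (1ℚ * 1ℚ * (1ℚ * 1ℚ) * (g * g))
      lemma₁ = RingSolver.solve-∀ ℚ-ring
      lemma₂ : ∀ c ε e N ν g → c * (ε * e * (N * ν) * (ε * e * (N * ν)) * (g * g)) ≡ c * (e * ν * (e * ν)) *
          (ε * (N * g) * (ε * (N * g)))
      lemma₂ = RingSolver.solve-∀ ℚ-ring
    far-error s k k<q (yes _) g≤ far = subst (λ M → 1ℚ ≤ 1ℚ * square (fromℕ s - M)) (sym M≡0)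
        (positive s (subst (Far (fromℕ s)) M≡0 far))
      where
      M≡0 : Nℚ * g₁ k ≡ 0ℚ
      M≡0 = trans (cong (Nℚ *_) (ℚ.≤-antisym g≤ (0≤g₁ k))) (ℚ.*-zeroʳ Nℚ)
      lemma : ∀ x → 1ℚ * ((x - 0ℚ) * (x - 0ℚ)) ≡ x * x
      lemma = RingSolver.solve-∀ ℚ-ring
      positive : ∀ s → Far (fromℕ s) 0ℚ → 1ℚ ≤ 1ℚ * square (fromℕ s - 0ℚ)
      positive zero    (inj₁ <0) = ⊥-elim (ℚ.<-irrefl (sym (ℚ.*-zeroʳ (1ℚ - ε))) <0)
      positive zero    (inj₂ 0<) = ⊥-elim (ℚ.<-irrefl (ℚ.*-zeroʳ (1ℚ + ε)) 0<)
      positive (suc s) _ = ℚ.≤-trans (1≤square (fromℕ-mono {1} {suc s} (s≤s z≤n)))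
          (ℚ.≤-reflexive (sym (lemma (fromℕ (suc s)))))

    inaccurate : ∀ m → m Out 0 ≡ D₀ → ¬ Accurate ε (marginal G q σ v) m → 1ℚ ≤ past m 0 q
    inaccurate m den≡ ¬accurate = decide (Fin.all? close?)
      where
      S M : Fin q → ℚ
      S c = fromℕ (m Out (suc (toℕ c)))
      M c = Nℚ * g₁ (toℕ c)
      Close : Fin q → Set
      Close c = (1ℚ - ε) * M c ≤ S c × S c ≤ (1ℚ + ε) * M c
      close? : Decidable Close
      close? c = ((1ℚ - ε) * M c ℚ.≤? S c) ×-dec (S c ℚ.≤? (1ℚ + ε) * M c)
      D*estimate : ∀ c → D * estimate m c ≡ S c
      D*estimate c = trans (ℚ.*-comm D (estimate m c)) (trans (cong (λ z → estimate m c * fromℕ z) (sym den≡))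
        (÷₀-* (S c) {fromℕ (m Out 0)} (subst (λ z → 0ℚ < fromℕ z) (sym den≡) 0<D)))
      scaled : ∀ x c → D * (x * marginal G q σ v c) ≡ x * M c
      scaled x c = trans (lemma D x (marginal G q σ v c)) (cong (x *_) (D*marginal c))
        where
        lemma : ∀ D x μ → D * (x * μ) ≡ x * (D * μ)
        lemma = RingSolver.solve-∀ ℚ-ring
      accurate : (∀ c → Close c) → Accurate ε (marginal G q σ v) m
      accurate close c =
        *-cancelˡ-≤ 0<D (subst₂ _≤_ (sym (scaled (1ℚ - ε) c)) (sym (D*estimate c)) (proj₁ (close c))) ,
        *-cancelˡ-≤ 0<D (subst₂ _≤_ (sym (D*estimate c)) (sym (scaled (1ℚ + ε) c)) (proj₂ (close c)))
      far : ∀ c → ¬ Close c → Far (S c) (M c)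
      far c ¬close = case (1ℚ - ε) * M c ℚ.≤? S c of λ where
        (no ≰)  → inj₁ (ℚ.≰⇒> ≰)
        (yes ≤) → inj₂ (ℚ.≰⇒> (λ ≤′ → ¬close (≤ , ≤′)))
      decide : Dec (∀ c → Close c) → 1ℚ ≤ past m 0 q
      decide (yes close) = ⊥-elim (¬accurate (accurate close))
      decide (no ¬close) = let c , ¬closeᶜ = Fin.¬∀⟶∃¬ q Close close? ¬close in
        ℚ.≤-trans (far-error (m Out (suc (toℕ c))) (toℕ c) (Fin.toℕ<n c) (blocked? (toℕ c))
                    (Run.g≤a (finalReward φ 0≤φ) w₁ 0≤w₁ (toℕ c) (Fin.toℕ<n c)) (far c ¬closeᶜ))
          (error≤past m 0 q (toℕ c) z≤n (Fin.toℕ<n c))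

    future≤δ : future q ≤ δ
    future≤δ = ℚ.≤-trans (future≤ q) (*-cancelˡ-≤ (0<fromℕ 0<N) (begin
      Nℚ * (fromℕ q * x)                           ≡⟨ lemma₁ Nℚ (fromℕ q) e ν ⟩
      fromℕ 64 * fromℕ q * (e * e) * (Nℚ * ν)      ≡⟨ cong (fromℕ 64 * fromℕ q * (e * e) *_) Nν≡1 ⟩
      fromℕ 64 * fromℕ q * (e * e) * 1ℚ            ≤⟨ *-mono {fromℕ 64 * fromℕ q * (e * e)}
          {fromℕ 64 * fromℕ q * (R₁ * R₁)} {1ℚ} {R₂ * δ}
                                                        (ℚ.<⇒≤ (ℚ.positive⁻¹ 1ℚ))
                                                            (0≤* (0≤* (0≤fromℕ 64) (0≤fromℕ q)) (0≤* 0≤R₁ 0≤R₁))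
                                                        (*-monoˡ {fromℕ 64 * fromℕ q} {e * e} {R₁ * R₁}
                                                            (0≤* (0≤fromℕ 64) (0≤fromℕ q)) (*-mono 0≤e 0≤R₁ e≤R₁ e≤R₁))
                                                            (proj₁ δ-bounds) ⟩
      fromℕ 64 * fromℕ q * (R₁ * R₁) * (R₂ * δ)    ≡⟨ lemma₂ (fromℕ 64) (fromℕ q) R₁ R₂ δ ⟩
      fromℕ 64 * (fromℕ q * (R₂ * (R₁ * R₁))) * δ  ≡⟨ cong (_* δ) N≡ ⟨
      Nℚ * δ                                       ∎))
      where
      open ℚ.≤-Reasoning
      R₁ R₂ x : ℚ
      R₁ = fromℕ r₁
      R₂ = fromℕ r₂
      x = fromℕ 64 * (e * e) * ν
      0≤R₁ : 0ℚ ≤ R₁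
      0≤R₁ = 0≤fromℕ r₁
      N≡ : Nℚ ≡ fromℕ 64 * (fromℕ q * (R₂ * (R₁ * R₁)))
      N≡ = trans (fromℕ-* 64 (q ℕ.* (r₂ ℕ.* (r₁ ℕ.* r₁)))) (cong (fromℕ 64 *_) (trans (fromℕ-* q (r₂ ℕ.* (r₁ ℕ.* r₁)))
             (cong (fromℕ q *_) (trans (fromℕ-* r₂ (r₁ ℕ.* r₁)) (cong (R₂ *_) (fromℕ-* r₁ r₁))))))
      e≤R₁ : e ≤ R₁
      e≤R₁ = begin
        e              ≡⟨ ℚ.*-identityˡ e ⟨
        1ℚ * e         ≤⟨ *-monoʳ {e} {1ℚ} {R₁ * ε} 0≤e (proj₁ ε-bounds) ⟩
        R₁ * ε * e     ≡⟨ ℚ.*-assoc R₁ ε e ⟩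
        R₁ * (ε * e)   ≡⟨ cong (R₁ *_) εe≡1 ⟩
        R₁ * 1ℚ        ≡⟨ ℚ.*-identityʳ R₁ ⟩
        R₁             ∎
      lemma₁ : ∀ N q e ν → N * (q * (fromℕ 64 * (e * e) * ν)) ≡ fromℕ 64 * q * (e * e) * (N * ν)
      lemma₁ = RingSolver.solve-∀ ℚ-ring
      lemma₂ : ∀ c q a b δ → c * q * (a * a) * (b * δ) ≡ c * (q * (b * (a * a))) * δ
      lemma₂ = RingSolver.solve-∀ ℚ-ring
      0≤x : 0ℚ ≤ x
      0≤x = 0≤* (0≤* (0≤fromℕ 64) (0≤p² e)) 0≤ν
      term : ∀ {A : Set} (b : Dec A) → pick b 1ℚ ω * (Nℚ * pick b 0ℚ 1ℚ) ≤ x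
      term (yes _) = ℚ.≤-trans (ℚ.≤-reflexive (trans (ℚ.*-identityˡ (Nℚ * 0ℚ)) (ℚ.*-zeroʳ Nℚ))) 0≤x
      term (no _)  = ℚ.≤-reflexive
          (trans (lemma₃ (fromℕ 64) e ν Nℚ) (trans (cong (fromℕ 64 * (e * e) * ν *_) Nν≡1) (ℚ.*-identityʳ x)))
        where
        lemma₃ : ∀ c e ν N → c * (e * ν * (e * ν)) * (N * 1ℚ) ≡ c * (e * e) * ν * (N * ν)
        lemma₃ = RingSolver.solve-∀ ℚ-ring
      future≤ : ∀ k → future k ≤ fromℕ k * x
      future≤ zero    = ℚ.≤-reflexive (sym (ℚ.*-zeroˡ x))
      future≤ (suc k) = ℚ.≤-trans (ℚ.+-mono-≤ (term (blocked? k)) (future≤ k))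
        (ℚ.≤-reflexive (trans (lemma₄ x (fromℕ k)) (cong (_* x) (sym (fromℕ-+ 1 k)))))
        where
        lemma₄ : ∀ x k → x + k * x ≡ (1ℚ + k) * x
        lemma₄ = RingSolver.solve-∀ ℚ-ring

    success : (1ℚ - δ) ≤sup haltProbability (oracle adj) (accurate? ε (marginal G q σ v)) start
    success = haltProbability≥ (oracle adj) (accurate? ε (marginal G q σ v)) φ 0≤φ
      (λ m ¬accurate → pick-elim (1ℚ ≤_) (m Out 0 ℕ.≟ D₀) (λ den≡ → inaccurate m den≡ ¬accurate) (λ _ → ℚ.≤-refl))
      start δ T
      (λ t → ℚ.≤-trans (Run.run-bounded (finalReward φ 0≤φ) w₁ 0≤w₁ (λ m den≡ →
          ℚ.≤-reflexive (pick-yes (m Out 0 ℕ.≟ D₀) den≡)) t)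
        (ℚ.≤-trans (ℚ.≤-reflexive (lemma T (future q))) future≤δ))
      time≤T
      where
      T : ℚ
      T = fromℕ (totalCost Δ q (length entries) r₁ r₂ h)
      lemma : ∀ t f → t * 0ℚ + f ≡ f
      lemma = RingSolver.solve-∀ ℚ-ring

    time-bound : ∀ t → expectedSteps (oracle adj) start t ≤ fromℕ (timeConstant ℕ.* 8) *
        (e * e * d * fromℕ (Δ ℕ.^ 2 ℕ.* q ℕ.^ 3 ℕ.* (length Λ ⊔ 1)))
    time-bound t = ℚ.≤-trans (time-bounded t)
      (subst (λ l → fromℕ T ≤ fromℕ (timeConstant ℕ.* 8) * (e * e * d * fromℕ (Δ ℕ.^ 2 ℕ.* q ℕ.^ 3 ℕ.* (l ⊔ 1))))
          (sym (List.length-map proj₁ entries))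
        (scale-cost timeConstant T r₁ r₂ (Δ ℕ.^ 2 ℕ.* q ℕ.^ 3 ℕ.* (length entries ⊔ 1)) 0≤e 0≤d (proj₂ ε-bounds)
            (proj₂ δ-bounds)
          (totalCost≤ {Δ} {q} {length entries} {r₁} {r₂} {h} 1≤Δ 0<q 0<r₁ 0<r₂
              (ℕ.≤-trans (ℕ.m≤m+n h (15 ℕ.* h)) 16h≤q))))
      where
      T : ℕ
      T = totalCost Δ q (length entries) r₁ r₂ h

open Correctness

open import Data.Nat using (_≤_; _*_)
open import Data.Product using (∃₂; _×_; _,_)

theorem1p7 : ∃₂ λ (algorithm : Stmt) (C : ℕ) →
    ∀ {n : ℕ} (G : Graph n) (adj : AdjacencyLists G) (q : ℕ) →
    let Δ = Graph.maxDegree G in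
    1 ≤ Δ → 65 * Δ ≤ q →
    ∀ (σ : PartialProperColoring G q) →
    let Λ = PartialProperColoring.Λ σ in
    ∀ (v : Fin n) → v ∉ Λ →
    ∀ (ε δ : ℚ) .{{_ : Positive ε}} .{{_ : Positive δ}} → ε ℚ.< 1ℚ → δ ℚ.< 1ℚ →
    let start = algorithm ∷ [] , input q σ v ε δ
        O = oracle adj
    in ((1ℚ ℚ.- δ) ≤sup haltProbability O (accurate? ε (marginal G q σ v)) start)
     × (sup (expectedSteps O start) ≤ (fromℕ C ℚ.* timeBound ε δ Δ q (length Λ)))
theorem1p7 = algorithm , timeConstant * 8 , λ {n} G adj q 1≤Δ 65Δ≤q σ v v∉Λ ε δ ε<1 δ<1 →
  let 0<ε = ℚ.positive⁻¹ ε
      0<δ = ℚ.positive⁻¹ δ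
      ε≡ = sym (ℕ.suc-pred ℤ.∣ ↥ ε ∣ {{ℕ.>-nonZero (0<↥p 0<ε)}})
      δ≡ = sym (ℕ.suc-pred ℤ.∣ ↥ δ ∣ {{ℕ.>-nonZero (0<↥p 0<δ)}})
      task : Task
      task = record
        { adj = adj ; q = q ; 1≤Δ = 1≤Δ ; 65Δ≤q = 65Δ≤q ; σ = σ ; v = v ; v∉Λ = v∉Λ
        ; ε = ε ; δ = δ ; e = (1/ ε) {{ℚ.pos⇒nonZero ε}} ; d = (1/ δ) {{ℚ.pos⇒nonZero δ}}
        ; 0<ε = 0<ε ; ε<1 = ε<1 ; 0<δ = 0<δ ; δ<1 = δ<1
        ; εe≡1 = ℚ.*-inverseʳ ε {{ℚ.pos⇒nonZero ε}} ; 0≤e = ℚ.<⇒≤ (ℚ.positive⁻¹ _ {{ℚ.1/pos⇒pos ε}})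
        ; δd≡1 = ℚ.*-inverseʳ δ {{ℚ.pos⇒nonZero δ}} ; 0≤d = ℚ.<⇒≤ (ℚ.positive⁻¹ _ {{ℚ.1/pos⇒pos δ}})
        ; ε₁≡ = ε≡ ; δ₁≡ = δ≡
        ; preparation = Setup.prepare (oracle adj) (input q σ v ε δ) q _ _ _ _ refl ε≡ refl δ≡ refl
        }
  in Analysis.success task , Analysis.time-bound task
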